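{- Let $n\ge 3$ be an integer. If a prime graph has an induced path of length $\lceil 6.75 n^7\rceil$, then it has a vertex-minor isomorphic to a cycle of length $n$.
   Context: All graphs are finite, simple and undirected; the length of a path is its number of edges. For a vertex $v$ of a graph $G$, the local complementation $G*v$ flips the adjacency of every pair of neighbors of $v$. A graph $H$ is a vertex-minor of $G$ if $H$ is an induced subgraph of a graph obtained from $G$ by a sequence of local complementations. A split of $G$ is a partition $(A,B)$ of $V(G)$ with $|A|,|B|\ge 2$ such that there are $A'\subseteq A$, $B'\subseteq B$ with $a\in A$ adjacent to $b\in B$ if and only if $a\in A'$ and $b\in B'$; $G$ is prime if it has no split. -}

module Defs where

open import Data.Nat using (ℕ; zero; suc; _+_; _*_; _^_; _≤_; _/_)
open import Data.Fin using (Fin; toℕ)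
open import Data.Fin.Subset using (Subset; _∈_; _∉_; ∣_∣; ∁)
open import Data.Bool using (Bool; true; false; _∧_; _xor_; not; if_then_else_)
open import Data.Product using (Σ; _×_; ∃; ∃-syntax; _,_)
open import Data.List using (List; []; _∷_; foldl)
open import Relation.Binary.PropositionalEquality using (_≡_; _≢_)
open import Relation.Nullary using (¬_; Dec; yes; no)
open import Data.Fin.Properties using (_≟_)
open import Function using (Injective)

record Graph : Set where
  field
    m     : ℕ
    adj   : Fin m → Fin m → Bool
    sym   : ∀ u v → adj u v ≡ adj v u
    irref : ∀ u → adj u u ≡ false
open Graph public

lcAdj : ∀ {m} → (Fin m → Fin m → Bool) → Fin m → Fin m → Fin m → Bool
lcAdj a v x y with x ≟ y
... | yes _ = a x y
... | no  _ = a x y xor (a v x ∧ a v y)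

-- Result of a sequence of local complementations, applied in list order
-- (on the bare adjacency function; symmetry and irreflexivity are preserved).
lcSeq : ∀ {m} → (Fin m → Fin m → Bool) → List (Fin m) → Fin m → Fin m → Bool
lcSeq a []       = a
lcSeq a (v ∷ vs) = lcSeq (lcAdj a v) vs

cycleAdj : (n : ℕ) → Fin n → Fin n → Bool
cycleAdj n i j = isSucc (toℕ i) (toℕ j) ∨' isSucc (toℕ j) (toℕ i)
  where
  _∨'_ : Bool → Bool → Bool
  true  ∨' _ = true
  false ∨' b = b
  eqℕ : ℕ → ℕ → Bool
  eqℕ zero zero = true
  eqℕ (suc a) (suc b) = eqℕ a b
  eqℕ _ _ = false
  isSucc : ℕ → ℕ → Bool
  isSucc a b = eqℕ (suc a) b ∨' (eqℕ (suc a) n ∧ eqℕ b zero)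

InducedCopy : ∀ {m} (k : ℕ) (h : Fin k → Fin k → Bool) (a : Fin m → Fin m → Bool) → Set
InducedCopy {m} k h a =
  Σ (Fin k → Fin m) λ f → Injective _≡_ _≡_ f × (∀ i j → a (f i) (f j) ≡ h i j)

HasCycleVertexMinor : Graph → ℕ → Set
HasCycleVertexMinor G n =
  Σ (List (Fin (m G))) λ vs → InducedCopy n (cycleAdj n) (lcSeq (adj G) vs)

pathAdj : (L : ℕ) → Fin (suc L) → Fin (suc L) → Bool
pathAdj L i j = succ (toℕ i) (toℕ j) ∨'' succ (toℕ j) (toℕ i)
  where
  _∨''_ : Bool → Bool → Bool
  true  ∨'' _ = true
  false ∨'' b = b
  succ : ℕ → ℕ → Bool
  succ a zero = false
  succ zero (suc zero) = true
  succ zero (suc (suc _)) = false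
  succ (suc a) (suc b) = succ a b

HasInducedPath : Graph → ℕ → Set
HasInducedPath G L = InducedCopy (suc L) (pathAdj L) (adj G)

Split : (G : Graph) → Subset (m G) → Set
Split G A =
  2 ≤ ∣ A ∣ × 2 ≤ ∣ ∁ A ∣ ×
  Σ (Subset (m G)) λ A' → Σ (Subset (m G)) λ B' →
    (∀ x → x ∈ A' → x ∈ A) × (∀ y → y ∈ B' → y ∉ A) ×
    (∀ x y → x ∈ A → y ∉ A → (adj G x y ≡ true → x ∈ A' × y ∈ B')
                           × (x ∈ A' → y ∈ B' → adj G x y ≡ true))

Prime : Graph → Set
Prime G = ∀ A → ¬ Split G A

-- ⌈ 6.75 n^7 ⌉ = ⌈ 27 n^7 / 4 ⌉ = ⌊ (27 n^7 + 3) / 4 ⌋.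
bound : ℕ → ℕ
bound n = (27 * n ^ 7 + 3) / 4

{-# OPTIONS --safe #-}
module Submission where

-- Let P be the path and U a minimal vertex set containing its two end edges S and T such that the
-- cut-rank connectivity between S and T inside U is still 2. By minimality the tight cuts form a
-- lattice in which each step adds one vertex, so U has a linear layout all of whose prefixes have
-- cut-rank 2. After local complementations every vertex acts on the later ones through its type in
-- F₂⁴, and a vertex's type recurs only after a type not commuting with it. If U is large,
-- pigeonhole yields a long alternating subword X Y X Y …; local complementations at three vertices
-- at each end make the induced subgraph on it a half-graph-like zigzag, and complementing this at
-- its vertices in order produces the cycle.
--
-- If U is small, then either a vertex of U has two far apart neighbours on P, or some long block
-- of P has no neighbours in U. In both cases a linked pair of edges is found for which every
-- minimal set contains a long stretch of P, and the first case applies to it.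

open import Defs
open import Data.Bool using (Bool; true; false; _∧_; _∨_; _xor_; not; if_then_else_)
open import Data.Bool.ListAction using (any)
open import Data.Bool.Properties using (∧-zeroʳ; ∧-identityʳ; ∨-comm) renaming (_≟_ to _≟ᵇ_)
open import Data.Empty using (⊥; ⊥-elim)
open import Data.Fin using (Fin; toℕ; fromℕ<; zero; suc; inject≤)
open import Data.Fin.Properties using (_≟_; toℕ-injective; toℕ<n; all?; any?; injective⇒≤; toℕ-fromℕ<; inject≤-injective)
open import Data.Fin.Subset using (Subset; ∣_∣) renaming (_∈_ to _∈ₛ_; _∉_ to _∉ₛ_)
open import Data.Fin.Subset.Properties using (anySubset?; x∈p⇒∣p-x∣<∣p∣; x∈p∧x≢y⇒x∈p-y; x∉p⇒x∈∁p)
open import Data.List using (List; []; _∷_; map; allFin; filter; length; filterᵇ; cartesianProduct; concatMap; _++_; _∷ʳ_; initLast; _∷ʳ′_; lookup)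
open import Data.List.Membership.Propositional using (_∈_; find; _∉_)
open import Data.List.Membership.Propositional.Properties using (∈-allFin; ∈-filter⁺; ∈-filter⁻; ∈-lookup; ∈-++⁺ˡ; ∈-++⁺ʳ; ∈-map⁺; ∈-cartesianProduct⁺)
open import Data.List.Properties using (filter-notAll; length-++; length-map)
open import Data.List.Relation.Unary.All as All using (All; []; _∷_)
open import Data.List.Relation.Unary.All.Properties using (¬All⇒Any¬)
open import Data.List.Relation.Unary.AllPairs using (AllPairs; []; _∷_)
open import Data.List.Relation.Unary.Any as Any using (Any; here; there; index)
open import Data.List.Relation.Unary.Any.Properties using (lookup-index)
open import Data.List.Relation.Unary.Unique.Propositional using (Unique)
open import Data.List.Relation.Unary.Unique.Propositional.Properties using (allFin⁺) renaming (filter⁺ to unique-filter)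
open import Data.Nat using (ℕ; zero; suc; _+_; _*_; _^_; _≤_; _<_; z≤n; s≤s; _∸_; _/_; _≡ᵇ_; s≤s⁻¹; _≤?_; ⌊_/2⌋; pred) renaming (_≟_ to _≟ℕ_)
open import Data.Nat.DivMod using (m≡m%n+[m/n]*n; m%n<n; /-monoˡ-≤; m*n/n≡m; m/n*n≤m)
open import Data.Nat.ListAction using (sum)
open import Data.Nat.Properties using (≤-refl; ≤-trans; <-trans; <⇒≢; <-cmp; n<1+n; +-suc; +-identityʳ; m≤m+n; ≤-<-trans; <-≤-trans; <⇒≤; n≤1+n; m≤n⇒m<n∨m≡n; <-irrefl; +-monoʳ-<; <-asym; +-comm; m∸n+n≡m; +-mono-≤; m≤n+m; ≤-reflexive; ≰⇒>; <⇒≱; +-monoˡ-≤; +-monoʳ-≤; +-assoc; ⌊n/2⌋+⌈n/2⌉≡n; ⌊n/2⌋≤⌈n/2⌉; *-distribˡ-+; *-monoʳ-≤; *-distribʳ-+; anyUpTo?; +-cancelˡ-≡; m⊓n≤n; m≤n⇒m⊓n≡m; *-mono-≤; *-monoˡ-≤; ^-monoˡ-≤; *-cancelʳ-<; ≤-antisym; module ≤-Reasoning; pred[n]≤n; *-identityʳ)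
open import Data.Nat.Tactic.RingSolver using (solve-∀)
open import Data.Product using (Σ; _×_; _,_; proj₁; proj₂)
open import Data.Sum using (_⊎_; inj₁; inj₂)
open import Data.Unit using (⊤; tt)
open import Data.Vec as Vec using (Vec; []; _∷_; tabulate)
open import Data.Vec.Properties using (lookup∘tabulate; []=⇒lookup; lookup⇒[]=)
open import Function using (_∘_; Injective)
open import Relation.Binary.Definitions using (tri<; tri≈; tri>)
open import Relation.Binary.PropositionalEquality using (_≡_; _≢_; refl; trans; cong; cong₂; subst) renaming (sym to ≡sym)
open import Relation.Nullary using (¬_; Dec; yes; no; does)
open import Relation.Nullary.Decidable using (_×-dec_; _→-dec_; map′; ¬?; from-yes; decidable-stable)
open import Data.List.Membership.DecPropositional _≟ℕ_ using (_∈?_)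

-- Local complementation

-- Minimality enters through deletion: `U` without `v` has a separating cut of rank at most 1, so
-- `v` can join either side at rank 2, and cut-rank is submodular. In the straightened layout the
-- adjacency of an earlier to a later vertex is a bilinear function of their types, and its
-- dependence on the order is the alternating form `ω`. Complementing at an end adds a symmetric
-- form in the adjacencies to that end, so `ω` stays fixed and only the quadratic form on the
-- diagonal can be adjusted. A zigzag on `X` and `Y` needs `ω X Y` and the value 1 at both letters.
-- The two vertices of an end need not yield every symmetric form, hence a third one at each end.
--
-- A minimal set need not follow the path, since edges off the path can shortcut it; its size has to
-- be forced separately. The 15 · 8 ordered pairs of non-commuting types make "large" mean
-- `60 * n + 23`. Blocks of the path have about that length and a small set spoils at most two of
-- them per vertex, so a path of length quadratic in `n` is enough. This is below the stated bound
-- only from `n = 5` on; the cycles of length 3 and 4 are made from an induced path of length 3.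

Adj : ℕ → Set
Adj m = Fin m → Fin m → Bool

HasC : ∀ {m} → Adj m → ℕ → Set
HasC {m} a n = Σ (List (Fin m)) λ vs → InducedCopy n (cycleAdj n) (lcSeq a vs)

hasC-lc : ∀ {m} {a : Adj m} {n} v → HasC (lcAdj a v) n → HasC a n
hasC-lc v (vs , c) = v ∷ vs , c

true≢false : ∀ {b} → b ≡ true → b ≡ false → ⊥
true≢false refl ()

∧-true : ∀ {a b} → a ∧ b ≡ true → a ≡ true × b ≡ true
∧-true {true} {true} _ = refl , refl

_⇔ᵇ_ : Bool → Bool → Bool
true ⇔ᵇ b = b
false ⇔ᵇ b = not b

⇔ᵇ-sound : ∀ a b → a ⇔ᵇ b ≡ true → a ≡ b
⇔ᵇ-sound true true _ = refl
⇔ᵇ-sound false false _ = refl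

⇔ᵇ-complete : ∀ {a b} → a ≡ b → a ⇔ᵇ b ≡ true
⇔ᵇ-complete {true} refl = refl
⇔ᵇ-complete {false} refl = refl

allᵇ : ∀ n → (Vec Bool n → Bool) → Bool
allᵇ zero f = f []
allᵇ (suc n) f = allᵇ n (λ v → f (true ∷ v)) ∧ allᵇ n (λ v → f (false ∷ v))

allᵇ-sound : ∀ n f → allᵇ n f ≡ true → ∀ v → f v ≡ true
allᵇ-sound zero f p [] = p
allᵇ-sound (suc n) f p (true ∷ v) = allᵇ-sound n _ (proj₁ (∧-true p)) v
allᵇ-sound (suc n) f p (false ∷ v) = allᵇ-sound n _ (proj₂ (∧-true p)) v

-- Identities over the two-element field are proved by evaluating all assignments, so the hypothesis
-- is closed by `refl`. The vector given last lists the terms that are treated as atoms.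
taut : ∀ n (f g : Vec Bool n → Bool) → allᵇ n (λ v → f v ⇔ᵇ g v) ≡ true → ∀ v → f v ≡ g v
taut n f g p v = ⇔ᵇ-sound (f v) (g v) (allᵇ-sound n (λ v → f v ⇔ᵇ g v) p v)

F₂² : Set
F₂² = Bool × Bool

dot : F₂² → F₂² → Bool
dot (a , b) (c , d) = (a ∧ c) xor (b ∧ d)

record IsGraph {m} (a : Adj m) : Set where
  constructor isGraph
  field
    symm : ∀ x y → a x y ≡ a y x
    irr  : ∀ x → a x x ≡ false
open IsGraph public

lc-≢ : ∀ {m} (a : Adj m) v {x y} → x ≢ y → lcAdj a v x y ≡ a x y xor (a v x ∧ a v y)
lc-≢ a v {x} {y} x≢y with x ≟ y
... | yes p = ⊥-elim (x≢y p)
... | no _ = refl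

lc-diag : ∀ {m} (a : Adj m) v x → lcAdj a v x x ≡ a x x
lc-diag a v x with x ≟ x
... | yes _ = refl
... | no q = ⊥-elim (q refl)

lc-graph : ∀ {m} {a : Adj m} v → IsGraph a → IsGraph (lcAdj a v)
lc-graph {a = a} v g = isGraph sy (λ x → trans (lc-diag a v x) (irr g x))
  where
  sy : ∀ x y → lcAdj a v x y ≡ lcAdj a v y x
  sy x y with x ≟ y | y ≟ x
  ... | yes p | yes q = symm g x y
  ... | yes p | no q = ⊥-elim (q (≡sym p))
  ... | no p | yes q = ⊥-elim (p (≡sym q))
  ... | no p | no q rewrite symm g x y =
    taut 3 (λ { (b ∷ c ∷ d ∷ []) → b xor (c ∧ d) }) (λ { (b ∷ c ∷ d ∷ []) → b xor (d ∧ c) }) refl (a y x ∷ a v x ∷ a v y ∷ [])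

lc-row : ∀ {m} {a : Adj m} v → IsGraph a → ∀ y → lcAdj a v v y ≡ a v y
lc-row {a = a} v g y with v ≟ y
... | yes _ = refl
... | no _ rewrite irr g v = taut 1 (λ { (b ∷ []) → b xor false }) (λ { (b ∷ []) → b }) refl (a v y ∷ [])

lc-col : ∀ {m} {a : Adj m} v → IsGraph a → ∀ y → lcAdj a v y v ≡ a y v
lc-col {a = a} v g y = trans (symm (lc-graph v g) y v) (trans (lc-row v g y) (symm g v y))

lc-involutive : ∀ {m} {a : Adj m} v → IsGraph a → ∀ x y → lcAdj (lcAdj a v) v x y ≡ a x y
lc-involutive {a = a} v g x y with x ≟ y
... | yes refl = lc-diag a v x
... | no p rewrite lc-≢ a v p | lc-row v g x | lc-row v g y =
  taut 2 (λ { (b ∷ c ∷ []) → (b xor c) xor c }) (λ { (b ∷ c ∷ []) → b }) refl (a x y ∷ (a v x ∧ a v y) ∷ [])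

-- The helper functions inside cycleAdj and pathAdj are local to Defs, so their
-- bodies are recovered by unification: abstracting the numerical arguments
-- makes each underscore below a pattern-unification problem.
mutual
  path-body : ∀ L (i j : Fin (suc L)) (x y : ℕ) → Bool
  path-body L i j x y = _
  path-body-spec : ∀ L (i j : Fin (suc L)) → pathAdj L i j ≡ path-body L i j (toℕ i) (toℕ j)
  path-body-spec L i j with toℕ i | toℕ j
  ... | x | y = refl

path-body-≡ : ∀ L i j x y → path-body L i j x y ≡ (suc x ≡ᵇ y) ∨ (suc y ≡ᵇ x)
path-body-≡ L i j zero zero = refl
path-body-≡ L i j zero (suc zero) = refl
path-body-≡ L i j zero (suc (suc y)) = refl
path-body-≡ L i j (suc zero) zero = refl
path-body-≡ L i j (suc (suc x)) zero = refl
path-body-≡ L i j (suc x) (suc y) = path-body-≡ L i j x y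

pathAdj-≡ : ∀ L (i j : Fin (suc L)) → pathAdj L i j ≡ (suc (toℕ i) ≡ᵇ toℕ j) ∨ (suc (toℕ j) ≡ᵇ toℕ i)
pathAdj-≡ L i j = trans (path-body-spec L i j) (path-body-≡ L i j (toℕ i) (toℕ j))

mutual
  cyc-body : ∀ n (i j : Fin n) (x' y x y' : ℕ) → Bool
  cyc-body n i j x' y x y' = _
  cyc-body-spec : ∀ n (i j : Fin n) → cycleAdj n i j ≡ cyc-body n i j (suc (toℕ i)) (toℕ j) (toℕ i) (suc (toℕ j))
  cyc-body-spec n i j with ℕ.suc (toℕ i) | ℕ.suc (toℕ j)
  ... | x' | y' with toℕ i | toℕ j
  ... | x | y = refl

module _ (k : ℕ) (i j : Fin (suc k)) where

  private
    -- The arguments `0` and `1` make the first disjunct of the body false. What is left is the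
    -- hidden equality test in `inner`, and the hidden wrap-around test in `last`.
    inner : ℕ → ℕ → Bool
    inner w x = cyc-body (suc k) i j 0 1 (suc x) (suc w)

    last : ℕ → Bool
    last w = cyc-body (suc k) i j 0 1 0 (suc w)

    inner-s0 : ∀ w → inner (suc w) 0 ≡ false
    inner-s0 w = ∧-zeroʳ _

    inner-01 : inner 0 1 ≡ false
    inner-01 = ∧-zeroʳ _

    inner-suc : ∀ w x → inner (suc w) (suc x) ≡ inner w x
    inner-suc zero x rewrite inner-s0 zero | inner-01 = refl
    inner-suc (suc w) x rewrite inner-s0 (suc w) | inner-s0 w = refl

    inner-≡ : ∀ w x → inner w x ≡ (w ≡ᵇ x)
    inner-≡ zero zero = refl
    inner-≡ zero (suc x) = ∧-zeroʳ _
    inner-≡ (suc w) zero = ∧-zeroʳ _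
    inner-≡ (suc w) (suc x) = trans (inner-suc w x) (inner-≡ w x)

    -- Unification supplies the hidden equality test without the trailing conjunction with `true`,
    -- so that a `with` can abstract it.
    last-name : ∀ w → Σ Bool λ b → last w ≡ b
    last-name w = _ , ∧-identityʳ _

    last-≡ : ∀ w → last w ≡ (w ≡ᵇ k)
    last-≡ w with proj₁ (last-name w) | inner-≡ w k
    ... | true | e = e
    ... | false | e = e

  cycleAdj-0s : toℕ i ≡ 0 → ∀ y → toℕ j ≡ suc y → cycleAdj (suc k) i j ≡ (0 ≡ᵇ y) ∨ (suc y ≡ᵇ k)
  cycleAdj-0s p y q = trans (cyc-body-spec (suc k) i j) (trans (cong₂ (λ a b → cyc-body (suc k) i j (suc a) b a (suc b)) p q) (g y))
    where
    g : ∀ y → cyc-body (suc k) i j 1 (suc y) 0 (suc (suc y)) ≡ (0 ≡ᵇ y) ∨ (suc y ≡ᵇ k)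
    g zero = refl
    g (suc y) rewrite inner-≡ 0 (suc y) = last-≡ (suc (suc y))

  cycleAdj-ss : ∀ x y → toℕ i ≡ suc x → toℕ j ≡ suc y → cycleAdj (suc k) i j ≡ (suc x ≡ᵇ y) ∨ (suc y ≡ᵇ x)
  cycleAdj-ss x y p q = trans (cyc-body-spec (suc k) i j) (trans (cong₂ (λ a b → cyc-body (suc k) i j (suc a) b a (suc b)) p q) g)
    where
    g : cyc-body (suc k) i j (suc (suc x)) (suc y) (suc x) (suc (suc y)) ≡ (suc x ≡ᵇ y) ∨ (suc y ≡ᵇ x)
    g rewrite inner-≡ (suc x) y | inner-≡ (suc y) x with suc x ≡ᵇ y
    ... | true = refl
    ... | false = refl

  cycleAdj-s0 : ∀ x → toℕ i ≡ suc x → toℕ j ≡ 0 → cycleAdj (suc k) i j ≡ (suc x ≡ᵇ k) ∨ (0 ≡ᵇ x)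
  cycleAdj-s0 x p q = trans (cyc-body-spec (suc k) i j) (trans (cong₂ (λ a b → cyc-body (suc k) i j (suc a) b a (suc b)) p q) g)
    where
    g : cyc-body (suc k) i j (suc (suc x)) 0 (suc x) 1 ≡ (suc x ≡ᵇ k) ∨ (0 ≡ᵇ x)
    g rewrite last-≡ (suc x) | inner-≡ 0 x with suc x ≡ᵇ k
    ... | true = refl
    ... | false = refl

  cycleAdj-00 : toℕ i ≡ 0 → toℕ j ≡ 0 → cycleAdj (suc k) i j ≡ (0 ≡ᵇ k)
  cycleAdj-00 p q = trans (cyc-body-spec (suc k) i j) (trans (cong₂ (λ a b → cyc-body (suc k) i j (suc a) b a (suc b)) p q) g)
    where
    g : cyc-body (suc k) i j 1 0 0 1 ≡ (0 ≡ᵇ k)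
    g rewrite last-≡ 0 with 0 ≡ᵇ k
    ... | true = refl
    ... | false = refl

-- Zigzag graphs

≡ᵇ-refl : ∀ x → (x ≡ᵇ x) ≡ true
≡ᵇ-refl zero = refl
≡ᵇ-refl (suc x) = ≡ᵇ-refl x

≢⇒≡ᵇ-false : ∀ {x y} → x ≢ y → (x ≡ᵇ y) ≡ false
≢⇒≡ᵇ-false {zero} {zero} p = ⊥-elim (p refl)
≢⇒≡ᵇ-false {zero} {suc y} p = refl
≢⇒≡ᵇ-false {suc x} {zero} p = refl
≢⇒≡ᵇ-false {suc x} {suc y} p = ≢⇒≡ᵇ-false (p ∘ cong suc)

ev : ℕ → Bool
ev zero = true
ev (suc n) = not (ev n)

module Zigzag {m} (n : ℕ) (z : ℕ → Fin m) (inj : ∀ {i j} → i < n → j < n → z i ≡ z j → i ≡ j) where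

  private
    z≢ : ∀ {i j} → i < j → j < n → z i ≢ z j
    z≢ i<j j<n e = <⇒≢ i<j (inj (<-trans i<j j<n) j<n e)

  -- The vertices `0` to `K` induce a cycle closed by the edge `0 K`. Only the two ends of that edge
  -- see the tail that is still to be absorbed: `z K` sees all of it, `z 0` every other vertex.
  -- Inside the tail, adjacency is decided by the parity of the earlier vertex.
  record Inv (a : Adj m) (K : ℕ) : Set where
    field
      step : ∀ i → i < K → a (z i) (z (suc i)) ≡ true
      far  : ∀ i j → suc i < j → j ≤ K → 0 < i ⊎ j < K → a (z i) (z j) ≡ false
      clos : a (z 0) (z K) ≡ true
      hub  : ∀ d → suc K + d < n → a (z 0) (z (suc K + d)) ≡ ev d
      head : ∀ d → suc K + d < n → a (z K) (z (suc K + d)) ≡ true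
      mid  : ∀ i d → 0 < i → i < K → suc K + d < n → a (z i) (z (suc K + d)) ≡ false
      rest : ∀ i j → i < j → suc K + j < n → a (z (suc K + i)) (z (suc K + j)) ≡ ev i
  open Inv

  -- Local complementation at vertex number K + 1 opens the cycle 0 … K at the
  -- edge 0 K and closes it again through K + 1.
  extend : ∀ {a K} → IsGraph a → 2 ≤ K → suc K < n → Inv a K → Inv (lcAdj a (z (suc K))) (suc K)
  extend {a} {K} g 2≤K k<n I = record
    { step = step' ; far = far' ; clos = trans (lc-col _ g (z 0)) nb0 ; hub = hub' ; head = head' ; mid = mid' ; rest = rest' }
    where
    k = suc K
    K0 : k + 0 ≡ k
    K0 = +-identityʳ k
    k0<n : k + 0 < n
    k0<n = subst (_< n) (≡sym K0) k<n
    at0 : (x : Fin m) {b : Bool} → a x (z (k + 0)) ≡ b → a x (z k) ≡ b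
    at0 x {b} = subst (λ w → a x (z w) ≡ b) K0
    nb0 : a (z 0) (z k) ≡ true
    nb0 = at0 (z 0) (hub I 0 k0<n)
    nbK : a (z K) (z k) ≡ true
    nbK = at0 (z K) (head I 0 k0<n)
    nbm : ∀ i → 0 < i → i < K → a (z i) (z k) ≡ false
    nbm i p q = at0 (z i) (mid I i 0 p q k0<n)
    nbr : ∀ d → suc k + d < n → a (z k) (z (suc k + d)) ≡ true
    nbr d q = trans (cong₂ (λ u w → a (z u) (z w)) (≡sym K0) (≡sym (+-suc k d))) (rest I 0 (suc d) (s≤s z≤n) (subst (_< n) (≡sym (+-suc k d)) q))
    flip : ∀ {i j} → i < j → j < n → lcAdj a (z k) (z i) (z j) ≡ a (z i) (z j) xor (a (z k) (z i) ∧ a (z k) (z j))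
    flip i<j j<n = lc-≢ a (z k) (z≢ i<j j<n)
    val : ∀ {i j b c d} → i < j → j < n → a (z i) (z j) ≡ b → a (z k) (z i) ≡ c → a (z k) (z j) ≡ d → lcAdj a (z k) (z i) (z j) ≡ b xor (c ∧ d)
    val p q refl refl refl = flip p q
    sy : ∀ {x y b} → a x y ≡ b → a y x ≡ b
    sy {x} {y} e = trans (symm g y x) e
    xor-true : ∀ b → not b xor true ≡ b
    xor-true true = refl
    xor-true false = refl
    ∧-false : ∀ c → false xor (c ∧ false) ≡ false
    ∧-false true = refl
    ∧-false false = refl
    K<n : K < n
    K<n = <-trans (n<1+n K) k<n
    step' : ∀ i → i < k → lcAdj a (z k) (z i) (z (suc i)) ≡ true
    step' i i<k with m≤n⇒m<n∨m≡n (s≤s⁻¹ i<k)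
    ... | inj₂ refl = trans (lc-col (z k) g (z i)) nbK
    step' zero i<k | inj₁ i<K = trans (val (s≤s z≤n) (≤-<-trans i<K K<n) (step I 0 i<K) (sy nb0) (sy (nbm 1 (s≤s z≤n) 2≤K))) refl
    step' (suc i) i<k | inj₁ i<K = val (n<1+n _) (≤-<-trans i<K K<n) (step I (suc i) i<K) (sy (nbm (suc i) (s≤s z≤n) i<K)) refl
    far' : ∀ i j → suc i < j → j ≤ k → 0 < i ⊎ j < k → lcAdj a (z k) (z i) (z j) ≡ false
    far' i j p q r with m≤n⇒m<n∨m≡n q
    far' i j p q (inj₁ 0<i) | inj₂ refl = trans (lc-col (z k) g (z i)) (nbm i 0<i (s≤s⁻¹ p))
    far' i j p q (inj₂ j<k) | inj₂ refl = ⊥-elim (<-irrefl refl j<k)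
    far' zero j p q r | inj₁ j<k with m≤n⇒m<n∨m≡n (s≤s⁻¹ j<k)
    -- The old closing edge: both of its ends are neighbours of `z k`, so it disappears.
    ... | inj₂ refl = val (<-trans (n<1+n 0) p) K<n (clos I) (sy nb0) (sy nbK)
    ... | inj₁ j<K = trans (val (<-trans (n<1+n 0) p) (<-trans j<K K<n) (far I 0 j p (<⇒≤ j<K) (inj₂ j<K)) refl (sy (nbm j (<-trans (n<1+n 0) p) j<K))) (∧-false _)
    far' (suc i) j p q r | inj₁ j<k = val (<-trans (n<1+n _) p) (≤-<-trans (s≤s⁻¹ j<k) K<n) (far I (suc i) j p (s≤s⁻¹ j<k) (inj₁ (s≤s z≤n))) (sy (nbm (suc i) (s≤s z≤n) (<-≤-trans (<-trans (n<1+n _) p) (s≤s⁻¹ j<k)))) refl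
    far0 : ∀ {d} i → i ≤ k → i < suc k + d
    far0 {d} i p = s≤s (≤-trans p (m≤m+n k d))
    hub' : ∀ d → suc k + d < n → lcAdj a (z k) (z 0) (z (suc k + d)) ≡ ev d
    hub' d q = trans (val (s≤s z≤n) q (subst (λ w → a (z 0) (z w) ≡ ev (suc d)) (+-suc k d) (hub I (suc d) (subst (_< n) (≡sym (+-suc k d)) q))) (sy nb0) (nbr d q)) (xor-true (ev d))
    head' : ∀ d → suc k + d < n → lcAdj a (z k) (z k) (z (suc k + d)) ≡ true
    head' d q = trans (lc-row (z k) g _) (nbr d q)
    mid' : ∀ i d → 0 < i → i < k → suc k + d < n → lcAdj a (z k) (z i) (z (suc k + d)) ≡ false
    mid' i d p i<k q with m≤n⇒m<n∨m≡n (s≤s⁻¹ i<k)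
    ... | inj₁ i<K = val (far0 i (<⇒≤ i<k)) q (subst (λ w → a (z i) (z w) ≡ false) (+-suc k d) (mid I i (suc d) p i<K (subst (_< n) (≡sym (+-suc k d)) q))) (sy (nbm i p i<K)) refl
    ... | inj₂ refl = val (far0 i (<⇒≤ i<k)) q (subst (λ w → a (z i) (z w) ≡ true) (+-suc k d) (head I (suc d) (subst (_< n) (≡sym (+-suc k d)) q))) (sy nbK) (nbr d q)
    rest' : ∀ i j → i < j → suc k + j < n → lcAdj a (z k) (z (suc k + i)) (z (suc k + j)) ≡ ev i
    rest' i j i<j q = trans (val (+-monoʳ-< (suc k) i<j) q
        (subst (λ w → a (z (suc k + i)) (z w) ≡ ev (suc i)) (+-suc k j) (subst (λ w → a (z w) (z (k + suc j)) ≡ ev (suc i)) (+-suc k i) (rest I (suc i) (suc j) (s≤s i<j) (subst (_< n) (≡sym (+-suc k j)) q))))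
        (nbr i (<-trans (+-monoʳ-< (suc k) i<j) q)) (nbr j q)) (xor-true (ev i))

  extend* : ∀ r {a K} → IsGraph a → 2 ≤ K → r + suc K ≡ n → Inv a K → (∀ {a'} → IsGraph a' → ∀ K' → suc K' ≡ n → Inv a' K' → HasC a' n) → HasC a n
  extend* zero g p refl I fin = fin g _ refl I
  extend* (suc r) {a} {K} g p e I fin = hasC-lc (z (suc K)) (extend* r (lc-graph (z (suc K)) g) (≤-trans p (n≤1+n K)) (trans (+-suc r (suc K)) e) (extend g p (subst (suc K <_) e (s≤s (≤-trans (≤-refl {suc K}) (subst (suc K ≤_) (+-comm (suc K) r) (m≤m+n (suc K) r))))) I) fin)

  -- After the complementation at `z 0`, adjacency among the other vertices depends only on the
  -- parity of the earlier one. Then `z 1` sees the whole tail and flips it, and `z 2` makes the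
  -- first three vertices a triangle, the cycle from which `extend` grows.
  start : ∀ {a} → IsGraph a → 2 < n → (∀ i j → i < j → j < n → a (z i) (z j) ≡ not (ev i) ∨ ev j) →
    Inv (lcAdj (lcAdj (lcAdj a (z 0)) (z 1)) (z 2)) 2
  start {a} g 2<n A = record
    { step = step₀ ; far = λ { zero .2 (s≤s (s≤s z≤n)) (s≤s (s≤s z≤n)) (inj₂ (s≤s (s≤s ()))) ; zero _ p (s≤s (s≤s z≤n)) (inj₁ ()) ; (suc i) j p q _ → ⊥-elim (<-irrefl refl (≤-trans (s≤s (s≤s (s≤s z≤n))) (≤-trans p q))) }
    ; clos = trans (lc-col (z 2) g₂ (z 0)) (a₂-0 2 (s≤s (s≤s z≤n)) 2<n)
    ; hub = λ d q → trans (val (s≤s z≤n) q (a₂-0 (3 + d) (s≤s (s≤s z≤n)) q) nb20 (a₂-r 2 (3 + d) (s≤s (s≤s z≤n)) (s≤s (s≤s (s≤s z≤n))) q)) (e₁ (ev d))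
    ; head = λ d q → trans (lc-row (z 2) g₂ _) (a₂-r 2 (3 + d) (s≤s (s≤s z≤n)) (s≤s (s≤s (s≤s z≤n))) q)
    ; mid = λ { (suc zero) d _ _ q → val (s≤s (s≤s z≤n)) q (a₂-1 (3 + d) (s≤s (s≤s z≤n)) q) nb21 (a₂-r 2 (3 + d) (s≤s (s≤s z≤n)) (s≤s (s≤s (s≤s z≤n))) q)
              ; (suc (suc i)) d _ (s≤s (s≤s ())) q }
    ; rest = λ i j i<j q → trans (val (+-monoʳ-< 3 i<j) q (a₂-r (3 + i) (3 + j) (s≤s (s≤s z≤n)) (+-monoʳ-< 3 i<j) q) (a₂-r 2 (3 + i) (s≤s (s≤s z≤n)) (s≤s (s≤s (s≤s z≤n))) (<-trans (+-monoʳ-< 3 i<j) q)) (a₂-r 2 (3 + j) (s≤s (s≤s z≤n)) (s≤s (s≤s (s≤s z≤n))) q)) (e₁ (ev i)) }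
    where
    a₁ = lcAdj a (z 0)
    a₂ = lcAdj a₁ (z 1)
    g₁ = lc-graph (z 0) g
    g₂ = lc-graph (z 1) g₁
    1<n : 1 < n
    1<n = <-trans (n<1+n 1) 2<n
    val : ∀ {i j b c d} → i < j → j < n → a₂ (z i) (z j) ≡ b → a₂ (z 2) (z i) ≡ c → a₂ (z 2) (z j) ≡ d → lcAdj a₂ (z 2) (z i) (z j) ≡ b xor (c ∧ d)
    val p q refl refl refl = lc-≢ a₂ (z 2) (z≢ p q)
    e₁ : ∀ b → (not (not (not b))) xor (true ∧ true) ≡ b
    e₁ true = refl
    e₁ false = refl
    a₁-0 : ∀ j → 1 ≤ j → j < n → a₁ (z 0) (z j) ≡ ev j
    a₁-0 j p q = trans (lc-row (z 0) g (z j)) (A 0 j p q)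
    a₁-r : ∀ i j → 1 ≤ i → i < j → j < n → a₁ (z i) (z j) ≡ not (ev i)
    a₁-r i j p q r = trans (lc-≢ a (z 0) (z≢ q r)) (trans (cong₂ _xor_ (A i j q r) (cong₂ _∧_ (A 0 i p (<-trans q r)) (A 0 j (≤-trans p (<⇒≤ q)) r)))
      (taut 2 (λ { (b ∷ c ∷ []) → (not b ∨ c) xor (b ∧ c) }) (λ { (b ∷ c ∷ []) → not b }) refl (ev i ∷ ev j ∷ [])))
    a₂-0 : ∀ j → 2 ≤ j → j < n → a₂ (z 0) (z j) ≡ ev j
    a₂-0 j p q = trans (lc-≢ a₁ (z 1) (z≢ (<-trans (n<1+n 0) p) q)) (trans (cong₂ _xor_ (a₁-0 j (<⇒≤ p) q) (cong (_∧ a₁ (z 1) (z j)) (trans (symm g₁ (z 1) (z 0)) (a₁-0 1 (s≤s z≤n) 1<n)))) (taut 1 (λ { (b ∷ []) → b xor false }) (λ { (b ∷ []) → b }) refl (ev j ∷ [])))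
    a₂-1 : ∀ j → 2 ≤ j → j < n → a₂ (z 1) (z j) ≡ true
    a₂-1 j p q = trans (lc-row (z 1) g₁ (z j)) (a₁-r 1 j (s≤s z≤n) p q)
    nb20 : a₂ (z 2) (z 0) ≡ true
    nb20 = trans (symm g₂ (z 2) (z 0)) (a₂-0 2 (s≤s (s≤s z≤n)) 2<n)
    nb21 : a₂ (z 2) (z 1) ≡ true
    nb21 = trans (symm g₂ (z 2) (z 1)) (a₂-1 2 (s≤s (s≤s z≤n)) 2<n)
    a₂-01 : a₂ (z 0) (z 1) ≡ false
    a₂-01 = trans (lc-col (z 1) g₁ (z 0)) (a₁-0 1 (s≤s z≤n) 1<n)
    a₂-r : ∀ i j → 2 ≤ i → i < j → j < n → a₂ (z i) (z j) ≡ ev i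
    a₂-r i j p q r = trans (lc-≢ a₁ (z 1) (z≢ q r)) (trans (cong₂ _xor_ (a₁-r i j (<⇒≤ p) q r) (cong₂ _∧_ (a₁-r 1 i (s≤s z≤n) p (<-trans q r)) (a₁-r 1 j (s≤s z≤n) (<-trans p q) r))) (taut 1 (λ { (b ∷ []) → not b xor true }) (λ { (b ∷ []) → b }) refl (ev i ∷ [])))
    step₀ : ∀ i → i < 2 → lcAdj a₂ (z 2) (z i) (z (suc i)) ≡ true
    step₀ zero _ = val (s≤s z≤n) 1<n a₂-01 nb20 nb21
    step₀ (suc zero) _ = trans (lc-col (z 2) g₂ (z 1)) (a₂-1 2 (s≤s (s≤s z≤n)) 2<n)
    step₀ (suc (suc i)) (s≤s (s≤s ()))

  finish : ∀ {a} → IsGraph a → ∀ K → 2 ≤ K → suc K ≡ n → Inv a K → HasC a n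
  finish {a} g K 2≤K refl I = [] , (λ i → z (toℕ i)) , (λ {i} {j} e → toℕ-injective (inj (toℕ<n i) (toℕ<n j) e)) , go
    where
    lt : ∀ x y → x < y → y ≤ K → (0 < x) → a (z x) (z y) ≡ (suc x ≡ᵇ y)
    lt x y p q r with m≤n⇒m<n∨m≡n p
    ... | inj₂ refl = trans (step I x q) (≡sym (≡ᵇ-refl (suc x)))
    ... | inj₁ s = trans (far I x y s q (inj₁ r)) (≡sym (≢⇒≡ᵇ-false (<⇒≢ s)))
    lt0 : ∀ y → suc y ≤ K → a (z 0) (z (suc y)) ≡ (0 ≡ᵇ y) ∨ (suc y ≡ᵇ K)
    lt0 zero q = step I 0 q
    lt0 (suc y) q with m≤n⇒m<n∨m≡n q
    ... | inj₂ refl = trans (clos I) (≡sym (≡ᵇ-refl (suc (suc y))))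
    ... | inj₁ s = trans (far I 0 (suc (suc y)) (s≤s (s≤s z≤n)) q (inj₂ s)) (≡sym (≢⇒≡ᵇ-false (<⇒≢ s)))
    go' : ∀ (i j : Fin (suc K)) x y → toℕ i ≡ x → toℕ j ≡ y → x ≤ K → y ≤ K → a (z x) (z y) ≡ cycleAdj (suc K) i j
    go' i j zero zero p q _ _ = trans (irr g (z 0)) (≡sym (trans (cycleAdj-00 K i j p q) (≢⇒≡ᵇ-false (<⇒≢ (<-≤-trans (s≤s z≤n) 2≤K)))))
    go' i j zero (suc y) p q _ h = trans (lt0 y h) (≡sym (cycleAdj-0s K i j p y q))
    go' i j (suc x) zero p q h _ = trans (symm g _ _) (trans (lt0 x h) (trans (∨-comm (0 ≡ᵇ x) (suc x ≡ᵇ K)) (≡sym (cycleAdj-s0 K i j x p q))))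
    go' i j (suc x) (suc y) p q h h' with <-cmp x y
    ... | tri< l _ _ = trans (lt (suc x) (suc y) (s≤s l) h' (s≤s z≤n)) (trans (≡sym (trans (cong ((suc x ≡ᵇ y) ∨_) (≢⇒≡ᵇ-false (λ e → <-asym l (subst (y <_) e (n<1+n y))))) (∨-comm _ false))) (≡sym (cycleAdj-ss K i j x y p q)))
    ... | tri≈ _ refl _ = trans (irr g _) (≡sym (trans (cycleAdj-ss K i j x x p q) (cong₂ _∨_ (≢⇒≡ᵇ-false {suc x} {x} (λ e → <⇒≢ (n<1+n x) (≡sym e))) (≢⇒≡ᵇ-false {suc x} {x} (λ e → <⇒≢ (n<1+n x) (≡sym e))))))
    ... | tri> _ _ l = trans (symm g _ _) (trans (lt (suc y) (suc x) (s≤s l) h (s≤s z≤n)) (trans (≡sym (cong (_∨ (suc y ≡ᵇ x)) (≢⇒≡ᵇ-false {suc x} {y} (λ e → <-asym l (subst (x <_) e (n<1+n x)))))) (≡sym (cycleAdj-ss K i j x y p q))))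
    go : ∀ i j → a (z (toℕ i)) (z (toℕ j)) ≡ cycleAdj (suc K) i j
    go i j = go' i j _ _ refl refl (s≤s⁻¹ (toℕ<n i)) (s≤s⁻¹ (toℕ<n j))

  zigzag⇒cycle : ∀ {a} → IsGraph a → 3 ≤ n → (∀ i j → i < j → j < n → a (z i) (z j) ≡ not (ev i) ∨ ev j) → HasC a n
  zigzag⇒cycle {a} g 3≤n A = hasC-lc (z 0) (hasC-lc (z 1) (hasC-lc (z 2)
    (extend* (n ∸ 3) (lc-graph (z 2) (lc-graph (z 1) (lc-graph (z 0) g))) (s≤s (s≤s z≤n)) (m∸n+n≡m 3≤n) (start g 3≤n A) (λ g' K' e I → finish g' K' (s≤s⁻¹ (subst (3 ≤_) (≡sym e) 3≤n)) e I))))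

-- Cut-rank

Sub : ℕ → Set
Sub m = Fin m → Bool

_⊑_ : ∀ {m} → Sub m → Sub m → Set
U ⊑ W = ∀ x → U x ≡ true → W x ≡ true

add del : ∀ {m} → Sub m → Fin m → Sub m
add U v x = U x ∨ does (x ≟ v)
del U v x = U x ∧ not (does (x ≟ v))

add-self : ∀ {m} (U : Sub m) v → add U v v ≡ true
add-self U v with v ≟ v
... | yes _ = taut 1 (λ { (b ∷ []) → b ∨ true }) (λ { (b ∷ []) → true }) refl (U v ∷ [])
... | no q = ⊥-elim (q refl)

add-mono : ∀ {m} (U : Sub m) v → U ⊑ add U v
add-mono U v x p rewrite p = refl

add-false : ∀ {m} (U : Sub m) v x → add U v x ≡ false → U x ≡ false × x ≢ v
add-false U v x p with U x | x ≟ v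
... | false | no q = refl , q

add-true : ∀ {m} (U : Sub m) v x → add U v x ≡ true → U x ≡ true ⊎ x ≡ v
add-true U v x p with U x | x ≟ v
... | true | _ = inj₁ refl
... | false | yes q = inj₂ q

add-out : ∀ {m} (U : Sub m) v x → U x ≡ false → x ≢ v → add U v x ≡ false
add-out U v x p q with x ≟ v
... | yes e = ⊥-elim (q e)
... | no _ rewrite p = refl

del-true : ∀ {m} (U : Sub m) v x → del U v x ≡ true → U x ≡ true × x ≢ v
del-true U v x p with U x | x ≟ v
... | true | no q = refl , q

del-in : ∀ {m} (U : Sub m) v x → U x ≡ true → x ≢ v → del U v x ≡ true
del-in U v x p q with x ≟ v
... | yes e = ⊥-elim (q e)
... | no _ rewrite p = refl

del-false : ∀ {m} (U : Sub m) v x → del U v x ≡ false → x ≢ v → U x ≡ false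
del-false U v x p q with U x | x ≟ v
... | false | _ = refl
... | true | yes e = ⊥-elim (q e)

in≢out : ∀ {m} {A : Sub m} {x y} → A x ≡ true → A y ≡ false → x ≢ y
in≢out p q refl = true≢false p q

Rank₁ Rank₂ : ∀ {m} → Adj m → Sub m → Sub m → Set
Rank₁ {m} a U A = Σ (Sub m) λ f → Σ (Sub m) λ g →
  ∀ x y → U x ≡ true → A x ≡ true → U y ≡ true → A y ≡ false → a x y ≡ f x ∧ g y
Rank₂ {m} a U A = Σ (Fin m → F₂²) λ f → Σ (Fin m → F₂²) λ g →
  ∀ x y → U x ≡ true → A x ≡ true → U y ≡ true → A y ≡ false → a x y ≡ dot (f x) (g y)

rank₁-⊑ : ∀ {m} {a : Adj m} {U U' A} → U' ⊑ U → Rank₁ a U A → Rank₁ a U' A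
rank₁-⊑ s (f , g , h) = f , g , λ x y p q r → h x y (s x p) q (s y r)

_+₂_ : F₂² → F₂² → F₂²
(a , b) +₂ (c , d) = a xor c , b xor d

_·₂_ : Bool → F₂² → F₂²
c ·₂ (a , b) = c ∧ a , c ∧ b

-- Inside the cut, complementing at `z` adds the row of `z` to rows on its own side (or its column
-- to columns), so only the factor on the side of `z` changes.
rank₁-lc : ∀ {m} {a : Adj m} {U A} z → IsGraph a → U z ≡ true → Rank₁ a U A → Rank₁ (lcAdj a z) U A
rank₁-lc {a = a} {U} {A} z gr Uz (f , g , h) with A z in Az
... | true = (λ x → f x xor (a z x ∧ f z)) , g , λ x y p q r s →
  trans (lc-≢ a z (in≢out q s)) (trans (cong₂ (λ b c → b xor (a z x ∧ c)) (h x y p q r s) (h z y Uz Az r s))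
  (taut 4 (λ { (p ∷ q ∷ r ∷ s ∷ []) → (p ∧ q) xor (r ∧ (s ∧ q)) }) (λ { (p ∷ q ∷ r ∷ s ∷ []) → (p xor (r ∧ s)) ∧ q }) refl (f x ∷ g y ∷ a z x ∷ f z ∷ [])))
... | false = f , (λ y → g y xor (a z y ∧ g z)) , λ x y p q r s →
  trans (lc-≢ a z (in≢out q s)) (trans (cong₂ (λ b c → b xor (c ∧ a z y)) (h x y p q r s) (trans (symm gr z x) (h x z p q Uz Az)))
  (taut 4 (λ { (p ∷ q ∷ r ∷ s ∷ []) → (p ∧ q) xor ((p ∧ s) ∧ r) }) (λ { (p ∷ q ∷ r ∷ s ∷ []) → p ∧ (q xor (r ∧ s)) }) refl (f x ∷ g y ∷ a z y ∷ g z ∷ [])))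

rank₂-lc : ∀ {m} {a : Adj m} {U A} z → IsGraph a → U z ≡ true → Rank₂ a U A → Rank₂ (lcAdj a z) U A
rank₂-lc {a = a} {U} {A} z gr Uz (f , g , h) with A z in Az
... | true = (λ x → f x +₂ (a z x ·₂ f z)) , g , λ x y p q r s →
  trans (lc-≢ a z (in≢out q s)) (trans (cong₂ (λ b c → b xor (a z x ∧ c)) (h x y p q r s) (h z y Uz Az r s))
  (taut 7 (λ { (p ∷ p' ∷ q ∷ q' ∷ r ∷ s ∷ s' ∷ []) → dot (p , p') (q , q') xor (r ∧ dot (s , s') (q , q')) }) (λ { (p ∷ p' ∷ q ∷ q' ∷ r ∷ s ∷ s' ∷ []) → dot ((p , p') +₂ (r ·₂ (s , s'))) (q , q') }) refl
    (proj₁ (f x) ∷ proj₂ (f x) ∷ proj₁ (g y) ∷ proj₂ (g y) ∷ a z x ∷ proj₁ (f z) ∷ proj₂ (f z) ∷ [])))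
... | false = f , (λ y → g y +₂ (a z y ·₂ g z)) , λ x y p q r s →
  trans (lc-≢ a z (in≢out q s)) (trans (cong₂ (λ b c → b xor (c ∧ a z y)) (h x y p q r s) (trans (symm gr z x) (h x z p q Uz Az)))
  (taut 7 (λ { (p ∷ p' ∷ q ∷ q' ∷ r ∷ s ∷ s' ∷ []) → dot (p , p') (q , q') xor (dot (p , p') (s , s') ∧ r) }) (λ { (p ∷ p' ∷ q ∷ q' ∷ r ∷ s ∷ s' ∷ []) → dot (p , p') ((q , q') +₂ (r ·₂ (s , s'))) }) refl
    (proj₁ (f x) ∷ proj₂ (f x) ∷ proj₁ (g y) ∷ proj₂ (g y) ∷ a z y ∷ proj₁ (g z) ∷ proj₂ (g z) ∷ [])))

rank₁-≗ : ∀ {m} {a b : Adj m} {U A} → (∀ x y → a x y ≡ b x y) → Rank₁ a U A → Rank₁ b U A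
rank₁-≗ e (f , g , h) = f , g , λ x y p q r s → trans (≡sym (e x y)) (h x y p q r s)

-- Leaving out u and w themselves makes dependence of their rows invariant under local complementation.
Dep : ∀ {m} → Adj m → Sub m → Fin m → Fin m → Set
Dep {m} a U u w = Σ Bool λ c → Σ Bool λ d → (c ∨ d ≡ true) ×
  (∀ z → U z ≡ true → z ≢ u → z ≢ w → (c ∧ a u z) xor (d ∧ a w z) ≡ false)

dep-sym : ∀ {m} {a : Adj m} {U u w} → Dep a U u w → Dep a U w u
dep-sym {a = a} {U} {u} {w} (c , d , p , h) = d , c , trans (taut 2 (λ { (c ∷ d ∷ []) → d ∨ c }) (λ { (c ∷ d ∷ []) → c ∨ d }) refl (c ∷ d ∷ [])) p ,
  λ z q r s → trans (taut 2 (λ { (c ∷ d ∷ []) → d xor c }) (λ { (c ∷ d ∷ []) → c xor d }) refl ((c ∧ a u z) ∷ (d ∧ a w z) ∷ [])) (h z q s r)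

dep-≗ : ∀ {m} {a b : Adj m} {U u w} → (∀ x y → a x y ≡ b x y) → Dep a U u w → Dep b U u w
dep-≗ e (c , d , p , h) = c , d , p , λ z q r s → trans (cong₂ (λ x y → (c ∧ x) xor (d ∧ y)) (≡sym (e _ z)) (≡sym (e _ z))) (h z q r s)

-- Complementing at `u` adds its row to that of an adjacent `w`, which the coefficient of `u`
-- absorbs. Complementing at a third vertex `v` changes the combination by a multiple of its value
-- at `v`, and that value is zero.
dep-lc : ∀ {m} {a : Adj m} {U u w} z → IsGraph a → U z ≡ true → Dep a U u w → Dep (lcAdj a z) U u w
dep-lc {a = a} {U} {u} {w} v gr Uv D with v ≟ u
dep-lc {a = a} {U} {u} {w} v gr Uv (c , d , p , h) | yes refl =
  c xor (d ∧ a u w) , d , trans (taut 3 (λ { (c ∷ d ∷ e ∷ []) → (c xor (d ∧ e)) ∨ d }) (λ { (c ∷ d ∷ e ∷ []) → c ∨ d }) refl (c ∷ d ∷ a u w ∷ [])) p ,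
  λ z q r s → trans (cong₂ (λ b b' → ((c xor (d ∧ a u w)) ∧ b) xor (d ∧ b')) (lc-row u gr z) (lc-≢ a u (λ e → s (≡sym e))))
    (trans (taut 5 (λ { (c ∷ d ∷ e ∷ f ∷ g ∷ []) → ((c xor (d ∧ e)) ∧ f) xor (d ∧ (g xor (e ∧ f))) }) (λ { (c ∷ d ∷ e ∷ f ∷ g ∷ []) → (c ∧ f) xor (d ∧ g) }) refl (c ∷ d ∷ a u w ∷ a u z ∷ a w z ∷ [])) (h z q r s))
... | no v≢u with v ≟ w
dep-lc {a = a} {U} {u} {w} v gr Uv (c , d , p , h) | no v≢u | yes refl =
  c , d xor (c ∧ a w u) , trans (taut 3 (λ { (c ∷ d ∷ e ∷ []) → c ∨ (d xor (c ∧ e)) }) (λ { (c ∷ d ∷ e ∷ []) → c ∨ d }) refl (c ∷ d ∷ a w u ∷ [])) p ,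
  λ z q r s → trans (cong₂ (λ b b' → (c ∧ b) xor ((d xor (c ∧ a w u)) ∧ b')) (lc-≢ a w (λ e → r (≡sym e))) (lc-row w gr z))
    (trans (taut 5 (λ { (c ∷ d ∷ e ∷ f ∷ g ∷ []) → (c ∧ (f xor (e ∧ g))) xor ((d xor (c ∧ e)) ∧ g) }) (λ { (c ∷ d ∷ e ∷ f ∷ g ∷ []) → (c ∧ f) xor (d ∧ g) }) refl (c ∷ d ∷ a w u ∷ a u z ∷ a w z ∷ [])) (h z q r s))
dep-lc {a = a} {U} {u} {w} v gr Uv (c , d , p , h) | no v≢u | no v≢w =
  c , d , p , λ z q r s → trans (cong₂ (λ b b' → (c ∧ b) xor (d ∧ b')) (lc-≢ a v (λ e → r (≡sym e))) (lc-≢ a v (λ e → s (≡sym e))))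
    (trans (taut 7 (λ { (c ∷ d ∷ e ∷ f ∷ g ∷ i ∷ j ∷ []) → (c ∧ (e xor (f ∧ g))) xor (d ∧ (i xor (j ∧ g))) }) (λ { (c ∷ d ∷ e ∷ f ∷ g ∷ i ∷ j ∷ []) → ((c ∧ e) xor (d ∧ i)) xor (g ∧ ((c ∧ f) xor (d ∧ j))) }) refl
      (c ∷ d ∷ a u z ∷ a v u ∷ a v z ∷ a w z ∷ a v w ∷ []))
    (trans (cong₂ (λ b b' → b xor (a v z ∧ b')) (h z q r s) (trans (cong₂ (λ b b' → (c ∧ b) xor (d ∧ b')) (symm gr v u) (symm gr v w)) (h v Uv v≢u v≢w)))
      (taut 1 (λ { (b ∷ []) → b ∧ false }) (λ { (b ∷ []) → false }) refl (a v z ∷ []))))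

¬dep-lc : ∀ {m} {a : Adj m} {U u w} z → IsGraph a → U z ≡ true → ¬ Dep a U u w → ¬ Dep (lcAdj a z) U u w
¬dep-lc z gr Uz n D = n (dep-≗ (lc-involutive z gr) (dep-lc z (lc-graph z gr) Uz D))

¬rank₁-lc : ∀ {m} {a : Adj m} {U A} z → IsGraph a → U z ≡ true → ¬ Rank₁ a U A → ¬ Rank₁ (lcAdj a z) U A
¬rank₁-lc z gr Uz n D = n (rank₁-≗ (lc-involutive z gr) (rank₁-lc z (lc-graph z gr) Uz D))

-- The search runs over vectors while sets are functions here; `resp` carries the property from a
-- function to its tabulation.
Σsub? : ∀ {m} {P : Sub m → Set} → (∀ {f g} → (∀ x → f x ≡ g x) → P f → P g) → (∀ f → Dec (P f)) → Dec (Σ (Sub m) P)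
Σsub? resp P? = map′ (λ (p , q) → Vec.lookup p , q) (λ (f , q) → tabulate f , resp (λ x → ≡sym (lookup∘tabulate f x)) q) (anySubset? (λ p → P? (Vec.lookup p)))

rank₁? : ∀ {m} (a : Adj m) U A → Dec (Rank₁ a U A)
rank₁? a U A = Σsub?
  (λ e (g , h) → g , λ x y p q r s → trans (h x y p q r s) (cong (_∧ g y) (e x)))
  (λ f → Σsub? (λ e h x y p q r s → trans (h x y p q r s) (cong (f x ∧_) (e y)))
    (λ g → all? λ x → all? λ y → (U x ≟ᵇ true) →-dec ((A x ≟ᵇ true) →-dec ((U y ≟ᵇ true) →-dec ((A y ≟ᵇ false) →-dec (a x y ≟ᵇ (f x ∧ g y)))))))

-- Connectivity between two edges and minimal linked sets

module Ends {m} (s s' t t' : Fin m) where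

  Sep : Sub m → Set
  Sep A = A s ≡ true × A s' ≡ true × A t ≡ false × A t' ≡ false

  -- The cut-rank connectivity between {s , s'} and {t , t'} inside U is at least 2.
  Kappa : Adj m → Sub m → Set
  Kappa a U = ∀ A → Sep A → ¬ Rank₁ a U A

  Thin : Adj m → Sub m → Set
  Thin a U = Σ (Sub m) λ A → Sep A × Rank₁ a U A

  Free : Fin m → Set
  Free v = v ≢ s × v ≢ s' × v ≢ t × v ≢ t'

  HasEnds : Sub m → Set
  HasEnds U = U s ≡ true × U s' ≡ true × U t ≡ true × U t' ≡ true

  thin? : ∀ a U → Dec (Thin a U)
  thin? a U = Σsub?
    (λ e ((p , q , r , r') , f , g , h) → (trans (≡sym (e _)) p , trans (≡sym (e _)) q , trans (≡sym (e _)) r , trans (≡sym (e _)) r') ,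
      f , g , λ x y p q r s → h x y p (trans (e x) q) r (trans (e y) s))
    (λ A → ((A s ≟ᵇ true) ×-dec ((A s' ≟ᵇ true) ×-dec ((A t ≟ᵇ false) ×-dec (A t' ≟ᵇ false)))) ×-dec rank₁? a U A)

  free? : ∀ v → Dec (Free v)
  free? v with v ≟ s | v ≟ s' | v ≟ t | v ≟ t'
  ... | no p | no q | no r | no r' = yes (p , q , r , r')
  ... | yes p | _ | _ | _ = no λ f → proj₁ f p
  ... | _ | yes p | _ | _ = no λ f → proj₁ (proj₂ f) p
  ... | _ | _ | yes p | _ = no λ f → proj₁ (proj₂ (proj₂ f)) p
  ... | _ | _ | _ | yes p = no λ f → proj₂ (proj₂ (proj₂ f)) p

  Minimal : Adj m → Sub m → Set
  Minimal a U = ∀ v → U v ≡ true → Free v → Thin a (del U v)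

  thin-⊑ : ∀ {a U U'} → U' ⊑ U → Thin a U → Thin a U'
  thin-⊑ s (A , S , r) = A , S , rank₁-⊑ s r

  private
    -- One pass is enough: if deleting `v` gives a thin set now, it still does after further
    -- deletions, by `thin-⊑`. A vertex once kept need not be tried again.
    pass : ∀ a vs U → HasEnds U → Kappa a U → Σ (Sub m) λ U' →
      U' ⊑ U × HasEnds U' × Kappa a U' × All (λ v → U' v ≡ true → Free v → Thin a (del U' v)) vs
    pass a [] U E K = U , (λ _ p → p) , E , K , []
    pass a (v ∷ vs) U E K with thin? a (del U v) | free? v
    ... | yes th | _ =
      let (U' , sub , E' , K' , h) = pass a vs U E K in
      U' , sub , E' , K' , (λ _ _ → thin-⊑ (λ x p → let (q , r) = del-true U' v x p in del-in U v x (sub x q) r) th) ∷ h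
    ... | no _ | no nf =
      let (U' , sub , E' , K' , h) = pass a vs U E K in
      U' , sub , E' , K' , (λ _ f → ⊥-elim (nf f)) ∷ h
    ... | no nt | yes (f₁ , f₂ , f₃ , f₄) =
      let (e₁ , e₂ , e₃ , e₄) = E
          (U' , sub , E' , K' , h) = pass a vs (del U v)
             (del-in U v s e₁ (λ e → f₁ (≡sym e)) , del-in U v s' e₂ (λ e → f₂ (≡sym e)) , del-in U v t e₃ (λ e → f₃ (≡sym e)) , del-in U v t' e₄ (λ e → f₄ (≡sym e)))
             (λ A S r → nt (A , S , r)) in
      U' , (λ x p → proj₁ (del-true U v x (sub x p))) , E' , K' , (λ p _ → ⊥-elim (proj₂ (del-true U v v (sub v p)) refl)) ∷ h

  abstract
    minimize : ∀ a U → HasEnds U → Kappa a U → Σ (Sub m) λ U' → U' ⊑ U × HasEnds U' × Kappa a U' × Minimal a U'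
    minimize a U E K =
      let (U' , sub , E' , K' , h) = pass a (allFin m) U E K in
      U' , sub , E' , K' , λ v → All.lookup h (∈-allFin v)

-- Tight cuts and linear layouts

_∪_ _∩_ : ∀ {m} → Sub m → Sub m → Sub m
(A ∪ B) x = A x ∨ B x
(A ∩ B) x = A x ∧ B x

∁ˢ : ∀ {m} → Sub m → Sub m
∁ˢ A x = not (A x)

not-true : ∀ {b} → not b ≡ true → b ≡ false
not-true {false} _ = refl

not-false : ∀ {b} → not b ≡ false → b ≡ true
not-false {true} _ = refl

∨-false : ∀ {a b} → a ∨ b ≡ false → a ≡ false × b ≡ false
∨-false {false} {false} _ = refl , refl

dot-comm : ∀ p q → dot p q ≡ dot q p
dot-comm (a , b) (c , d) = taut 4 (λ { (a ∷ b ∷ c ∷ d ∷ []) → dot (a , b) (c , d) }) (λ { (a ∷ b ∷ c ∷ d ∷ []) → dot (c , d) (a , b) }) refl (a ∷ b ∷ c ∷ d ∷ [])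

rank₂-cong : ∀ {m} {a : Adj m} {U A B} → (∀ x → U x ≡ true → A x ≡ B x) → Rank₂ a U A → Rank₂ a U B
rank₂-cong e (f , g , h) = f , g , λ x y p q r s → h x y p (trans (e x p) q) r (trans (e y r) s)

rank₁-cong : ∀ {m} {a : Adj m} {U A B} → (∀ x → U x ≡ true → A x ≡ B x) → Rank₁ a U A → Rank₁ a U B
rank₁-cong e (f , g , h) = f , g , λ x y p q r s → h x y p (trans (e x p) q) r (trans (e y r) s)

rank₂-∁ : ∀ {m} {a : Adj m} {U A} → IsGraph a → Rank₂ a U A → Rank₂ a U (∁ˢ A)
rank₂-∁ gr (f , g , h) = g , f , λ x y p q r s → trans (symm gr x y) (trans (h y x r (not-false s) p (not-true q)) (dot-comm (f y) (g x)))

rank₁-∁ : ∀ {m} {a : Adj m} {U A} → IsGraph a → Rank₁ a U A → Rank₁ a U (∁ˢ A)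
rank₁-∁ gr (f , g , h) = g , f , λ x y p q r s → trans (symm gr x y) (trans (h y x r (not-false s) p (not-true q))
  (taut 2 (λ { (a ∷ b ∷ []) → a ∧ b }) (λ { (a ∷ b ∷ []) → b ∧ a }) refl (f y ∷ g x ∷ [])))

-- Planes in `F₂⁴` and submodularity of cut-rank

F₂⁴ : Set
F₂⁴ = F₂² × F₂²

dot₄ : F₂⁴ → F₂⁴ → Bool
dot₄ (p , q) (r , s) = dot p r xor dot q s

vec₄ : Vec Bool 4 → F₂⁴
vec₄ (a ∷ b ∷ c ∷ d ∷ []) = (a , b) , (c , d)

bits₄ : F₂⁴ → Vec Bool 4
bits₄ ((a , b) , (c , d)) = a ∷ b ∷ c ∷ d ∷ []

_==₂_ : F₂² → F₂² → Bool
(a , b) ==₂ (c , d) = (a ⇔ᵇ c) ∧ (b ⇔ᵇ d)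

_==₄_ : F₂⁴ → F₂⁴ → Bool
(p , q) ==₄ (r , s) = (p ==₂ r) ∧ (q ==₂ s)

==₂-sound : ∀ p q → p ==₂ q ≡ true → p ≡ q
==₂-sound (a , b) (c , d) e = cong₂ _,_ (⇔ᵇ-sound a c (proj₁ (∧-true e))) (⇔ᵇ-sound b d (proj₂ (∧-true {a ⇔ᵇ c} e)))

==₄-sound : ∀ p q → p ==₄ q ≡ true → p ≡ q
==₄-sound (p , q) (r , s) e = cong₂ _,_ (==₂-sound p r (proj₁ (∧-true e))) (==₂-sound q s (proj₂ (∧-true {p ==₂ r} e)))

==₂-refl : ∀ p → p ==₂ p ≡ true
==₂-refl (a , b) = cong₂ _∧_ (⇔ᵇ-complete {a} refl) (⇔ᵇ-complete {b} refl)

==₄-refl : ∀ p → p ==₄ p ≡ true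
==₄-refl (p , q) = cong₂ _∧_ (==₂-refl p) (==₂-refl q)

0₂ : F₂²
0₂ = false , false

0₄ : F₂⁴
0₄ = 0₂ , 0₂

all₂ : List F₂²
all₂ = (false , false) ∷ (false , true) ∷ (true , false) ∷ (true , true) ∷ []

all₄ : List F₂⁴
all₄ = concatMap (λ p → map (p ,_) all₂) all₂

orth : F₂⁴ → F₂⁴ → F₂⁴ → Bool
orth e f z = not (dot₄ e z) ∧ not (dot₄ f z)

comb : F₂² → F₂⁴ → F₂⁴ → F₂⁴
comb (c , d) (g , g') (h , h') = ((c ·₂ g) +₂ (d ·₂ h)) , ((c ·₂ g') +₂ (d ·₂ h'))

coord : F₂⁴ → F₂⁴ → F₂⁴ → F₂²
coord g h z = if z ==₄ 0₄ then 0₂ else (if z ==₄ g then (true , false) else (if z ==₄ h then (false , true) else (true , true)))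

firstTwo : List F₂⁴ → F₂⁴ × F₂⁴
firstTwo (g ∷ h ∷ _) = g , h
firstTwo _ = 0₄ , 0₄

-- For independent `e` and `f` the orthogonal complement is a plane. Any two distinct nonzero
-- vectors of a plane over the two-element field form a basis, so the first two found will do and
-- the default of `firstTwo` is not reached.
orthBasis : F₂⁴ → F₂⁴ → F₂⁴ × F₂⁴
orthBasis e f = firstTwo (filterᵇ (λ z → orth e f z ∧ not (z ==₄ 0₄)) all₄)

indep : F₂⁴ → F₂⁴ → Bool
indep e f = not (e ==₄ 0₄) ∧ (not (f ==₄ 0₄) ∧ not (e ==₄ f))

_⇒ᵇ_ : Bool → Bool → Bool
true ⇒ᵇ b = b
false ⇒ᵇ b = true

⇒ᵇ-elim : ∀ {a b} → a ⇒ᵇ b ≡ true → a ≡ true → b ≡ true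
⇒ᵇ-elim p refl = p

orth-span : ∀ e f z → indep e f ≡ true → orth e f z ≡ true →
  let (g , h) = orthBasis e f in z ≡ comb (coord g h z) g h
orth-span e f z p q = ==₄-sound _ _ (⇒ᵇ-elim (⇒ᵇ-elim (allᵇ-sound 12 chk refl (e₁ ∷ e₂ ∷ e₃ ∷ e₄ ∷ f₁ ∷ f₂ ∷ f₃ ∷ f₄ ∷ bits₄ z)) p) q)
  where
  e₁ = proj₁ (proj₁ e)
  e₂ = proj₂ (proj₁ e)
  e₃ = proj₁ (proj₂ e)
  e₄ = proj₂ (proj₂ e)
  f₁ = proj₁ (proj₁ f)
  f₂ = proj₂ (proj₁ f)
  f₃ = proj₁ (proj₂ f)
  f₄ = proj₂ (proj₂ f)
  chk' : F₂⁴ → F₂⁴ → F₂⁴ → Bool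
  chk' e f z = let (g , h) = orthBasis e f in indep e f ⇒ᵇ (orth e f z ⇒ᵇ (z ==₄ comb (coord g h z) g h))
  chk : Vec Bool 12 → Bool
  chk (e₁ ∷ e₂ ∷ e₃ ∷ e₄ ∷ f₁ ∷ f₂ ∷ f₃ ∷ f₄ ∷ v) = chk' ((e₁ , e₂) , (e₃ , e₄)) ((f₁ , f₂) , (f₃ , f₄)) (vec₄ v)

dot₄-comb : ∀ x c g h → dot₄ x (comb c g h) ≡ dot (dot₄ x g , dot₄ x h) c
dot₄-comb ((x₁ , x₂) , (x₃ , x₄)) (c , d) ((g₁ , g₂) , (g₃ , g₄)) ((h₁ , h₂) , (h₃ , h₄)) =
  trans (cong₂ _xor_ (l x₁ x₂ g₁ g₂ h₁ h₂) (l x₃ x₄ g₃ g₄ h₃ h₄))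
    (taut 6 (λ { (p ∷ q ∷ r ∷ s ∷ c ∷ d ∷ []) → ((c ∧ p) xor (d ∧ q)) xor ((c ∧ r) xor (d ∧ s)) })
            (λ { (p ∷ q ∷ r ∷ s ∷ c ∷ d ∷ []) → dot (p xor r , q xor s) (c , d) }) refl
      (dot (x₁ , x₂) (g₁ , g₂) ∷ dot (x₁ , x₂) (h₁ , h₂) ∷ dot (x₃ , x₄) (g₃ , g₄) ∷ dot (x₃ , x₄) (h₃ , h₄) ∷ c ∷ d ∷ []))
  where
  l : ∀ x₁ x₂ g₁ g₂ h₁ h₂ → dot (x₁ , x₂) ((c ·₂ (g₁ , g₂)) +₂ (d ·₂ (h₁ , h₂))) ≡ (c ∧ dot (x₁ , x₂) (g₁ , g₂)) xor (d ∧ dot (x₁ , x₂) (h₁ , h₂))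
  l x₁ x₂ g₁ g₂ h₁ h₂ = taut 8 (λ { (c ∷ d ∷ x₁ ∷ x₂ ∷ g₁ ∷ g₂ ∷ h₁ ∷ h₂ ∷ []) → dot (x₁ , x₂) ((c ·₂ (g₁ , g₂)) +₂ (d ·₂ (h₁ , h₂))) })
    (λ { (c ∷ d ∷ x₁ ∷ x₂ ∷ g₁ ∷ g₂ ∷ h₁ ∷ h₂ ∷ []) → (c ∧ dot (x₁ , x₂) (g₁ , g₂)) xor (d ∧ dot (x₁ , x₂) (h₁ , h₂)) }) refl (c ∷ d ∷ x₁ ∷ x₂ ∷ g₁ ∷ g₂ ∷ h₁ ∷ h₂ ∷ [])

-- Submodularity of cut-rank at the value 2: for x ∈ A ∩ B and u ∉ A ∪ B the two
-- factorizations agree, so the combined vectors of A ∩ B and of the complement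
-- of A ∪ B are orthogonal in F₂⁴; the former span at least a plane.
rank₂-∪ : ∀ {m} {a : Adj m} {U A B} → Rank₂ a U A → Rank₂ a U B → ¬ Rank₁ a U (A ∩ B) → Rank₂ a U (A ∪ B)
rank₂-∪ {m} {a} {U} {A} {B} (α , β , hA) (γ , δ , hB) ¬r
  with any? (λ x → ((U x ≟ᵇ true) ×-dec ((A ∩ B) x ≟ᵇ true)) ×-dec (((α x , γ x) ==₄ 0₄) ≟ᵇ false))
... | no none = ⊥-elim (¬r ((λ _ → false) , (λ _ → false) , λ x y p q r s → zeros x y p q r s))
  where
  z : ∀ x → U x ≡ true → (A ∩ B) x ≡ true → (α x , γ x) ≡ 0₄
  z x p q with (α x , γ x) ==₄ 0₄ in e
  ... | true = ==₄-sound _ _ e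
  ... | false = ⊥-elim (none (x , (p , q) , e))
  zeros : ∀ x y → U x ≡ true → (A ∩ B) x ≡ true → U y ≡ true → (A ∩ B) y ≡ false → a x y ≡ false
  zeros x y p q r s with A y in Ay
  ... | false = trans (hA x y p (proj₁ (∧-true q)) r Ay) (cong (λ v → dot v (β y)) (cong proj₁ (z x p q)))
  ... | true = trans (hB x y p (proj₂ (∧-true {A x} q)) r s) (cong (λ v → dot v (δ y)) (cong proj₂ (z x p q)))
... | yes (x₀ , (U₀ , D₀) , e₀)
  with any? (λ x → ((U x ≟ᵇ true) ×-dec ((A ∩ B) x ≟ᵇ true)) ×-dec (indep (α x₀ , γ x₀) (α x , γ x) ≟ᵇ true))
... | no none = ⊥-elim (¬r (f , g , line))
  where
  e : F₂⁴
  e = α x₀ , γ x₀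
  f g : Sub m
  f x = not ((α x , γ x) ==₄ 0₄)
  g y = if A y then dot (proj₂ e) (δ y) else dot (proj₁ e) (β y)
  only : ∀ x → U x ≡ true → (A ∩ B) x ≡ true → (α x , γ x) ≡ (f x ·₂ proj₁ e , f x ·₂ proj₂ e)
  only x p q with (α x , γ x) ==₄ 0₄ in e₁ | e ==₄ (α x , γ x) in e₂
  ... | true | _ = ==₄-sound _ _ e₁
  ... | false | true = ≡sym (==₄-sound _ _ e₂)
  ... | false | false = ⊥-elim (none (x , (p , q) , cong₂ (λ b c → not b ∧ c) e₀ (cong₂ (λ b c → not b ∧ not c) e₁ e₂)))
  sc : ∀ c v w → dot (c ·₂ v) w ≡ c ∧ dot v w
  sc true v w = refl
  sc false v w = refl
  line : ∀ x y → U x ≡ true → (A ∩ B) x ≡ true → U y ≡ true → (A ∩ B) y ≡ false → a x y ≡ f x ∧ g y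
  line x y p q r s with A y in Ay
  ... | false = trans (hA x y p (proj₁ (∧-true q)) r Ay) (trans (cong (λ v → dot v (β y)) (cong proj₁ (only x p q))) (sc (f x) (proj₁ e) (β y)))
  ... | true = trans (hB x y p (proj₂ (∧-true {A x} q)) r s) (trans (cong (λ v → dot v (δ y)) (cong proj₂ (only x p q))) (sc (f x) (proj₂ e) (δ y)))
... | yes (x₁ , (U₁ , D₁) , ind) = φ , ψ , fac
  where
  e f : F₂⁴
  e = α x₀ , γ x₀
  f = α x₁ , γ x₁
  g h : F₂⁴
  g = proj₁ (orthBasis e f)
  h = proj₂ (orthBasis e f)
  -- Outside `A ∪ B` either factorization alone gives the row of `x`, so the other half of the
  -- vector can be set to zero.
  pad w : Fin m → F₂⁴
  pad x = if A x then (α x , 0₂) else (0₂ , γ x)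
  w y = β y , δ y
  φ ψ : Fin m → F₂²
  φ x = dot₄ (pad x) g , dot₄ (pad x) h
  ψ y = coord g h (w y)
  perp : ∀ x y → U x ≡ true → (A ∩ B) x ≡ true → U y ≡ true → A y ≡ false → B y ≡ false → dot₄ (α x , γ x) (w y) ≡ false
  perp x y p q r s t rewrite ≡sym (hA x y p (proj₁ (∧-true q)) r s) | ≡sym (hB x y p (proj₂ (∧-true {A x} q)) r t) with a x y
  ... | true = refl
  ... | false = refl
  fac' : ∀ x y → U x ≡ true → (A ∪ B) x ≡ true → U y ≡ true → A y ≡ false → B y ≡ false → a x y ≡ dot₄ (pad x) (w y)
  fac' x y p q r s t with A x in Ax
  ... | true = trans (hA x y p Ax r s) (taut 1 (λ { (b ∷ []) → b }) (λ { (b ∷ []) → b xor false }) refl (dot (α x) (β y) ∷ []))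
  ... | false = hB x y p q r t
  fac : ∀ x y → U x ≡ true → (A ∪ B) x ≡ true → U y ≡ true → (A ∪ B) y ≡ false → a x y ≡ dot (φ x) (ψ y)
  fac x y p q r s = let (s₁ , s₂) = ∨-false {A y} s in
    trans (fac' x y p q r s₁ s₂) (trans (cong (dot₄ (pad x)) (orth-span e f (w y) ind (cong₂ (λ b c → not b ∧ not c) (perp x₀ y U₀ D₀ r s₁ s₂) (perp x₁ y U₁ D₁ r s₁ s₂))))
      (dot₄-comb (pad x) (ψ y) g h))

rank₂-∩ : ∀ {m} {a : Adj m} {U A B} → IsGraph a → Rank₂ a U A → Rank₂ a U B → ¬ Rank₁ a U (A ∪ B) → Rank₂ a U (A ∩ B)
rank₂-∩ {A = A} {B} gr rA rB ¬r = rank₂-cong (λ x _ → taut 2 (λ { (b ∷ c ∷ []) → not (not b ∨ not c) }) (λ { (b ∷ c ∷ []) → b ∧ c }) refl (A x ∷ B x ∷ []))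
  (rank₂-∁ gr (rank₂-∪ (rank₂-∁ gr rA) (rank₂-∁ gr rB)
    (λ r → ¬r (rank₁-cong (λ x _ → taut 2 (λ { (b ∷ c ∷ []) → not (not b ∧ not c) }) (λ { (b ∷ c ∷ []) → b ∨ c }) refl (A x ∷ B x ∷ [])) (rank₁-∁ gr r)))))

∪-add-∩ : ∀ {m} (C A D : Sub m) w → D w ≡ true → ∀ x → ((C ∪ add A w) ∩ D) x ≡ add ((C ∪ A) ∩ D) w x
∪-add-∩ C A D w Dw x with x ≟ w
... | yes refl = trans (cong ((C x ∨ (A x ∨ true)) ∧_) Dw) (taut 3 (λ { (b ∷ c ∷ d ∷ []) → (b ∨ (c ∨ true)) ∧ true }) (λ { (b ∷ c ∷ d ∷ []) → d ∨ true }) refl (C x ∷ A x ∷ ((C ∪ A) ∩ D) x ∷ []))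
... | no _ = taut 3 (λ { (b ∷ c ∷ d ∷ []) → (b ∨ (c ∨ false)) ∧ d }) (λ { (b ∷ c ∷ d ∷ []) → ((b ∨ c) ∧ d) ∨ false }) refl (C x ∷ A x ∷ D x ∷ [])

-- The lattice of tight cuts

module Layout {m} {s s' t t' : Fin m} {a : Adj m} (gr : IsGraph a) {U : Sub m} where
  open Ends s s' t t'

  Tight : Sub m → Set
  Tight C = Sep C × Rank₂ a U C

  module _ (E : HasEnds U) (K : Kappa a U) (M : Minimal a U) where

    sep-∪ : ∀ {A B} → Sep A → Sep B → Sep (A ∪ B)
    sep-∪ (p , q , r , r') (p' , q' , o , o') = cong₂ _∨_ p p' , cong₂ _∨_ q q' , cong₂ _∨_ r o , cong₂ _∨_ r' o'

    sep-∩ : ∀ {A B} → Sep A → Sep B → Sep (A ∩ B)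
    sep-∩ (p , q , r , r') (p' , q' , o , o') = cong₂ _∧_ p p' , cong₂ _∧_ q q' , cong₂ _∧_ r o , cong₂ _∧_ r' o'

    tight-∪ : ∀ {A B} → Tight A → Tight B → Tight (A ∪ B)
    tight-∪ {A} {B} (S₁ , r₁) (S₂ , r₂) = sep-∪ {A} {B} S₁ S₂ , rank₂-∪ r₁ r₂ (K (A ∩ B) (sep-∩ {A} {B} S₁ S₂))

    tight-∩ : ∀ {A B} → Tight A → Tight B → Tight (A ∩ B)
    tight-∩ {A} {B} (S₁ , r₁) (S₂ , r₂) = sep-∩ {A} {B} S₁ S₂ , rank₂-∩ gr r₁ r₂ (K (A ∪ B) (sep-∪ {A} {B} S₁ S₂))

    sep-free : ∀ {A v} → Sep A → Free v → Sep (del A v) × Sep (add A v)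
    sep-free {A} {v} (p , q , r , r') (f₁ , f₂ , f₃ , f₄) =
      (del-in A v s p (λ e → f₁ (≡sym e)) , del-in A v s' q (λ e → f₂ (≡sym e)) , cong (_∧ _) r , cong (_∧ _) r') ,
      (add-mono A v s p , add-mono A v s' q , add-out A v t r (λ e → f₃ (≡sym e)) , add-out A v t' r' (λ e → f₄ (≡sym e)))

    -- One more vertex raises the rank of a cut by at most 1, whichever side it joins. So the thin
    -- cut of `U` without `v` gives two tight cuts of `U`; the second coordinate carries the column
    -- or the row of `v`.
    private-cut : ∀ v → U v ≡ true → Free v → Σ (Sub m) λ A → A v ≡ false × Tight A × Tight (add A v)
    private-cut v Uv F with M v Uv F
    ... | (A₀ , S₀ , f , g , h) = A , Av , (proj₁ (sep-free S₀ F) , low) , (proj₂ (sep-free (proj₁ (sep-free S₀ F)) F) , up)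
      where
      A = del A₀ v
      Av : A v ≡ false
      Av with v ≟ v
      ... | yes _ = taut 1 (λ { (b ∷ []) → b ∧ false }) (λ { (b ∷ []) → false }) refl (A₀ v ∷ [])
      ... | no q = ⊥-elim (q refl)
      out : ∀ y → A y ≡ false → y ≢ v → A₀ y ≡ false
      out y = del-false A₀ v y
      low : Rank₂ a U A
      low = (λ x → f x , a x v) , (λ y → if does (y ≟ v) then (false , true) else (g y , false)) , fac
        where
        fac : ∀ x y → U x ≡ true → A x ≡ true → U y ≡ true → A y ≡ false → a x y ≡ dot (f x , a x v) (if does (y ≟ v) then (false , true) else (g y , false))
        fac x y p q r s with y ≟ v | out y s | del-true A₀ v x q
        ... | yes refl | _ | _ = taut 2 (λ { (b ∷ c ∷ []) → c }) (λ { (b ∷ c ∷ []) → dot (b , c) (false , true) }) refl (f x ∷ a x v ∷ [])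
        ... | no n | o | (q₁ , q₂) =
          trans (h x y (del-in U v x p q₂) q₁ (del-in U v y r n) (o n)) (taut 3 (λ { (b ∷ c ∷ d ∷ []) → b ∧ d }) (λ { (b ∷ c ∷ d ∷ []) → dot (b , c) (d , false) }) refl (f x ∷ a x v ∷ g y ∷ []))
      up : Rank₂ a U (add A v)
      up = (λ x → if does (x ≟ v) then (false , true) else (f x , false)) , (λ y → g y , a v y) , fac
        where
        inA : ∀ x → add A v x ≡ true → x ≢ v → A₀ x ≡ true
        inA x q n with add-true A v x q
        ... | inj₁ q' = proj₁ (del-true A₀ v x q')
        ... | inj₂ e = ⊥-elim (n e)
        fac : ∀ x y → U x ≡ true → add A v x ≡ true → U y ≡ true → add A v y ≡ false → a x y ≡ dot (if does (x ≟ v) then (false , true) else (f x , false)) (g y , a v y)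
        fac x y p q r s with x ≟ v | inA x q
        ... | yes refl | _ = refl
        ... | no n | i = let (s₁ , s₂) = add-false A v y s in
          trans (h x y (del-in U v x p n) (i n) (del-in U v y r s₂) (out y s₁ s₂)) (taut 2 (λ { (b ∷ d ∷ []) → b ∧ d }) (λ { (b ∷ d ∷ []) → (b ∧ d) xor false }) refl (f x ∷ g y ∷ []))

    private
      -- If `w` lies in `D` but not in `C`, let `A` be its private cut. Then `(C ∪ A) ∩ D` is tight,
      -- omits `w`, and is still tight when `w` is put back, so `w` takes over the part of `v`.
      -- Since `D` only shrinks, one pass over all vertices leaves none of `U` in `D` outside `C`.
      descend : ∀ C → Tight C → (ws : List (Fin m)) → ∀ D v → Tight D → Tight (add D v) → C ⊑ D → D v ≡ false → U v ≡ true → Free v →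
        Σ (Sub m) λ D' → Σ (Fin m) λ v' → Tight (add D' v') × C ⊑ D' × D' ⊑ D × D' v' ≡ false × U v' ≡ true × Free v' × All (λ w → U w ≡ true → D' w ≡ true → C w ≡ true) ws
      descend C TC [] D v T T' sub p q F = D , v , T' , sub , (λ _ x → x) , p , q , F , []
      descend C TC (w ∷ ws) D v T T' sub p q F with ((U w ≟ᵇ true) ×-dec (D w ≟ᵇ true)) ×-dec (C w ≟ᵇ false)
      ... | no n = let (D' , v' , h₁ , h₂ , h₃ , h₄ , h₅ , h₆ , h₇) = descend C TC ws D v T T' sub p q F in
        D' , v' , h₁ , h₂ , h₃ , h₄ , h₅ , h₆ , (λ Uw Dw → keep Uw (h₃ w Dw)) ∷ h₇
        where
        keep : U w ≡ true → D w ≡ true → C w ≡ true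
        keep Uw Dw with C w
        ... | true = refl
        ... | false = ⊥-elim (n ((Uw , Dw) , refl))
      ... | yes ((Uw , Dw) , Cw) =
        let (D' , v' , h₁ , h₂ , h₃ , h₄ , h₅ , h₆ , h₇) = descend C TC ws D₁ w T₁ T₁' sub₁ D₁w Uw Fw in
        D' , v' , h₁ , h₂ , (λ x y → proj₂ (∧-true {(C ∪ A) x} (h₃ x y))) , h₄ , h₅ , h₆ , (λ _ y → ⊥-elim (true≢false (h₃ w y) D₁w)) ∷ h₇
        where
        Fw : Free w
        Fw = let (c₁ , c₂ , _) = proj₁ TC ; (_ , _ , d₁ , d₂) = proj₁ T in
          (λ e → in≢out {A = C} c₁ Cw (≡sym e)) , (λ e → in≢out {A = C} c₂ Cw (≡sym e)) , (λ e → in≢out {A = D} Dw d₁ e) , (λ e → in≢out {A = D} Dw d₂ e)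
        pc = private-cut w Uw Fw
        A = proj₁ pc
        D₁ = (C ∪ A) ∩ D
        T₁ : Tight D₁
        T₁ = tight-∩ (tight-∪ TC (proj₁ (proj₂ (proj₂ pc)))) T
        D₁w : D₁ w ≡ false
        D₁w = cong₂ (λ b c → (b ∨ c) ∧ D w) Cw (proj₁ (proj₂ pc))
        T₁' : Tight (add D₁ w)
        T₁' = proj₂ (sep-free {D₁} (proj₁ T₁) Fw) , rank₂-cong (λ x _ → ∪-add-∩ C A D w Dw x) (proj₂ (tight-∩ (tight-∪ TC (proj₂ (proj₂ (proj₂ pc)))) T))
        sub₁ : C ⊑ D₁
        sub₁ x y = cong₂ (λ b c → (b ∨ A x) ∧ c) y (sub x y)

    -- The private cut of `v`, joined to `C`, lies above `C` and stays tight when `v` is added.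
    -- Lowering it by `descend` until it agrees with `C` on `U` leaves the single vertex to be
    -- added.
    next : ∀ C → Tight C → ∀ v → U v ≡ true → Free v → C v ≡ false →
      Σ (Fin m) λ w → U w ≡ true × Free w × C w ≡ false × Tight (add C w)
    next C TC v Uv F Cv =
      let (A , Av , TA , TA') = private-cut v Uv F
          T₀ = tight-∪ TC TA
          T₀' = tight-∪ TC TA'
          (D , w , h₁ , h₂ , h₃ , h₄ , h₅ , h₆ , h₇) = descend C TC (allFin m) (C ∪ A) v T₀
             (proj₂ (sep-free {C ∪ A} (proj₁ T₀) F) , rank₂-cong (λ x _ → taut 3 (λ { (b ∷ c ∷ d ∷ []) → b ∨ (c ∨ d) }) (λ { (b ∷ c ∷ d ∷ []) → (b ∨ c) ∨ d }) refl (C x ∷ A x ∷ does (x ≟ v) ∷ [])) (proj₂ T₀'))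
             (λ x p → cong (_∨ A x) p) (cong₂ _∨_ Cv Av) Uv F
          Cw : C w ≡ false
          Cw = low C D w h₂ h₄ in
      w , h₅ , h₆ , Cw , proj₂ (sep-free (proj₁ TC) h₆) , rank₂-cong (λ x p → cong (_∨ does (x ≟ w)) (same C D x p h₂ h₇)) (proj₂ h₁)
      where
      low : ∀ (C D : Sub m) w → C ⊑ D → D w ≡ false → C w ≡ false
      low C D w sub p with C w in e
      ... | false = refl
      ... | true = ⊥-elim (true≢false (sub w e) p)
      same : ∀ (C D : Sub m) x → U x ≡ true → C ⊑ D → All (λ w → U w ≡ true → D w ≡ true → C w ≡ true) (allFin m) → D x ≡ C x
      same C D x p sub h with C x in e₁ | D x in e₂
      ... | true | true = refl
      ... | false | false = refl
      ... | true | false = ⊥-elim (true≢false (sub x e₁) e₂)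
      ... | false | true = ⊥-elim (true≢false (All.lookup h (∈-allFin x) p e₂) e₁)

module Chains {m} (s s' t t' : Fin m) (U : Sub m) where
  open Ends s s' t t'

  data Chain (a : Adj m) : Sub m → List (Fin m) → Set where
    done : ∀ {C} → (∀ x → U x ≡ true → Free x → C x ≡ true) → Chain a C []
    step : ∀ {C vs} v → U v ≡ true → Free v → C v ≡ false → Rank₂ a U (add C v) → Chain a (add C v) vs → Chain a C (v ∷ vs)

  chain-lc : ∀ {a C vs} z → IsGraph a → U z ≡ true → Chain a C vs → Chain (lcAdj a z) C vs
  chain-lc z gr Uz (done h) = done h
  chain-lc z gr Uz (step v p q r h c) = step v p q r (rank₂-lc z gr Uz h) (chain-lc z gr Uz c)

  abstract
    chain : ∀ {a} → IsGraph a → HasEnds U → Kappa a U → Minimal a U → ∀ k (rem : List (Fin m)) → length rem ≤ k →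
      ∀ C → Sep C → Rank₂ a U C → (∀ x → U x ≡ true → Free x → C x ≡ false → x ∈ rem) → Σ (List (Fin m)) (Chain a C)
    chain {a} gr E K M k rem l C S r cov with any? (λ x → ((U x ≟ᵇ true) ×-dec (C x ≟ᵇ false)) ×-dec free? x)
    ... | no n = [] , done fin
      where
      fin : ∀ x → U x ≡ true → Free x → C x ≡ true
      fin x p q with C x in e
      ... | true = refl
      ... | false = ⊥-elim (n (x , (p , e) , q))
    chain {a} gr E K M zero (_ ∷ _) () C S r cov | yes _
    chain {a} gr E K M zero [] l C S r cov | yes (x , (p , q) , F) with cov x p F q
    ... | ()
    chain {a} gr E K M (suc k) rem l C S r cov | yes (x , (p , q) , F) =
      let (w , Uw , Fw , Cw , S' , r') = Layout.next gr E K M C (S , r) x p F q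
          rem' = filter (λ y → ¬? (y ≟ w)) rem
          (vs , c) = chain gr E K M k rem' (s≤s⁻¹ (≤-trans (filter-notAll (λ y → ¬? (y ≟ w)) rem (Any.map (λ e n → n (≡sym e)) (cov w Uw Fw Cw))) l)) (add C w) S' r'
            (λ y Uy Fy Cy → let (c₁ , c₂) = add-false C w y Cy in ∈-filter⁺ (λ y → ¬? (y ≟ w)) (cov y Uy Fy c₁) c₂) in
      w ∷ vs , step w Uw Fw Cw r' c

-- Straightening a layout: rows as combinations of the rows of `s` and `s'`

any-witness : ∀ {X : Set} (p : X → Bool) xs → any p xs ≡ true → Σ X λ x → p x ≡ true
any-witness p (x ∷ xs) e with p x in q
... | true = x , q
... | false = any-witness p xs e

lin₂ : F₂² → F₂² → F₂² → F₂²
lin₂ (c , d) p q = (c ·₂ p) +₂ (d ·₂ q)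

abstract
  -- If `p` and `q` are independent they span the plane. Otherwise the coefficients of a dependence
  -- are kept, because `convert` turns them into the coefficients of a row.
  relation₂ : ∀ p q r → (Σ F₂² λ c → r ≡ lin₂ c p q) ⊎ (Σ F₂² λ c → c ==₂ 0₂ ≡ false × lin₂ c p q ≡ 0₂)
  relation₂ p q r with any (λ c → r ==₂ lin₂ c p q) all₂ in e
  ... | true = let (c , h) = any-witness (λ c → r ==₂ lin₂ c p q) all₂ e in inj₁ (c , ==₂-sound _ _ h)
  ... | false = let (c , h) = any-witness (λ c → not (c ==₂ 0₂) ∧ (lin₂ c p q ==₂ 0₂)) all₂ (⇒ᵇ-elim (allᵇ-sound 6 chk refl (proj₁ p ∷ proj₂ p ∷ proj₁ q ∷ proj₂ q ∷ proj₁ r ∷ proj₂ r ∷ [])) (cong not e))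
                    (h₁ , h₂) = ∧-true h in
      inj₂ (c , not-true h₁ , ==₂-sound _ _ h₂)
    where
    chk : Vec Bool 6 → Bool
    chk (p₁ ∷ p₂ ∷ q₁ ∷ q₂ ∷ r₁ ∷ r₂ ∷ []) = let p = p₁ , p₂ ; q = q₁ , q₂ ; r = r₁ , r₂ in
      not (any (λ c → r ==₂ lin₂ c p q) all₂) ⇒ᵇ any (λ c → not (c ==₂ 0₂) ∧ (lin₂ c p q ==₂ 0₂)) all₂

dot-lin₂ : ∀ c p q y → dot (lin₂ c p q) y ≡ dot c (dot p y , dot q y)
dot-lin₂ (c , d) (p₁ , p₂) (q₁ , q₂) (y₁ , y₂) =
  taut 8 (λ { (c ∷ d ∷ p₁ ∷ p₂ ∷ q₁ ∷ q₂ ∷ y₁ ∷ y₂ ∷ []) → dot (lin₂ (c , d) (p₁ , p₂) (q₁ , q₂)) (y₁ , y₂) })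
         (λ { (c ∷ d ∷ p₁ ∷ p₂ ∷ q₁ ∷ q₂ ∷ y₁ ∷ y₂ ∷ []) → dot (c , d) (dot (p₁ , p₂) (y₁ , y₂) , dot (q₁ , q₂) (y₁ , y₂)) }) refl
    (c ∷ d ∷ p₁ ∷ p₂ ∷ q₁ ∷ q₂ ∷ y₁ ∷ y₂ ∷ [])

data _⊢_⟿_ {m} (U : Sub m) (a : Adj m) : Adj m → Set where
  stop : U ⊢ a ⟿ a
  flip : ∀ {b} z → U z ≡ true → U ⊢ lcAdj a z ⟿ b → U ⊢ a ⟿ b

⟿-trans : ∀ {m} {U : Sub m} {a b c} → U ⊢ a ⟿ b → U ⊢ b ⟿ c → U ⊢ a ⟿ c
⟿-trans stop q = q
⟿-trans (flip z u p) q = flip z u (⟿-trans p q)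

⟿-graph : ∀ {m} {U : Sub m} {a b} → U ⊢ a ⟿ b → IsGraph a → IsGraph b
⟿-graph stop g = g
⟿-graph (flip z _ p) g = ⟿-graph p (lc-graph z g)

⟿-hasC : ∀ {m} {U : Sub m} {a b} {n} → U ⊢ a ⟿ b → HasC b n → HasC a n
⟿-hasC stop c = c
⟿-hasC (flip z _ p) c = hasC-lc z (⟿-hasC p c)

⟿-¬dep : ∀ {m} {U : Sub m} {a b u w} → U ⊢ a ⟿ b → IsGraph a → ¬ Dep a U u w → ¬ Dep b U u w
⟿-¬dep stop g n = n
⟿-¬dep (flip z u p) g n = ⟿-¬dep p (lc-graph z g) (¬dep-lc z g u n)

module Rows {m} (s s' t t' : Fin m) (U : Sub m) where
  open Ends s s' t t'
  open Chains s s' t t' U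

  module NonDegenerate {a : Adj m} (gr : IsGraph a) (E : HasEnds U) (K : Kappa a U) (M : Minimal a U)
    (ss : a s s' ≡ true) (tt : a t t' ≡ true) (s∉ : s ≢ t × s ≢ t') (s'∉ : s' ≢ t × s' ≢ t') where

    private
      s≢s' : s ≢ s'
      s≢s' refl = true≢false ss (irr gr s)
      t≢t' : t ≢ t'
      t≢t' refl = true≢false tt (irr gr t)

      -- A vertex whose row is 0 or that of w can be deleted: in a thin cut, put it on the side of w.
      redundant : ∀ u w φ → U u ≡ true → Free u → U w ≡ true → w ≢ u → (∀ z → U z ≡ true → z ≢ u → z ≢ w → a u z ≡ φ ∧ a w z) → ⊥
      redundant u w φ Uu F@(f₁ , f₂ , f₃ , f₄) Uw w≢u row with M u Uu F
      ... | (A , (S₁ , S₂ , S₃ , S₄) , f , g , h) = K A' (at s f₁ S₁ , at s' f₂ S₂ , at t f₃ S₃ , at t' f₄ S₄) (f' , g' , fac)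
        where
        A' f' g' : Sub m
        A' x = if does (x ≟ u) then A w else A x
        f' x = if does (x ≟ u) then φ ∧ f w else f x
        g' x = if does (x ≟ u) then φ ∧ g w else g x
        at : ∀ x {b} → u ≢ x → A x ≡ b → A' x ≡ b
        at x n e with x ≟ u
        ... | yes p = ⊥-elim (n (≡sym p))
        ... | no _ = e
        fac : ∀ x y → U x ≡ true → A' x ≡ true → U y ≡ true → A' y ≡ false → a x y ≡ f' x ∧ g' y
        fac x y p q r o with x ≟ u | y ≟ u
        ... | yes refl | yes refl = ⊥-elim (true≢false q o)
        ... | no n | no n' = h x y (del-in U u x p n) q (del-in U u y r n') o
        ... | yes refl | no n' = trans (row y r n' (λ { refl → true≢false q o })) (trans (cong (φ ∧_) (h w y (del-in U u w Uw w≢u) q (del-in U u y r n') o))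
              (taut 3 (λ { (b ∷ c ∷ d ∷ []) → b ∧ (c ∧ d) }) (λ { (b ∷ c ∷ d ∷ []) → (b ∧ c) ∧ d }) refl (φ ∷ f w ∷ g y ∷ [])))
        ... | no n | yes refl = trans (symm gr x u) (trans (row x p n (λ { refl → true≢false q o })) (trans (cong (φ ∧_) (trans (symm gr w x) (h x w (del-in U u x p n) q (del-in U u w Uw w≢u) o)))
              (taut 3 (λ { (b ∷ c ∷ d ∷ []) → b ∧ (c ∧ d) }) (λ { (b ∷ c ∷ d ∷ []) → c ∧ (b ∧ d) }) refl (φ ∷ f x ∷ g w ∷ []))))

      two-rows : ∀ c d b b' → c ∨ d ≡ true → (c ∧ b) xor (d ∧ b') ≡ false →
        (b ≡ d ∧ (if d then b else b')) × (b' ≡ c ∧ (if d then b else b'))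
      two-rows true true true true _ _ = refl , refl
      two-rows true true false false _ _ = refl , refl
      two-rows true false false b' _ _ = refl , refl
      two-rows false true b false _ _ = refl , refl

    -- With coefficient 1 at `u`, the row of `u` is redundant. Otherwise the row of `w` vanishes off
    -- `u`: a free `w` is then redundant itself, and an end `w` contradicts the edge to its partner,
    -- which is not `u`.
    nonDep : ∀ u w → U u ≡ true → Free u → U w ≡ true → u ≢ w → ¬ Dep a U u w
    nonDep u w Uu Fu Uw n (true , d , _ , h) = redundant u w d Uu Fu Uw (λ e → n (≡sym e)) (λ z p q r → xor-eq (h z p q r))
      where
      xor-eq : ∀ {b c} → b xor c ≡ false → b ≡ c
      xor-eq {true} {true} _ = refl
      xor-eq {false} {false} _ = refl
    nonDep u w Uu Fu Uw n (false , true , _ , h) with free? w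
    ... | yes Fw = redundant w u false Uw Fw Uu n (λ z p q r → h z p r q)
    ... | no nf = nf ((λ { refl → true≢false ss (h s' (proj₁ (proj₂ E)) (λ e → proj₁ (proj₂ Fu) (≡sym e)) (λ e → s≢s' (≡sym e))) })
                    , (λ { refl → true≢false (trans (symm gr s' s) ss) (h s (proj₁ E) (λ e → proj₁ Fu (≡sym e)) s≢s') })
                    , (λ { refl → true≢false tt (h t' (proj₂ (proj₂ (proj₂ E))) (λ e → proj₂ (proj₂ (proj₂ Fu)) (≡sym e)) (λ e → t≢t' (≡sym e))) })
                    , (λ { refl → true≢false (trans (symm gr t' t) tt) (h t (proj₁ (proj₂ (proj₂ E))) (λ e → proj₁ (proj₂ (proj₂ Fu)) (≡sym e)) t≢t') }))

    private
      pair : Fin m → Fin m → Sub m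
      pair u w x = does (x ≟ u) ∨ does (x ≟ w)

      pair-false : ∀ u w x → pair u w x ≡ false → x ≢ u × x ≢ w
      pair-false u w x p with x ≟ u | x ≟ w
      ... | no q | no r = q , r

      pair-in₁ : ∀ u w → pair u w u ≡ true
      pair-in₁ u w with u ≟ u
      ... | yes _ = refl
      ... | no q = ⊥-elim (q refl)

      pair-in₂ : ∀ u w → pair u w w ≡ true
      pair-in₂ u w with w ≟ w
      ... | yes _ = taut 1 (λ { (b ∷ []) → b ∨ true }) (λ { (b ∷ []) → true }) refl (does (w ≟ u) ∷ [])
      ... | no q = ⊥-elim (q refl)

      pair-out : ∀ u w x → x ≢ u → x ≢ w → pair u w x ≡ false
      pair-out u w x p q with x ≟ u | x ≟ w
      ... | yes e | _ = ⊥-elim (p e)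
      ... | no _ | yes e = ⊥-elim (q e)
      ... | no _ | no _ = refl

      dep-rank : ∀ u w → u ≢ w → Dep a U u w → Rank₁ a U (pair u w)
      dep-rank u w n (c , d , nz , h) = (λ x → if does (x ≟ u) then d else c) , (λ y → if d then a u y else a w y) , fac
        where
        fac : ∀ x y → U x ≡ true → pair u w x ≡ true → U y ≡ true → pair u w y ≡ false → a x y ≡ (if does (x ≟ u) then d else c) ∧ (if d then a u y else a w y)
        fac x y p q r o with pair-false u w y o
        ... | y≢u , y≢w with x ≟ u | x ≟ w
        ... | yes refl | _ = proj₁ (two-rows c d (a u y) (a w y) nz (h y r y≢u y≢w))
        ... | no _ | yes refl = proj₂ (two-rows c d (a u y) (a w y) nz (h y r y≢u y≢w))

    -- A dependence would make the pair `s`, `s'` itself a separating cut of rank at most 1.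
    nonDep-s : ¬ Dep a U s s'
    nonDep-s D = K (pair s s') (pair-in₁ s s' , pair-in₂ s s' , pair-out s s' t (λ e → proj₁ s∉ (≡sym e)) (λ e → proj₁ s'∉ (≡sym e)) , pair-out s s' t' (λ e → proj₂ s∉ (≡sym e)) (λ e → proj₂ s'∉ (≡sym e))) (dep-rank s s' s≢s' D)

    nonDep-t : ¬ Dep a U t t'
    nonDep-t D = K (∁ˢ (pair t t')) (cong not (pair-out t t' s (proj₁ s∉) (proj₂ s∉)) , cong not (pair-out t t' s' (proj₁ s'∉) (proj₂ s'∉)) , cong not (pair-in₁ t t') , cong not (pair-in₂ t t'))
      (rank₁-∁ gr (dep-rank t t' t≢t' D))

  kappa-lc : ∀ {a} z → IsGraph a → U z ≡ true → Kappa a U → Kappa (lcAdj a z) U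
  kappa-lc z gr Uz K A S = ¬rank₁-lc z gr Uz (K A S)

  β : Adj m → Fin m → F₂²
  β a w = a s w , a s' w

  RowGood : Adj m → Fin m → F₂² → Sub m → Set
  RowGood a u l D = ∀ w → U w ≡ true → D w ≡ false → a u w ≡ dot l (β a w)

  -- The relation between the rows of `u`, `s` and `s'` holds at `v` too, so the multiples of the
  -- row of `v` that are added to the three rows satisfy the same relation.
  rowGood-lc : ∀ {a u l D} v → IsGraph a → D v ≡ false → D s ≡ true → D s' ≡ true → D u ≡ true → U v ≡ true →
    RowGood a u l D → RowGood (lcAdj a v) u l D
  rowGood-lc {a} {u} {l₁ , l₂} {D} v gr Dv Ds Ds' Du Uv R w Uw Dw with w ≟ v
  ... | yes refl = trans (lc-col v gr u) (trans (R v Uv Dv) (≡sym (cong₂ (λ b c → dot (l₁ , l₂) (b , c)) (lc-col v gr s) (lc-col v gr s'))))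
  ... | no _ = trans (lc-≢ a v (in≢out {A = D} Du Dw)) (trans (cong₂ (λ b c → b xor (c ∧ a v w)) (R w Uw Dw) (trans (symm gr v u) (R v Uv Dv)))
      (trans (taut 7 (λ { (l ∷ k ∷ b ∷ b' ∷ c ∷ c' ∷ e ∷ []) → dot (l , k) (b , b') xor (dot (l , k) (c , c') ∧ e) })
                     (λ { (l ∷ k ∷ b ∷ b' ∷ c ∷ c' ∷ e ∷ []) → dot (l , k) (b xor (c ∧ e) , b' xor (c' ∧ e)) }) refl (l₁ ∷ l₂ ∷ a s w ∷ a s' w ∷ a s v ∷ a s' v ∷ a v w ∷ []))
        (≡sym (cong₂ (λ b c → dot (l₁ , l₂) (b , c)) (trans (lc-≢ a v (in≢out {A = D} Ds Dw)) (cong (λ b → a s w xor (b ∧ a v w)) (symm gr v s)))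
                                                     (trans (lc-≢ a v (in≢out {A = D} Ds' Dw)) (cong (λ b → a s' w xor (b ∧ a v w)) (symm gr v s')))))))

  data KForm (a : Adj m) : Sub m → List (Fin m) → Set where
    nil : ∀ {C} → KForm a C []
    cons : ∀ {C vs} v l → U v ≡ true → Free v → C v ≡ false → RowGood a v l (add C v) → KForm a (add C v) vs → KForm a C (v ∷ vs)

  -- Later complementations must not spoil rows that are already settled. Each of them was settled
  -- off its own prefix, hence the quantification over all smaller `D`.
  Preserves : Adj m → Adj m → Sub m → Set
  Preserves a a' C = ∀ D u l → D ⊑ C → D s ≡ true → D s' ≡ true → D u ≡ true → RowGood a u l D → RowGood a' u l D

  private
    ⊑-false : ∀ {D C : Sub m} → D ⊑ C → ∀ x → C x ≡ false → D x ≡ false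
    ⊑-false {D} h x p with D x in e
    ... | false = refl
    ... | true = ⊥-elim (true≢false (h x e) p)

    -- In `F₂²` a vector orthogonal to a nonzero `(c₁ , c₂)` is a multiple of `(c₂ , c₁)`; the
    -- conditional reads the multiple off a nonzero coordinate.
    line : ∀ c₁ c₂ b₁ b₂ → (c₁ , c₂) ==₂ 0₂ ≡ false → dot (c₁ , c₂) (b₁ , b₂) ≡ false → ∀ l₁ l₂ →
      dot (l₁ , l₂) (b₁ , b₂) ≡ dot (l₁ , l₂) (c₂ , c₁) ∧ (if c₂ then b₁ else b₂)
    line c₁ c₂ b₁ b₂ p q l₁ l₂ = ⇔ᵇ-sound _ _ (⇒ᵇ-elim (⇒ᵇ-elim (allᵇ-sound 6 (λ { (c₁ ∷ c₂ ∷ b₁ ∷ b₂ ∷ l₁ ∷ l₂ ∷ []) →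
      not ((c₁ , c₂) ==₂ 0₂) ⇒ᵇ (not (dot (c₁ , c₂) (b₁ , b₂)) ⇒ᵇ (dot (l₁ , l₂) (b₁ , b₂) ⇔ᵇ (dot (l₁ , l₂) (c₂ , c₁) ∧ (if c₂ then b₁ else b₂)))) }) refl (c₁ ∷ c₂ ∷ b₁ ∷ b₂ ∷ l₁ ∷ l₂ ∷ [])) (cong not p)) (cong not q))

  -- Each vertex v in turn: its row on the later vertices is a combination of
  -- those of s and s', if necessary after a local complementation at v.
  abstract
    convert : ∀ {a C vs} → IsGraph a → Chain a C vs → Sep C → Kappa a U → HasEnds U → (Λ : Fin m → F₂²) →
      (∀ x → U x ≡ true → C x ≡ true → RowGood a x (Λ x) C) →
      Σ (Adj m) λ a' → (U ⊢ a ⟿ a') × Preserves a a' C × KForm a' C vs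
    convert {a} gr (done _) S K E Λ rows = a , stop , (λ _ _ _ _ _ _ _ r → r) , nil
    convert {a} {C} gr (step {vs = vs} v Uv Fv Cv (α , δ , h) ch) S@(Cs , Cs' , Ct , Ct') K E Λ rows with relation₂ (α s) (α s') (α v)
    ... | inj₁ (c , e) =
      let (a' , r , pr , k) = convert gr ch S' K E (λ x → if does (x ≟ v) then c else Λ x) rows' in
      a' , r , (λ D u l D⊑ Ds Ds' Du R → pr D u l (λ x p → add-mono C v x (D⊑ x p)) Ds Ds' Du R) ,
      cons v c Uv Fv Cv (pr (add C v) v c (λ _ p → p) (proj₁ S') (proj₁ (proj₂ S')) (add-self C v) new) k
      where
      S' : Sep (add C v)
      S' = add-mono C v s Cs , add-mono C v s' Cs' , add-out C v t Ct (λ e → proj₁ (proj₂ (proj₂ Fv)) (≡sym e)) , add-out C v t' Ct' (λ e → proj₂ (proj₂ (proj₂ Fv)) (≡sym e))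
      new : RowGood a v c (add C v)
      new w Uw Cw = trans (h v w Uv (add-self C v) Uw Cw) (trans (cong (λ p → dot p (δ w)) e) (trans (dot-lin₂ c (α s) (α s') (δ w))
        (≡sym (cong₂ (λ p q → dot c (p , q)) (h s w (proj₁ E) (proj₁ S') Uw Cw) (h s' w (proj₁ (proj₂ E)) (proj₁ (proj₂ S')) Uw Cw)))))
      rows' : ∀ x → U x ≡ true → add C v x ≡ true → RowGood a x (if does (x ≟ v) then c else Λ x) (add C v)
      rows' x p q w Uw Cw with x ≟ v | add-true C v x q
      ... | yes refl | _ = new w Uw Cw
      ... | no n | inj₂ e = ⊥-elim (n e)
      ... | no n | inj₁ q' = rows x p q' w Uw (proj₁ (add-false C v w Cw))
    ... | inj₂ (c , c≢0 , e) with dot c (β a v) in ev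
    -- Now `c` annihilates the columns of all vertices of `U` outside `C`. They lie on one line, so
    -- `C` would have rank at most 1.
    ... | false = ⊥-elim (K C S ((λ x → dot (Λ x) (proj₂ c , proj₁ c)) , (λ w → if proj₂ c then a s w else a s' w) ,
          λ x w p q r o → trans (rows x p q w r o) (line (proj₁ c) (proj₂ c) (a s w) (a s' w) c≢0 (perp w r o) (proj₁ (Λ x)) (proj₂ (Λ x)))))
      where
      perp : ∀ w → U w ≡ true → C w ≡ false → dot c (β a w) ≡ false
      perp w Uw Cw with w ≟ v
      ... | yes refl = ev
      ... | no n = let o = add-out C v w Cw n in
        trans (cong₂ (λ p q → dot c (p , q)) (h s w (proj₁ E) (add-mono C v s Cs) Uw o) (h s' w (proj₁ (proj₂ E)) (add-mono C v s' Cs') Uw o))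
          (trans (≡sym (dot-lin₂ c (α s) (α s') (δ w))) (cong (λ p → dot p (δ w)) e))
    -- The combination `c` of the rows of `s` and `s'` vanishes after `v` but is 1 at `v`.
    -- Complementing at `v` turns its entry at a later `w` into `a v w`, so it becomes the row of
    -- `v`.
    ... | true =
      let (a' , r , pr , k) = convert gr₁ (chain-lc v gr Uv ch) S' (kappa-lc v gr Uv K) E (λ x → if does (x ≟ v) then c else Λ x) rows' in
      a' , flip v Uv r ,
      (λ D u l D⊑ Ds Ds' Du R → pr D u l (λ x p → add-mono C v x (D⊑ x p)) Ds Ds' Du (rowGood-lc {l = l} {D = D} v gr (⊑-false D⊑ v Cv) Ds Ds' Du Uv R)) ,
      cons v c Uv Fv Cv (pr (add C v) v c (λ _ p → p) (proj₁ S') (proj₁ (proj₂ S')) (add-self C v) new) k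
      where
      gr₁ : IsGraph (lcAdj a v)
      gr₁ = lc-graph v gr
      S' : Sep (add C v)
      S' = add-mono C v s Cs , add-mono C v s' Cs' , add-out C v t Ct (λ e → proj₁ (proj₂ (proj₂ Fv)) (≡sym e)) , add-out C v t' Ct' (λ e → proj₂ (proj₂ (proj₂ Fv)) (≡sym e))
      perp : ∀ w → U w ≡ true → add C v w ≡ false → dot c (β a w) ≡ false
      perp w Uw o = trans (cong₂ (λ p q → dot c (p , q)) (h s w (proj₁ E) (proj₁ S') Uw o) (h s' w (proj₁ (proj₂ E)) (proj₁ (proj₂ S')) Uw o))
          (trans (≡sym (dot-lin₂ c (α s) (α s') (δ w))) (cong (λ p → dot p (δ w)) e))
      new : RowGood (lcAdj a v) v c (add C v)
      new w Uw o = trans (lc-row v gr w) (≡sym (trans (cong₂ (λ p q → dot c (p , q))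
          (trans (lc-≢ a v (in≢out {A = add C v} (proj₁ S') o)) (cong (λ b → a s w xor (b ∧ a v w)) (symm gr v s)))
          (trans (lc-≢ a v (in≢out {A = add C v} (proj₁ (proj₂ S')) o)) (cong (λ b → a s' w xor (b ∧ a v w)) (symm gr v s'))))
        (trans (taut 7 (λ { (c ∷ d ∷ x ∷ y ∷ x' ∷ y' ∷ z ∷ []) → dot (c , d) (x xor (x' ∧ z) , y xor (y' ∧ z)) }) (λ { (c ∷ d ∷ x ∷ y ∷ x' ∷ y' ∷ z ∷ []) → dot (c , d) (x , y) xor (dot (c , d) (x' , y') ∧ z) }) refl
             (proj₁ c ∷ proj₂ c ∷ a s w ∷ a s' w ∷ a s v ∷ a s' v ∷ a v w ∷ []))
          (cong₂ (λ p q → p xor (q ∧ a v w)) (perp w Uw o) ev))))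
      rows' : ∀ x → U x ≡ true → add C v x ≡ true → RowGood (lcAdj a v) x (if does (x ≟ v) then c else Λ x) (add C v)
      rows' x p q w Uw Cw with x ≟ v | add-true C v x q
      ... | yes refl | _ = new w Uw Cw
      ... | no n | inj₂ e = ⊥-elim (n e)
      ... | no n | inj₁ q' = rowGood-lc {l = Λ x} {D = C} v gr Cv Cs Cs' q' Uv (rows x p q') w Uw (proj₁ (add-false C v w Cw))

-- Words of types

-- A vertex of type (l , c) is adjacent to a later one of type (l' , c') iff dot l c' is true,
-- so ω tells whether the adjacency of two types depends on their order.
ω : F₂⁴ → F₂⁴ → Bool
ω (p , q) (r , s) = dot p s xor dot r q

==₄-false : ∀ {p q} → p ==₄ q ≡ false → p ≢ q
==₄-false {p} e refl = true≢false (==₄-refl p) e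

∈-all₂ : ∀ p → p ∈ all₂
∈-all₂ (false , false) = here refl
∈-all₂ (false , true) = there (here refl)
∈-all₂ (true , false) = there (there (here refl))
∈-all₂ (true , true) = there (there (there (here refl)))

∈-all₄ : ∀ p → p ∈ all₄
∈-all₄ (p , q) = go p q (∈-all₂ p) (∈-all₂ q)
  where
  go : ∀ p q → p ∈ all₂ → q ∈ all₂ → (p , q) ∈ all₄
  go p q i j = ∈-cartesianProduct⁺ i j

ncPairs : List (F₂⁴ × F₂⁴)
ncPairs = filterᵇ (λ (X , Y) → ω X Y) (cartesianProduct all₄ all₄)

∈-filterᵇ : ∀ {A : Set} (p : A → Bool) {x xs} → x ∈ xs → p x ≡ true → x ∈ filterᵇ p xs
∈-filterᵇ p {x} {y ∷ xs} (here refl) e rewrite e = here refl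
∈-filterᵇ p {x} {y ∷ xs} (there i) e with p y
... | true = there (∈-filterᵇ p i e)
... | false = ∈-filterᵇ p i e

filterᵇ-∈ : ∀ {A : Set} (p : A → Bool) {x} xs → x ∈ filterᵇ p xs → p x ≡ true
filterᵇ-∈ p (y ∷ xs) i with p y in e
filterᵇ-∈ p (y ∷ xs) (here refl) | true = e
filterᵇ-∈ p (y ∷ xs) (there i) | true = filterᵇ-∈ p xs i
... | false = filterᵇ-∈ p xs i

∈-ncPairs : ∀ X Y → ω X Y ≡ true → (X , Y) ∈ ncPairs
∈-ncPairs X Y e = ∈-filterᵇ (λ (X , Y) → ω X Y) (∈-cartesianProduct⁺ (∈-all₄ X) (∈-all₄ Y)) e

sum-mono : ∀ {A : Set} {f g : A → ℕ} xs → (∀ x → f x ≤ g x) → sum (map f xs) ≤ sum (map g xs)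
sum-mono [] h = z≤n
sum-mono (x ∷ xs) h = +-mono-≤ (h x) (sum-mono xs h)

sum-mono-< : ∀ {A : Set} {f g : A → ℕ} {x} xs → (∀ x → f x ≤ g x) → x ∈ xs → f x < g x → sum (map f xs) < sum (map g xs)
sum-mono-< (x ∷ xs) h (here refl) l = +-mono-≤ l (sum-mono xs h)
sum-mono-< {f = f} {g} (y ∷ xs) h (there i) l = subst (_≤ g y + sum (map g xs)) (+-suc (f y) _) (+-mono-≤ (h y) (sum-mono-< xs h i l))

sum-bound : ∀ {A : Set} {f : A → ℕ} {k} xs → All (λ x → f x ≤ k) xs → sum (map f xs) ≤ length xs * k
sum-bound [] [] = z≤n
sum-bound (x ∷ xs) (p ∷ ps) = +-mono-≤ p (sum-bound xs ps)

toNat : Bool → ℕ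
toNat b = if b then 1 else 0

module Words {E : Set} (typ : E → F₂⁴) where

  occurs : F₂⁴ → List E → Bool
  occurs X [] = false
  occurs X (e ∷ es) = if typ e ==₄ X then true else occurs X es

  separated : F₂⁴ → List E → Bool
  separated X [] = true
  separated X (e ∷ es) = if typ e ==₄ X then false else (if ω X (typ e) then true else separated X es)

  turns : F₂⁴ → F₂⁴ → List E → Bool
  turns X Y [] = false
  turns X Y (e ∷ es) = if typ e ==₄ X then false else (if typ e ==₄ Y then true else turns X Y es)

  #turns : F₂⁴ → F₂⁴ → List E → ℕ
  #turns X Y [] = 0
  #turns X Y (e ∷ es) = toNat ((typ e ==₄ X) ∧ turns X Y es) + #turns X Y es

  Separated : List E → Set
  Separated [] = ⊤
  Separated (e ∷ es) = separated (typ e) es ≡ true × Separated es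

  -- The letter that separates the two occurrences of `X` serves as `Y`.
  turn : ∀ X es → separated X es ≡ true → occurs X es ≡ true → Σ F₂⁴ λ Y → ω X Y ≡ true × turns X Y es ≡ true
  turn X (e ∷ es) p q with typ e ==₄ X in e₁
  ... | false with ω X (typ e) in e₂
  ... | true = typ e , e₂ , cong (λ b → if b then true else turns X (typ e) es) (==₄-refl (typ e))
  ... | false = let (Y , h₁ , h₂) = turn X es p q in Y , h₁ , skip Y h₂
    where
    skip : ∀ Y → turns X Y es ≡ true → (if typ e ==₄ Y then true else turns X Y es) ≡ true
    skip Y h with typ e ==₄ Y
    ... | true = refl
    ... | false = h

  total : List (F₂⁴ × F₂⁴) → List E → ℕ
  total ps es = sum (map (λ (X , Y) → #turns X Y es) ps)

  letters : List F₂⁴ → List E → ℕ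
  letters xs es = sum (map (λ X → toNat (occurs X es)) xs)

  private
    more : ∀ e es X → toNat (occurs X es) ≤ toNat (occurs X (e ∷ es))
    more e es X with typ e ==₄ X | occurs X es
    ... | true | true = ≤-refl
    ... | true | false = z≤n
    ... | false | _ = ≤-refl

  -- Between two occurrences of a letter X lies a letter that does not commute with X, so every
  -- position that is not the last one of its letter is charged to a turn X Y with ω X Y.
  length-bound : ∀ ps xs → (∀ X Y → ω X Y ≡ true → (X , Y) ∈ ps) → (∀ X → X ∈ xs) → ∀ es → Separated es → length es ≤ total ps es + letters xs es
  length-bound ps xs hp hx [] _ = z≤n
  length-bound ps xs hp hx (e ∷ es) (p , q) with occurs (typ e) es in o
  ... | true = let (Y , h₁ , h₂) = turn (typ e) es p o in
    ≤-trans (s≤s (length-bound ps xs hp hx es q)) (+-mono-≤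
      (sum-mono-< {f = λ (X , Y) → #turns X Y es} {g = λ (X , Y) → #turns X Y (e ∷ es)} ps (λ (X , Y) → m≤n+m _ _) (hp (typ e) Y h₁)
        (≤-reflexive (≡sym (cong (λ b → toNat b + #turns (typ e) Y es) (cong₂ _∧_ (==₄-refl (typ e)) h₂)))))
      (sum-mono xs (more e es)))
  ... | false = ≤-trans (s≤s (length-bound ps xs hp hx es q)) (subst (_≤ total ps (e ∷ es) + letters xs (e ∷ es)) (+-suc (total ps es) (letters xs es))
      (+-mono-≤ (sum-mono {f = λ (X , Y) → #turns X Y es} {g = λ (X , Y) → #turns X Y (e ∷ es)} ps (λ (X , Y) → m≤n+m _ _))
        (sum-mono-< {f = λ X → toNat (occurs X es)} {g = λ X → toNat (occurs X (e ∷ es))} xs (more e es) (hx (typ e)) strict)))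
    where
    strict : toNat (occurs (typ e) es) < toNat (occurs (typ e) (e ∷ es))
    strict rewrite o | ==₄-refl (typ e) = ≤-refl

  abstract
    -- Each of the 15 nonzero types fails to commute with 8 types, which gives 120 ordered pairs.
    -- The 16 pays for the last occurrence of each letter.
    manyTurns : ∀ k es → Separated es → 120 * k + 16 < length es → Σ F₂⁴ λ X → Σ F₂⁴ λ Y → ω X Y ≡ true × k < #turns X Y es
    manyTurns k es S l with All.all? (λ (X , Y) → #turns X Y es ≤? k) ncPairs
    ... | yes h = ⊥-elim (<⇒≱ l (≤-trans (length-bound ncPairs all₄ ∈-ncPairs ∈-all₄ es S) (+-mono-≤ (sum-bound {f = λ (X , Y) → #turns X Y es} ncPairs h) (sum-bound {k = 1} all₄ (All.universal (λ X → one (occurs X es)) all₄)))))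
      where
      one : ∀ b → toNat b ≤ 1
      one true = ≤-refl
      one false = z≤n
    ... | no n = let ((X , Y) , i , h) = find (¬All⇒Any¬ (λ (X , Y) → #turns X Y es ≤? k) ncPairs n) in
      X , Y , filterᵇ-∈ (λ (X , Y) → ω X Y) (cartesianProduct all₄ all₄) i , ≰⇒> h

  data Alt : F₂⁴ → F₂⁴ → List E → Set where
    [] : ∀ {X Y} → Alt X Y []
    _∷_ : ∀ {X Y e es} → typ e ≡ X → Alt Y X es → Alt X Y (e ∷ es)

  abstract
    mutual
      -- Each turn contributes its `X` and the next `Y`. That `L` is a sublist is expressed by what
      -- it inherits, for an arbitrary relation and an arbitrary predicate.
      alternate : ∀ {R : E → E → Set} X Y es → Σ (List E) λ L → Alt X Y L × length L ≡ #turns X Y es + #turns X Y es × (AllPairs R es → AllPairs R L) × (∀ (P : E → Set) → All P es → All P L)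
      alternate X Y [] = [] , [] , refl , (λ p → p) , (λ _ p → p)
      alternate {R} X Y (e ∷ es) with typ e ==₄ X in e₁ | turns X Y es in e₂
      ... | true | true = let (L , A , l , p , q) = alternate' {R} X Y es e₂ in
        e ∷ L , ==₄-sound _ _ e₁ ∷ A , trans (cong suc l) (≡sym (cong suc (+-suc _ _))) , (λ { (h ∷ hs) → q (R e) h ∷ p hs }) , (λ { P (h ∷ hs) → h ∷ q P hs })
      ... | true | false = let (L , A , l , p , q) = alternate {R} X Y es in L , A , l , (λ { (h ∷ hs) → p hs }) , (λ { P (h ∷ hs) → q P hs })
      ... | false | _ = let (L , A , l , p , q) = alternate {R} X Y es in L , A , l , (λ { (h ∷ hs) → p hs }) , (λ { P (h ∷ hs) → q P hs })

      alternate' : ∀ {R : E → E → Set} X Y es → turns X Y es ≡ true → Σ (List E) λ L → Alt Y X L × length L ≡ suc (#turns X Y es + #turns X Y es) × (AllPairs R es → AllPairs R L) × (∀ (P : E → Set) → All P es → All P L)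
      alternate' {R} X Y (e ∷ es) t with typ e ==₄ X in e₁
      ... | false with typ e ==₄ Y in e₂
      ... | true = let (L , A , l , p , q) = alternate {R} X Y es in
        e ∷ L , ==₄-sound _ _ e₂ ∷ A , cong suc l , (λ { (h ∷ hs) → q (R e) h ∷ p hs }) , (λ { P (h ∷ hs) → h ∷ q P hs })
      ... | false = let (L , A , l , p , q) = alternate' {R} X Y es t in L , A , l , (λ { (h ∷ hs) → p hs }) , (λ { P (h ∷ hs) → q P hs })

-- The word of types of a straightened layout

module Entries {m} (s s' t t' : Fin m) (U : Sub m) (a : Adj m) (gr : IsGraph a) where
  open Ends s s' t t'
  open Rows s s' t t' U

  Entry : Set
  Entry = Fin m × F₂²

  typ : Entry → F₂⁴
  typ (v , l) = l , β a v

  open Words typ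

  entries : ∀ {C vs} → KForm a C vs → List Entry
  entries nil = []
  entries (cons v l _ _ _ _ k) = (v , l) ∷ entries k

  Before : Entry → Entry → Set
  Before (u , l) (w , _) = u ≢ w × a u w ≡ dot l (β a w)

  entries-out : ∀ {C vs} (k : KForm a C vs) → All (λ e → U (proj₁ e) ≡ true × Free (proj₁ e) × C (proj₁ e) ≡ false) (entries k)
  entries-out nil = []
  entries-out (cons {C} v l Uv Fv Cv R k) = (Uv , Fv , Cv) ∷ All.map (λ { (p , q , r) → p , q , proj₁ (add-false C v _ r) }) (entries-out k)

  entries-pairs : ∀ {C vs} (k : KForm a C vs) → AllPairs Before (entries k)
  entries-pairs nil = []
  entries-pairs (cons {C} v l Uv Fv Cv R k) = All.map (λ { {w , _} (p , q , r) → (λ e → proj₂ (add-false C v w r) (≡sym e)) , R w p r }) (entries-out k) ∷ entries-pairs k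

  module _ (nd : ∀ u w → U u ≡ true → Free u → U w ≡ true → u ≢ w → ¬ Dep a U u w) where

    private
      xor-false : ∀ {b c} → b xor c ≡ false → b ≡ c
      xor-false {true} {true} _ = refl
      xor-false {false} {false} _ = refl

      -- If the type of `u` recurred at `w` with only commuting types between, the two would be
      -- twins: a vertex placed before `w` sees both through the same column, and both see later
      -- vertices with the same coefficients. A vertex between them can be treated as if it preceded
      -- `u`, since commuting makes its adjacency to `u` the same in either order; `prev` records
      -- this.
      scan : ∀ u l → U u ≡ true → Free u → ∀ {C vs} (k : KForm a C vs) → C u ≡ true → RowGood a u l C →
        (∀ z → U z ≡ true → C z ≡ true → z ≢ u → Σ F₂² λ l' → RowGood a z l' C × a u z ≡ dot l' (β a u)) →
        separated (l , β a u) (entries k) ≡ true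
      scan u l Uu Fu nil Cu R prev = refl
      scan u l Uu Fu (cons {C} w l' Uw Fw Cw R' k) Cu R prev with (l' , β a w) ==₄ (l , β a u) in e₁
      ... | true = ⊥-elim (nd u w Uu Fu Uw u≢w (true , true , refl , twin))
        where
        same : (l' , β a w) ≡ (l , β a u)
        same = ==₄-sound _ _ e₁
        u≢w : u ≢ w
        u≢w = in≢out {A = C} Cu Cw
        eq⇒xor : ∀ {b c} → b ≡ c → b xor c ≡ false
        eq⇒xor {true} refl = refl
        eq⇒xor {false} refl = refl
        twin : ∀ z → U z ≡ true → z ≢ u → z ≢ w → a u z xor a w z ≡ false
        twin z Uz zu zw with C z in Cz
        ... | true = let (lz , Rz , h) = prev z Uz Cz zu in
          eq⇒xor (trans h (trans (cong (dot lz) (≡sym (cong proj₂ same))) (trans (≡sym (Rz w Uw Cw)) (symm gr z w))))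
        ... | false = eq⇒xor (trans (R z Uz Cz) (trans (cong (λ p → dot p (β a z)) (≡sym (cong proj₁ same))) (≡sym (R' z Uz (add-out C w z Cz zw)))))
      ... | false with ω (l , β a u) (l' , β a w) in e₂
      ... | true = refl
      ... | false = scan u l Uu Fu k (add-mono C w u Cu) (λ z p q → R z p (proj₁ (add-false C w z q))) prev'
        where
        prev' : ∀ z → U z ≡ true → add C w z ≡ true → z ≢ u → Σ F₂² λ l'' → RowGood a z l'' (add C w) × a u z ≡ dot l'' (β a u)
        prev' z Uz Cz zu with add-true C w z Cz
        ... | inj₁ q = let (lz , Rz , h) = prev z Uz q zu in lz , (λ y p q → Rz y p (proj₁ (add-false C w y q))) , h
        ... | inj₂ refl = l' , R' , trans (R w Uw Cw) (xor-false e₂)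

    entries-separated : ∀ {C vs} (k : KForm a C vs) → (∀ z → U z ≡ true → C z ≡ true → Σ F₂² λ l → RowGood a z l C) → Separated (entries k)
    entries-separated nil rows = tt
    entries-separated (cons {C} v l Uv Fv Cv R k) rows =
      scan v l Uv Fv k (add-self C v) R prev , entries-separated k rows'
      where
      rows' : ∀ z → U z ≡ true → add C v z ≡ true → Σ F₂² λ l → RowGood a z l (add C v)
      rows' z Uz p with add-true C v z p
      ... | inj₁ q = let (lz , Rz) = rows z Uz q in lz , λ y p q → Rz y p (proj₁ (add-false C v y q))
      ... | inj₂ refl = l , R
      prev : ∀ z → U z ≡ true → add C v z ≡ true → z ≢ v → Σ F₂² λ l' → RowGood a z l' (add C v) × a v z ≡ dot l' (β a v)
      prev z Uz p n with add-true C v z p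
      ... | inj₁ q = let (lz , Rz) = rows z Uz q in lz , (λ y p q → Rz y p (proj₁ (add-false C v y q))) , trans (symm gr v z) (Rz v Uv Cv)
      ... | inj₂ e = ⊥-elim (n e)

-- Adjusting the two ends

-- A symmetric bilinear form on `F₂²`, given by the entries of its matrix. Complementing at a vertex
-- with row vector `v` adds the rank-one form `square v`.
Form : Set
Form = Bool × Bool × Bool

qf : Form → F₂² → F₂² → Bool
qf (q₁ , q₂ , q₃) (x , y) (x' , y') = (q₁ ∧ (x ∧ x')) xor ((q₂ ∧ ((x ∧ y') xor (y ∧ x'))) xor (q₃ ∧ (y ∧ y')))

square : F₂² → Form
square (x , y) = x , x ∧ y , y

_+ᶠ_ : Form → Form → Form
(a , b , c) +ᶠ (d , e , f) = a xor d , b xor e , c xor f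

_==ᶠ_ : Form → Form → Bool
(a , p) ==ᶠ (b , q) = (a ⇔ᵇ b) ∧ (p ==₂ q)

==ᶠ-sound : ∀ P Q → P ==ᶠ Q ≡ true → P ≡ Q
==ᶠ-sound (a , p) (b , q) e = cong₂ _,_ (⇔ᵇ-sound a b (proj₁ (∧-true e))) (==₂-sound p q (proj₂ (∧-true {a ⇔ᵇ b} e)))

qf-square : ∀ c Q x y v → (c xor qf Q x y) xor (dot v x ∧ dot v y) ≡ c xor qf (Q +ᶠ square v) x y
qf-square c (q₁ , q₂ , q₃) (x₁ , x₂) (y₁ , y₂) (v₁ , v₂) =
  taut 10 (λ { (c ∷ q₁ ∷ q₂ ∷ q₃ ∷ x₁ ∷ x₂ ∷ y₁ ∷ y₂ ∷ v₁ ∷ v₂ ∷ []) → (c xor qf (q₁ , q₂ , q₃) (x₁ , x₂) (y₁ , y₂)) xor (dot (v₁ , v₂) (x₁ , x₂) ∧ dot (v₁ , v₂) (y₁ , y₂)) })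
          (λ { (c ∷ q₁ ∷ q₂ ∷ q₃ ∷ x₁ ∷ x₂ ∷ y₁ ∷ y₂ ∷ v₁ ∷ v₂ ∷ []) → c xor qf ((q₁ , q₂ , q₃) +ᶠ square (v₁ , v₂)) (x₁ , x₂) (y₁ , y₂) }) refl
    (c ∷ q₁ ∷ q₂ ∷ q₃ ∷ x₁ ∷ x₂ ∷ y₁ ∷ y₂ ∷ v₁ ∷ v₂ ∷ [])

qf-sym : ∀ Q x y → qf Q x y ≡ qf Q y x
qf-sym (q₁ , q₂ , q₃) (x₁ , x₂) (y₁ , y₂) = taut 7 (λ { (q₁ ∷ q₂ ∷ q₃ ∷ x₁ ∷ x₂ ∷ y₁ ∷ y₂ ∷ []) → qf (q₁ , q₂ , q₃) (x₁ , x₂) (y₁ , y₂) })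
  (λ { (q₁ ∷ q₂ ∷ q₃ ∷ x₁ ∷ x₂ ∷ y₁ ∷ y₂ ∷ []) → qf (q₁ , q₂ , q₃) (y₁ , y₂) (x₁ , x₂) }) refl (q₁ ∷ q₂ ∷ q₃ ∷ x₁ ∷ x₂ ∷ y₁ ∷ y₂ ∷ [])

⟿-mono : ∀ {m} {W U : Sub m} {a b} → W ⊑ U → W ⊢ a ⟿ b → U ⊢ a ⟿ b
⟿-mono h stop = stop
⟿-mono h (flip z p q) = flip z (h z p) (⟿-mono h q)

LinRel : ∀ {m} → Sub m → Adj m → (x y z : Fin m) → F₂² → Set
LinRel U a x y z l = ∀ u → U u ≡ true → u ≢ x → u ≢ y → u ≢ z → a z u ≡ dot l (a x u , a y u)

linRel-lc : ∀ {m} {U : Sub m} {a x y z l} v → IsGraph a → U v ≡ true → v ≢ x → v ≢ y → v ≢ z → LinRel U a x y z l → LinRel U (lcAdj a v) x y z l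
linRel-lc {a = a} {x} {y} {z} {l₁ , l₂} v gr Uv vx vy vz R u Uu ux uy uz =
  trans (lc-≢ a v (λ e → uz (≡sym e))) (trans (cong₂ (λ b c → b xor (c ∧ a v u)) (R u Uu ux uy uz) (trans (symm gr v z) (R v Uv vx vy vz)))
  (trans (taut 7 (λ { (l ∷ k ∷ b ∷ b' ∷ c ∷ c' ∷ e ∷ []) → dot (l , k) (b , b') xor (dot (l , k) (c , c') ∧ e) })
                 (λ { (l ∷ k ∷ b ∷ b' ∷ c ∷ c' ∷ e ∷ []) → dot (l , k) (b xor (c ∧ e) , b' xor (c' ∧ e)) }) refl (l₁ ∷ l₂ ∷ a x u ∷ a y u ∷ a x v ∷ a y v ∷ a v u ∷ []))
    (≡sym (cong₂ (λ b c → dot (l₁ , l₂) (b , c)) (trans (lc-≢ a v (λ e → ux (≡sym e))) (cong (λ b → a x u xor (b ∧ a v u)) (symm gr v x)))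
                                                 (trans (lc-≢ a v (λ e → uy (≡sym e))) (cong (λ b → a y u xor (b ∧ a v u)) (symm gr v y)))))))

linRel-⟿ : ∀ {m} {U W : Sub m} {a b x y z l} → IsGraph a → W ⊑ U → W x ≡ false → W y ≡ false → W z ≡ false → W ⊢ a ⟿ b → LinRel U a x y z l → LinRel U b x y z l
linRel-⟿ gr s p q r stop R = R
linRel-⟿ {W = W} {l = l} gr s p q r (flip v Wv h) R = linRel-⟿ {l = l} (lc-graph v gr) s p q r h
  (linRel-lc {l = l} v gr (s v Wv) (in≢out {A = W} Wv p) (in≢out {A = W} Wv q) (in≢out {A = W} Wv r) R)

-- Local complementations inside a triple {x , y , z} add to the rest of the graph a symmetric form in the
-- adjacencies to x and y; outer expresses the current rows of the triple through the initial rows of x and y.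
record TripleState : Set where
  constructor ⟨_,_,_⟩
  field
    inner : Adj 3
    outer : Fin 3 → F₂²
    form  : Form
open TripleState

tlc : Fin 3 → TripleState → TripleState
tlc k ⟨ e , v , Q ⟩ = ⟨ lcAdj e k , (λ i → v i +₂ (e k i ·₂ v k)) , Q +ᶠ square (v k) ⟩

trun : List (Fin 3) → TripleState → TripleState
trun [] st = st
trun (k ∷ ks) st = trun ks (tlc k st)

triangle : Bool → Bool → Bool → Adj 3
triangle p q r zero zero = false
triangle p q r zero (suc zero) = p
triangle p q r zero (suc (suc zero)) = q
triangle p q r (suc zero) zero = p
triangle p q r (suc zero) (suc zero) = false
triangle p q r (suc zero) (suc (suc zero)) = r
triangle p q r (suc (suc zero)) zero = q
triangle p q r (suc (suc zero)) (suc zero) = r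
triangle p q r (suc (suc zero)) (suc (suc zero)) = false

three : ∀ {A : Set} → A → A → A → Fin 3 → A
three x y z zero = x
three x y z (suc zero) = y
three x y z (suc (suc zero)) = z

startState : F₂² → Bool → Bool → Bool → TripleState
startState l p q r = ⟨ triangle p q r , three (true , false) (false , true) l , (false , false , false) ⟩

wordsOf : ℕ → List (List (Fin 3))
wordsOf zero = [] ∷ []
wordsOf (suc n) = [] ∷ concatMap (λ k → map (k ∷_) (wordsOf n)) (allFin 3)

-- The rows of `i` and `j` are compared at the third vertex and, through their coefficients, outside
-- the triple. A zero combination found here is a dependence in the graph, so excluding `Dep`
-- excludes it.
depPair : TripleState → Fin 3 → Fin 3 → Fin 3 → F₂² → Bool
depPair ⟨ e , v , _ ⟩ i j k (c , d) = (c ∨ d) ∧ (not ((c ∧ e i k) xor (d ∧ e j k)) ∧ (lin₂ (c , d) (v i) (v j) ==₂ 0₂))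

indepPairs : TripleState → Bool
indepPairs st = let 0F = zero ; 1F = suc zero ; 2F = suc (suc zero) in
  not (any (depPair st 0F 1F 2F) all₂) ∧ (not (any (depPair st 0F 2F 1F) all₂) ∧ not (any (depPair st 1F 2F 0F) all₂))

-- Complementing at two nonadjacent vertices `x` and `y` only adds the squares of their own rows, so
-- the mixed coefficient stays 0. With a third vertex and no dependent pair, at most four
-- complementations reach each of the eight forms.
allForms-check : allᵇ 8 (λ { (l ∷ l' ∷ p ∷ q ∷ r ∷ a ∷ b ∷ c ∷ []) →
  indepPairs (startState (l , l') p q r) ⇒ᵇ any (λ ks → form (trun ks (startState (l , l') p q r)) ==ᶠ (a , b , c)) (wordsOf 4) }) ≡ true
allForms-check = refl

abstract
  allForms : ∀ l p q r Q → indepPairs (startState l p q r) ≡ true → Σ (List (Fin 3)) λ ks → form (trun ks (startState l p q r)) ≡ Q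
  allForms l@(l₁ , l₂) p q r Q@(q₁ , q₂ , q₃) h =
    let (ks , e) = any-witness (λ ks → form (trun ks (startState l p q r)) ==ᶠ Q) (wordsOf 4)
                     (⇒ᵇ-elim (allᵇ-sound 8 (λ { (l ∷ l' ∷ p ∷ q ∷ r ∷ a ∷ b ∷ c ∷ []) →
                        indepPairs (startState (l , l') p q r) ⇒ᵇ any (λ ks → form (trun ks (startState (l , l') p q r)) ==ᶠ (a , b , c)) (wordsOf 4) }) allForms-check (l₁ ∷ l₂ ∷ p ∷ q ∷ r ∷ q₁ ∷ q₂ ∷ q₃ ∷ [])) h) in
    ks , ==ᶠ-sound _ _ e

module Triple {m} (U : Sub m) (a : Adj m) (gr : IsGraph a) (x y z : Fin m) (l : F₂²)
  (xy : x ≢ y) (xz : x ≢ z) (yz : y ≢ z) where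

  W : Sub m
  W v = does (v ≟ x) ∨ (does (v ≟ y) ∨ does (v ≟ z))

  h : Fin 3 → Fin m
  h = three x y z

  Outside : Fin m → Set
  Outside u = U u ≡ true × u ≢ x × u ≢ y × u ≢ z

  vec : Fin m → F₂²
  vec u = a x u , a y u

  private
    W-h : ∀ k → W (h k) ≡ true
    W-h zero with x ≟ x
    ... | yes _ = refl
    ... | no q = ⊥-elim (q refl)
    W-h (suc zero) with y ≟ x | y ≟ y
    ... | yes _ | _ = refl
    ... | no _ | yes _ = refl
    ... | no _ | no q = ⊥-elim (q refl)
    W-h (suc (suc zero)) with z ≟ x | z ≟ y | z ≟ z
    ... | yes _ | _ | _ = refl
    ... | no _ | yes _ | _ = refl
    ... | no _ | no _ | yes _ = refl
    ... | no _ | no _ | no q = ⊥-elim (q refl)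

    h-inj : ∀ i j → i ≢ j → h i ≢ h j
    h-inj zero zero n = λ _ → n refl
    h-inj zero (suc zero) n = xy
    h-inj zero (suc (suc zero)) n = xz
    h-inj (suc zero) zero n = λ e → xy (≡sym e)
    h-inj (suc zero) (suc zero) n = λ _ → n refl
    h-inj (suc zero) (suc (suc zero)) n = yz
    h-inj (suc (suc zero)) zero n = λ e → xz (≡sym e)
    h-inj (suc (suc zero)) (suc zero) n = λ e → yz (≡sym e)
    h-inj (suc (suc zero)) (suc (suc zero)) n = λ _ → n refl

    out≢h : ∀ u → Outside u → ∀ k → h k ≢ u
    out≢h u (_ , p , q , r) zero e = p (≡sym e)
    out≢h u (_ , p , q , r) (suc zero) e = q (≡sym e)
    out≢h u (_ , p , q , r) (suc (suc zero)) e = r (≡sym e)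

    record Models (b : Adj m) (st : TripleState) : Set where
      field
        innerₘ : ∀ i j → b (h i) (h j) ≡ inner st i j
        outerₘ : ∀ u → Outside u → ∀ i → b (h i) u ≡ dot (outer st i) (vec u)
        formₘ  : ∀ u w → Outside u → Outside w → u ≢ w → b u w ≡ a u w xor qf (form st) (vec u) (vec w)
    open Models

    dot-add : ∀ v c w x → dot v x xor (c ∧ dot w x) ≡ dot (v +₂ (c ·₂ w)) x
    dot-add (v₁ , v₂) c (w₁ , w₂) (x₁ , x₂) = taut 7 (λ { (v₁ ∷ v₂ ∷ c ∷ w₁ ∷ w₂ ∷ x₁ ∷ x₂ ∷ []) → dot (v₁ , v₂) (x₁ , x₂) xor (c ∧ dot (w₁ , w₂) (x₁ , x₂)) })
      (λ { (v₁ ∷ v₂ ∷ c ∷ w₁ ∷ w₂ ∷ x₁ ∷ x₂ ∷ []) → dot ((v₁ , v₂) +₂ (c ·₂ (w₁ , w₂))) (x₁ , x₂) }) refl (v₁ ∷ v₂ ∷ c ∷ w₁ ∷ w₂ ∷ x₁ ∷ x₂ ∷ [])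

    models-lc : ∀ {b st} k → Models b st → Models (lcAdj b (h k)) (tlc k st)
    models-lc {b} {⟨ e , v , Q ⟩} k M = record
      { innerₘ = inn
      ; outerₘ = λ u o i → trans (lc-≢ b (h k) (out≢h u o i)) (trans (cong₂ _xor_ (outerₘ M u o i) (cong₂ _∧_ (innerₘ M k i) (outerₘ M u o k))) (dot-add (v i) (e k i) (v k) (vec u)))
      ; formₘ = λ u w o o' n → trans (lc-≢ b (h k) n) (trans (cong₂ _xor_ (formₘ M u w o o' n) (cong₂ _∧_ (outerₘ M u o k) (outerₘ M w o' k))) (qf-square (a u w) Q (vec u) (vec w) (v k))) }
      where
      inn : ∀ i j → lcAdj b (h k) (h i) (h j) ≡ lcAdj e k i j
      inn i j with i ≟ j
      ... | yes refl = trans (lc-diag b (h k) (h i)) (innerₘ M i i)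
      ... | no n = trans (lc-≢ b (h k) (h-inj i j n)) (cong₂ _xor_ (innerₘ M i j) (cong₂ _∧_ (innerₘ M k i) (innerₘ M k j)))

    models-run : ∀ {b st} ks → Models b st → Σ (Adj m) λ b' → (W ⊢ b ⟿ b') × Models b' (trun ks st)
    models-run {b} [] M = b , stop , M
    models-run (k ∷ ks) M = let (b' , r , M') = models-run ks (models-lc k M) in b' , flip (h k) (W-h k) r , M'

  module _ (R : LinRel U a x y z l) (Dxy : ¬ Dep a U x y) (Dxz : ¬ Dep a U x z) (Dyz : ¬ Dep a U y z) where

    private
      st = startState l (a x y) (a x z) (a y z)

      start : Models a st
      start = record { innerₘ = inn ; outerₘ = out ; formₘ = λ u w _ _ _ → taut 5 (λ { (c ∷ _ ∷ _ ∷ _ ∷ _ ∷ []) → c }) (λ { (c ∷ x₁ ∷ x₂ ∷ y₁ ∷ y₂ ∷ []) → c xor qf (false , false , false) (x₁ , x₂) (y₁ , y₂) }) refl (a u w ∷ a x u ∷ a y u ∷ a x w ∷ a y w ∷ []) }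
        where
        inn : ∀ i j → a (h i) (h j) ≡ inner st i j
        inn zero zero = irr gr x
        inn zero (suc zero) = refl
        inn zero (suc (suc zero)) = refl
        inn (suc zero) zero = symm gr y x
        inn (suc zero) (suc zero) = irr gr y
        inn (suc zero) (suc (suc zero)) = refl
        inn (suc (suc zero)) zero = symm gr z x
        inn (suc (suc zero)) (suc zero) = symm gr z y
        inn (suc (suc zero)) (suc (suc zero)) = irr gr z
        out : ∀ u → Outside u → ∀ i → a (h i) u ≡ dot (outer st i) (vec u)
        out u o zero = taut 2 (λ { (b ∷ c ∷ []) → b }) (λ { (b ∷ c ∷ []) → dot (true , false) (b , c) }) refl (a x u ∷ a y u ∷ [])
        out u o (suc zero) = refl
        out u (p , q , r , s) (suc (suc zero)) = R u p q r s

      indepPair : ∀ i j k → (∀ u → U u ≡ true → u ≢ h i → u ≢ h j → (u ≡ h k) ⊎ Outside u) → ¬ Dep a U (h i) (h j) → any (depPair st i j k) all₂ ≡ false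
      indepPair i j k split nd with any (depPair st i j k) all₂ in e
      ... | false = refl
      ... | true with any-witness (depPair st i j k) all₂ e
      ... | ((c , d) , q) with ∧-true {c ∨ d} q
      ... | (nz , q') with ∧-true {not ((c ∧ inner st i k) xor (d ∧ inner st j k))} q'
      ... | (q₁ , q₂) = ⊥-elim (nd (c , d , nz , zero-row))
        where
        zero-row : ∀ u → U u ≡ true → u ≢ h i → u ≢ h j → (c ∧ a (h i) u) xor (d ∧ a (h j) u) ≡ false
        zero-row u Uu ui uj with split u Uu ui uj
        ... | inj₁ refl = trans (cong₂ (λ p q → (c ∧ p) xor (d ∧ q)) (innerₘ start i k) (innerₘ start j k)) (not-true q₁)
        ... | inj₂ o = trans (cong₂ (λ p q → (c ∧ p) xor (d ∧ q)) (outerₘ start u o i) (outerₘ start u o j))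
              (trans (≡sym (dot-lin₂ (c , d) (outer st i) (outer st j) (vec u))) (cong (λ p → dot p (vec u)) (==₂-sound (lin₂ (c , d) (outer st i) (outer st j)) 0₂ q₂)))

      good : indepPairs st ≡ true
      good = cong₂ _∧_ (cong not (indepPair zero (suc zero) (suc (suc zero)) s₁ Dxy))
            (cong₂ _∧_ (cong not (indepPair zero (suc (suc zero)) (suc zero) s₂ Dxz)) (cong not (indepPair (suc zero) (suc (suc zero)) zero s₃ Dyz)))
        where
        s₁ : ∀ u → U u ≡ true → u ≢ x → u ≢ y → (u ≡ z) ⊎ Outside u
        s₁ u p q r with u ≟ z
        ... | yes e = inj₁ e
        ... | no n = inj₂ (p , q , r , n)
        s₂ : ∀ u → U u ≡ true → u ≢ x → u ≢ z → (u ≡ y) ⊎ Outside u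
        s₂ u p q r with u ≟ y
        ... | yes e = inj₁ e
        ... | no n = inj₂ (p , q , n , r)
        s₃ : ∀ u → U u ≡ true → u ≢ y → u ≢ z → (u ≡ x) ⊎ Outside u
        s₃ u p q r with u ≟ x
        ... | yes e = inj₁ e
        ... | no n = inj₂ (p , n , q , r)

    abstract
      addForm : ∀ Q → Σ (Adj m) λ b → (W ⊢ a ⟿ b) × (∀ u w → Outside u → Outside w → u ≢ w → b u w ≡ a u w xor qf Q (vec u) (vec w))
      addForm Q =
        let (ks , e) = allForms l (a x y) (a x z) (a y z) Q good
            (b , r , M) = models-run ks start in
        b , r , λ u w o o' n → trans (formₘ M u w o o' n) (cong (λ q → a u w xor qf q (vec u) (vec w)) e)

-- Adjacency of a vertex of type `(α , b)` to a later one with column `c`, once `Q` has been added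
-- at the left end.
bilin : Form → F₂⁴ → F₂² → Bool
bilin Q (α , b) c = dot α c xor qf Q b c

-- Adjacency of a vertex of type X to a later one of type Y after adding the form Q at the left end and P at the
-- right end; c and d are the columns of t and t'.
bilin' : Form → Form → F₂² → F₂² → F₂⁴ → F₂⁴ → Bool
bilin' Q P c d X Y = bilin Q X (proj₂ Y) xor qf P (bilin Q X c , bilin Q X d) (bilin Q Y c , bilin Q Y d)

-- The added forms are symmetric, so they cancel.
bilin'-ω : ∀ Q P c d X Y → bilin' Q P c d X Y xor bilin' Q P c d Y X ≡ ω X Y
bilin'-ω Q P c d X@(α , b) Y@(γ , e) rewrite qf-sym P (bilin Q Y c , bilin Q Y d) (bilin Q X c , bilin Q X d) | qf-sym Q e b =
  taut 4 (λ { (p ∷ q ∷ r ∷ s ∷ []) → ((p xor q) xor r) xor ((s xor q) xor r) }) (λ { (p ∷ q ∷ r ∷ s ∷ []) → p xor s }) refl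
    (dot α e ∷ qf Q b e ∷ qf P (bilin Q X c , bilin Q X d) (bilin Q Y c , bilin Q Y d) ∷ dot γ b ∷ [])

allForms-list : List Form
allForms-list = concatMap (λ b → map (b ,_) all₂) (false ∷ true ∷ [])

-- The map sending `Z` to `bilin' Q P C D Z Z` is a quadratic form with polar form `ω`. With `ω X Y`
-- true, the value 1 at `X` and `Y` forces the value 1 at their sum, so the form is elliptic on the
-- plane they span. The search is over all 64 pairs of forms.
makeElliptic-check : allᵇ 12 (λ { (c ∷ c' ∷ d ∷ d' ∷ x₁ ∷ x₂ ∷ x₃ ∷ x₄ ∷ y₁ ∷ y₂ ∷ y₃ ∷ y₄ ∷ []) →
    let X = (x₁ , x₂) , (x₃ , x₄) ; Y = (y₁ , y₂) , (y₃ , y₄) ; C = c , c' ; D = d , d' in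
    indep (C , 0₂) (D , 0₂) ⇒ᵇ (ω X Y ⇒ᵇ any (λ (Q , P) → bilin' Q P C D X X ∧ bilin' Q P C D Y Y) (cartesianProduct allForms-list allForms-list)) }) ≡ true
makeElliptic-check = refl

abstract
  makeElliptic : ∀ C D X Y → indep (C , 0₂) (D , 0₂) ≡ true → ω X Y ≡ true →
    Σ Form λ Q → Σ Form λ P → bilin' Q P C D X X ≡ true × bilin' Q P C D Y Y ≡ true
  makeElliptic C@(c , c') D@(d , d') X@((x₁ , x₂) , (x₃ , x₄)) Y@((y₁ , y₂) , (y₃ , y₄)) i o =
    let ((Q , P) , e) = any-witness (λ (Q , P) → bilin' Q P C D X X ∧ bilin' Q P C D Y Y) (cartesianProduct allForms-list allForms-list)
          (⇒ᵇ-elim (⇒ᵇ-elim (allᵇ-sound 12 (λ { (c ∷ c' ∷ d ∷ d' ∷ x₁ ∷ x₂ ∷ x₃ ∷ x₄ ∷ y₁ ∷ y₂ ∷ y₃ ∷ y₄ ∷ []) →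
            let X = (x₁ , x₂) , (x₃ , x₄) ; Y = (y₁ , y₂) , (y₃ , y₄) ; C = c , c' ; D = d , d' in
            indep (C , 0₂) (D , 0₂) ⇒ᵇ (ω X Y ⇒ᵇ any (λ (Q , P) → bilin' Q P C D X X ∧ bilin' Q P C D Y Y) (cartesianProduct allForms-list allForms-list)) }) makeElliptic-check
            (c ∷ c' ∷ d ∷ d' ∷ x₁ ∷ x₂ ∷ x₃ ∷ x₄ ∷ y₁ ∷ y₂ ∷ y₃ ∷ y₄ ∷ [])) i) o)
        (e₁ , e₂) = ∧-true e in
    Q , P , e₁ , e₂

-- From a layout to a cycle

all-∷ʳ : ∀ {A : Set} {P : A → Set} xs {x} → All P (xs ∷ʳ x) → All P xs × P x
all-∷ʳ [] (p ∷ []) = [] , p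
all-∷ʳ (x ∷ xs) (p ∷ ps) = let (q , r) = all-∷ʳ xs ps in p ∷ q , r

allPairs-∷ʳ : ∀ {A : Set} {R : A → A → Set} xs {x} → AllPairs R (xs ∷ʳ x) → AllPairs R xs × All (λ y → R y x) xs
allPairs-∷ʳ [] _ = [] , []
allPairs-∷ʳ (x ∷ xs) (p ∷ ps) = let (q , r) = allPairs-∷ʳ xs ps ; (p₁ , p₂) = all-∷ʳ xs p in p₁ ∷ q , p₂ ∷ r

nth : ∀ {A : Set} → A → List A → ℕ → A
nth d [] _ = d
nth d (x ∷ xs) zero = x
nth d (x ∷ xs) (suc i) = nth d xs i

all-nth : ∀ {A : Set} {P : A → Set} {d xs} → All P xs → ∀ i → i < length xs → P (nth d xs i)
all-nth (p ∷ ps) zero _ = p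
all-nth (p ∷ ps) (suc i) (s≤s l) = all-nth ps i l

allPairs-nth : ∀ {A : Set} {R : A → A → Set} {d xs} → AllPairs R xs → ∀ i j → i < j → j < length xs → R (nth d xs i) (nth d xs j)
allPairs-nth (p ∷ ps) zero (suc j) _ (s≤s l) = all-nth p j l
allPairs-nth (p ∷ ps) (suc i) (suc j) (s≤s i<j) (s≤s l) = allPairs-nth ps i j i<j l

module _ {E : Set} (typ : E → F₂⁴) where
  open Words typ

  alt-nth : ∀ {X Y d es} → Alt X Y es → ∀ i → i < length es → typ (nth d es i) ≡ (if ev i then X else Y)
  alt-nth (p ∷ A) zero _ = p
  alt-nth {X} {Y} (p ∷ A) (suc i) (s≤s l) = trans (alt-nth A i l) (if-not (ev i))
    where
    if-not : ∀ b → (if b then Y else X) ≡ (if not b then X else Y)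
    if-not true = refl
    if-not false = refl

  separated-∷ʳ : ∀ X es {e} → separated X (es ∷ʳ e) ≡ true → separated X es ≡ true
  separated-∷ʳ X [] _ = refl
  separated-∷ʳ X (x ∷ es) p with typ x ==₄ X | ω X (typ x)
  ... | false | true = refl
  ... | false | false = separated-∷ʳ X es p

  Separated-∷ʳ : ∀ es {e} → Separated (es ∷ʳ e) → Separated es
  Separated-∷ʳ [] _ = tt
  Separated-∷ʳ (x ∷ es) (p , q) = separated-∷ʳ (typ x) es p , Separated-∷ʳ es q

  alternating⇒cycle : ∀ {m} {d : Adj m} (v : E → Fin m) → IsGraph d → E → ∀ n L {X Y} → 3 ≤ n → n ≤ length L → Alt X Y L → (B : F₂⁴ → F₂⁴ → Bool) →
    AllPairs (λ e e' → v e ≢ v e' × d (v e) (v e') ≡ B (typ e) (typ e')) L →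
    B X X ≡ true → B Y Y ≡ true → B X Y ≡ false → B Y X ≡ true → HasC d n
  alternating⇒cycle {d = d} v gr e₀ n L {X} {Y} 3≤n n≤ A B AP XX YY XY YX = Zigzag.zigzag⇒cycle n z inj gr 3≤n adjz
    where
    z : ℕ → _
    z i = v (nth e₀ L i)
    rel : ∀ i j → i < j → j < n → z i ≢ z j × d (z i) (z j) ≡ B (typ (nth e₀ L i)) (typ (nth e₀ L j))
    rel i j p q = allPairs-nth AP i j p (<-≤-trans q n≤)
    inj : ∀ {i j} → i < n → j < n → z i ≡ z j → i ≡ j
    inj {i} {j} p q e with <-cmp i j
    ... | tri< l _ _ = ⊥-elim (proj₁ (rel i j l q) e)
    ... | tri≈ _ r _ = r
    ... | tri> _ _ l = ⊥-elim (proj₁ (rel j i l p) (≡sym e))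
    table : ∀ b c → B (if b then X else Y) (if c then X else Y) ≡ not b ∨ c
    table true true = XX
    table true false = XY
    table false true = YX
    table false false = YY
    adjz : ∀ i j → i < j → j < n → d (z i) (z j) ≡ not (ev i) ∨ ev j
    adjz i j p q = trans (proj₂ (rel i j p q)) (trans (cong₂ B (alt-nth {d = e₀} A i (<-≤-trans (<-trans p q) n≤)) (alt-nth {d = e₀} A j (<-≤-trans q n≤))) (table (ev i) (ev j)))

dependent₂ : ∀ p q → indep (p , 0₂) (q , 0₂) ≡ false → Σ F₂² λ c → c ==₂ 0₂ ≡ false × lin₂ c p q ≡ 0₂
dependent₂ p q e with any-witness (λ c → not (c ==₂ 0₂) ∧ (lin₂ c p q ==₂ 0₂)) all₂ (⇒ᵇ-elim (allᵇ-sound 4 chk refl (proj₁ p ∷ proj₂ p ∷ proj₁ q ∷ proj₂ q ∷ [])) (cong not e))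
  where
  chk : Vec Bool 4 → Bool
  chk (p₁ ∷ p₂ ∷ q₁ ∷ q₂ ∷ []) = not (indep ((p₁ , p₂) , 0₂) ((q₁ , q₂) , 0₂)) ⇒ᵇ any (λ c → not (c ==₂ 0₂) ∧ (lin₂ c (p₁ , p₂) (q₁ , q₂) ==₂ 0₂)) all₂
... | (c , h) = c , not-true (proj₁ (∧-true h)) , ==₂-sound (lin₂ c p q) 0₂ (proj₂ (∧-true {not (c ==₂ 0₂)} h))

double-half : ∀ n → ⌊ n /2⌋ + ⌊ n /2⌋ ≤ n
double-half n = ≤-trans (+-monoʳ-≤ ⌊ n /2⌋ (⌊n/2⌋≤⌈n/2⌉ n)) (≤-reflexive (⌊n/2⌋+⌈n/2⌉≡n n))

n≤double-half : ∀ n → n < suc ⌊ n /2⌋ + suc ⌊ n /2⌋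
n≤double-half zero = s≤s z≤n
n≤double-half (suc zero) = s≤s (s≤s z≤n)
n≤double-half (suc (suc n)) = s≤s (s≤s (≤-trans (n≤double-half n) (≤-reflexive (≡sym (+-suc _ _)))))

double-* : ∀ c k n → k + k ≤ n → (c + c) * k ≤ c * n
double-* c k n l = ≤-trans (≤-reflexive (trans (*-distribʳ-+ k c c) (≡sym (*-distribˡ-+ c k k)))) (*-monoʳ-≤ c l)

abstract
  half-bound : ∀ n {l} → 60 * n + 17 ≤ l → 120 * ⌊ n /2⌋ + 16 < l
  half-bound n h = ≤-trans (s≤s (+-monoˡ-≤ 16 (double-* 60 ⌊ n /2⌋ n (double-half n)))) (≤-trans (≤-reflexive (≡sym (+-suc (60 * n) 16))) h)

module Ground {m} (s s' t t' : Fin m) (U : Sub m) (s∉ : s ≢ t × s ≢ t') (s'∉ : s' ≢ t × s' ≢ t') where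

  open Ends s s' t t'
  open Rows s s' t t' U

  C₀ : Sub m
  C₀ x = does (x ≟ s) ∨ does (x ≟ s')

  C₀-s : C₀ s ≡ true
  C₀-s with s ≟ s
  ... | yes _ = refl
  ... | no q = ⊥-elim (q refl)

  C₀-s' : C₀ s' ≡ true
  C₀-s' with s' ≟ s | s' ≟ s'
  ... | yes _ | _ = refl
  ... | no _ | yes _ = refl
  ... | no _ | no q = ⊥-elim (q refl)

  C₀-true : ∀ x → C₀ x ≡ true → x ≡ s ⊎ x ≡ s'
  C₀-true x p with x ≟ s | x ≟ s'
  ... | yes e | _ = inj₁ e
  ... | no _ | yes e = inj₂ e

  C₀-out : ∀ x → x ≢ s → x ≢ s' → C₀ x ≡ false
  C₀-out x p q with x ≟ s | x ≟ s'
  ... | yes e | _ = ⊥-elim (p e)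
  ... | no _ | yes e = ⊥-elim (q e)
  ... | no _ | no _ = refl

  C₀-sep : Sep C₀
  C₀-sep = C₀-s , C₀-s' , C₀-out t (λ e → proj₁ s∉ (≡sym e)) (λ e → proj₁ s'∉ (≡sym e)) , C₀-out t' (λ e → proj₂ s∉ (≡sym e)) (λ e → proj₂ s'∉ (≡sym e))

  Λ₀ : Fin m → F₂²
  Λ₀ x = if does (x ≟ s) then (true , false) else (false , true)

  dot-10 : ∀ b c → b ≡ dot (true , false) (b , c)
  dot-10 b c = taut 2 (λ { (b ∷ c ∷ []) → b }) (λ { (b ∷ c ∷ []) → dot (true , false) (b , c) }) refl (b ∷ c ∷ [])

  rows₀ : ∀ b x → U x ≡ true → C₀ x ≡ true → RowGood b x (Λ₀ x) C₀
  rows₀ b x p q w Uw Cw with x ≟ s | C₀-true x q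
  ... | yes refl | _ = dot-10 (b s w) (b s' w)
  ... | no n | inj₁ e = ⊥-elim (n e)
  ... | no _ | inj₂ refl = refl

module Finish {m} (s s' t t' : Fin m) (U : Sub m) (a₁ : Adj m) (gr₁ : IsGraph a₁)
  (E : Ends.HasEnds s s' t t' U) (s≢s' : s ≢ s') (t≢t' : t ≢ t') (s∉ : s ≢ t × s ≢ t') (s'∉ : s' ≢ t × s' ≢ t')
  (nd₁ : ∀ u w → U u ≡ true → Ends.Free s s' t t' u → U w ≡ true → u ≢ w → ¬ Dep a₁ U u w)
  (ndS : ¬ Dep a₁ U s s') (ndT : ¬ Dep a₁ U t t') (n : ℕ) (3≤n : 3 ≤ n) where

  open Ends s s' t t'
  open Rows s s' t t' U
  module En = Entries s s' t t' U a₁ gr₁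
  open En using (entries; typ; Before)

  open Ground s s' t t' U s∉ s'∉

  module Final {v₁ l₁} (Uv₁ : U v₁ ≡ true) (Fv₁ : Free v₁) (R₁ : RowGood a₁ v₁ l₁ (add C₀ v₁))
    (mid : List En.Entry) (vN : Fin m) (lN : F₂²)
    (allOut : All (λ e → U (proj₁ e) ≡ true × Free (proj₁ e) × v₁ ≢ proj₁ e) (mid ∷ʳ (vN , lN)))
    (pairs : AllPairs Before ((v₁ , l₁) ∷ (mid ∷ʳ (vN , lN))))
    (trows : All (λ (u , l) → a₁ u t ≡ dot l (β a₁ t) × a₁ u t' ≡ dot l (β a₁ t')) ((v₁ , l₁) ∷ (mid ∷ʳ (vN , lN))))
    (all-U : ∀ u → U u ≡ true → Free u → Any (λ e → proj₁ e ≡ u) ((v₁ , l₁) ∷ (mid ∷ʳ (vN , lN))))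
    (sepd : Words.Separated typ (mid ∷ʳ (vN , lN)))
    (len : 60 * n + 17 ≤ length mid) where

    private
      UN = proj₁ (proj₂ (all-∷ʳ mid allOut))
      FN = proj₁ (proj₂ (proj₂ (all-∷ʳ mid allOut)))
      v₁≢N = proj₂ (proj₂ (proj₂ (all-∷ʳ mid allOut)))

      beforeN : All (λ e → Before e (vN , lN)) ((v₁ , l₁) ∷ mid)
      beforeN = proj₂ (allPairs-∷ʳ ((v₁ , l₁) ∷ mid) pairs)

      -- All other free vertices precede `vN`, and all free vertices precede `t` and `t'`, so a
      -- single coefficient vector gives the adjacency of `u` to these three.
      coords : ∀ u → U u ≡ true → u ≢ t → u ≢ t' → Σ F₂² λ l → (a₁ u t ≡ dot l (β a₁ t) × a₁ u t' ≡ dot l (β a₁ t')) × (u ≢ vN → a₁ u vN ≡ dot l (β a₁ vN))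
      coords u p q r with u ≟ s | u ≟ s'
      ... | yes refl | _ = (true , false) , (dot-10 (a₁ s t) (a₁ s' t) , dot-10 (a₁ s t') (a₁ s' t')) , λ _ → dot-10 (a₁ s vN) (a₁ s' vN)
      ... | no _ | yes refl = (false , true) , (refl , refl) , λ _ → refl
      ... | no us | no us' = go ((v₁ , l₁) ∷ mid) trows beforeN (all-U u p (us , us' , q , r))
        where
        go : ∀ es → All (λ (u , l) → a₁ u t ≡ dot l (β a₁ t) × a₁ u t' ≡ dot l (β a₁ t')) (es ∷ʳ (vN , lN)) → All (λ e → Before e (vN , lN)) es →
          Any (λ e → proj₁ e ≡ u) (es ∷ʳ (vN , lN)) → Σ F₂² λ l → (a₁ u t ≡ dot l (β a₁ t) × a₁ u t' ≡ dot l (β a₁ t')) × (u ≢ vN → a₁ u vN ≡ dot l (β a₁ vN))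
        go [] (h ∷ []) [] (here refl) = lN , h , λ n → ⊥-elim (n refl)
        go ((_ , l) ∷ es) (h ∷ _) (b ∷ _) (here refl) = l , h , λ _ → proj₂ b
        go (_ ∷ es) (_ ∷ hs) (_ ∷ bs) (there i) = go es hs bs i

      -- Every other vertex of `U` sees `t` and `t'` only through their columns, so dependent
      -- columns would give dependent rows of `t` and `t'`.
      βt-indep : ∀ c → c ==₂ 0₂ ≡ false → lin₂ c (β a₁ t) (β a₁ t') ≡ 0₂ → ⊥
      βt-indep (c , d) nz e = ndT (c , d , nonzero c d nz , λ z p q r →
        let (l , (h₁ , h₂) , _) = coords z p q r in
        trans (cong₂ (λ x y → (c ∧ x) xor (d ∧ y)) (trans (symm gr₁ t z) h₁) (trans (symm gr₁ t' z) h₂))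
          (trans (cong₂ (λ x y → (c ∧ x) xor (d ∧ y)) (dot-comm l _) (dot-comm l _)) (trans (≡sym (dot-lin₂ (c , d) (β a₁ t) (β a₁ t') l)) (cong (λ v → dot v l) e))))
        where
        nonzero : ∀ c d → (c , d) ==₂ 0₂ ≡ false → c ∨ d ≡ true
        nonzero true d _ = refl
        nonzero false true _ = refl

      indep-t : indep (β a₁ t , 0₂) (β a₁ t' , 0₂) ≡ true
      indep-t with indep (β a₁ t , 0₂) (β a₁ t' , 0₂) in e
      ... | true = refl
      ... | false = let (c , h₁ , h₂) = dependent₂ (β a₁ t) (β a₁ t') e in ⊥-elim (βt-indep c h₁ h₂)

      -- The columns of `t` and `t'` form a basis of `F₂²`. Hence the last vertex completes a triple
      -- at the right end, just as `v₁` does at the left one.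
      lastRel : Σ F₂² λ c → β a₁ vN ≡ lin₂ c (β a₁ t) (β a₁ t')
      lastRel with relation₂ (β a₁ t) (β a₁ t') (β a₁ vN)
      ... | inj₁ h = h
      ... | inj₂ (c , h₁ , h₂) = ⊥-elim (βt-indep c h₁ h₂)

      linL : LinRel U a₁ s s' v₁ l₁
      linL u p q r o = R₁ u p (add-out C₀ v₁ u (C₀-out u q r) o)

      linR : LinRel U a₁ t t' vN (proj₁ lastRel)
      linR u p q r o = let (l , (h₁ , h₂) , h₃) = coords u p q r in
        trans (symm gr₁ vN u) (trans (h₃ o) (trans (cong (dot l) (proj₂ lastRel)) (trans (dot-comm l _) (trans (dot-lin₂ (proj₁ lastRel) (β a₁ t) (β a₁ t') l)
          (cong₂ (λ x y → dot (proj₁ lastRel) (x , y)) (trans (dot-comm _ l) (trans (≡sym h₁) (symm gr₁ u t))) (trans (dot-comm _ l) (trans (≡sym h₂) (symm gr₁ u t'))))))))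

      Us = proj₁ E
      Us' = proj₁ (proj₂ E)
      Ut = proj₁ (proj₂ (proj₂ E))
      Ut' = proj₂ (proj₂ (proj₂ E))

      module TL = Triple U a₁ gr₁ s s' v₁ l₁ s≢s' (λ e → proj₁ Fv₁ (≡sym e)) (λ e → proj₁ (proj₂ Fv₁) (≡sym e))

      TL-W : TL.W ⊑ U
      TL-W x p with x ≟ s | x ≟ s' | x ≟ v₁
      ... | yes refl | _ | _ = Us
      ... | no _ | yes refl | _ = Us'
      ... | no _ | no _ | yes refl = Uv₁

      TL-out : ∀ x → x ≢ s → x ≢ s' → x ≢ v₁ → TL.W x ≡ false
      TL-out x p q r with x ≟ s | x ≟ s' | x ≟ v₁
      ... | yes e | _ | _ = ⊥-elim (p e)
      ... | no _ | yes e | _ = ⊥-elim (q e)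
      ... | no _ | no _ | yes e = ⊥-elim (r e)
      ... | no _ | no _ | no _ = refl

      left = TL.addForm linL ndS
        (λ D → nd₁ v₁ s Uv₁ Fv₁ Us (proj₁ Fv₁) (dep-sym {a = a₁} {U} {s} {v₁} D)) (λ D → nd₁ v₁ s' Uv₁ Fv₁ Us' (proj₁ (proj₂ Fv₁)) (dep-sym {a = a₁} {U} {s'} {v₁} D))

      inner-out : ∀ (e : En.Entry) → U (proj₁ e) ≡ true × Free (proj₁ e) × v₁ ≢ proj₁ e → TL.Outside (proj₁ e)
      inner-out e (p , (q₁ , q₂ , _) , r) = p , q₁ , q₂ , λ x → r (≡sym x)

      many = Words.manyTurns typ ⌊ n /2⌋ mid (Separated-∷ʳ typ mid sepd) (half-bound n len)

      X = proj₁ many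
      Y = proj₁ (proj₂ many)
      ωXY : ω X Y ≡ true
      ωXY = proj₁ (proj₂ (proj₂ many))

      alt = Words.alternate typ {Before} X Y mid
      L = proj₁ alt

      -- One letter more than the cycle needs, because the first one may have to be dropped.
      L-long : n < length L
      L-long = ≤-trans (≤-trans (n≤double-half n) (+-mono-≤ (proj₂ (proj₂ (proj₂ many))) (proj₂ (proj₂ (proj₂ many))))) (≤-reflexive (≡sym (proj₁ (proj₂ (proj₂ alt)))))

      ell = makeElliptic (β a₁ t) (β a₁ t') X Y indep-t ωXY
      Q = proj₁ ell
      P = proj₁ (proj₂ ell)

      a₂ = proj₁ (left Q)
      r₂ : TL.W ⊢ a₁ ⟿ a₂
      r₂ = proj₁ (proj₂ (left Q))
      gr₂ = ⟿-graph r₂ gr₁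
      a₂-≡ = proj₂ (proj₂ (left Q))

      module TR = Triple U a₂ gr₂ t t' vN (proj₁ lastRel) t≢t' (λ e → proj₁ (proj₂ (proj₂ FN)) (≡sym e)) (λ e → proj₂ (proj₂ (proj₂ FN)) (≡sym e))

      TR-W : TR.W ⊑ U
      TR-W x p with x ≟ t | x ≟ t' | x ≟ vN
      ... | yes refl | _ | _ = Ut
      ... | no _ | yes refl | _ = Ut'
      ... | no _ | no _ | yes refl = UN

      r₁₂ : U ⊢ a₁ ⟿ a₂
      r₁₂ = ⟿-mono TL-W r₂

      t-out = TL-out t (λ e → proj₁ s∉ (≡sym e)) (λ e → proj₁ s'∉ (≡sym e)) (λ e → proj₁ (proj₂ (proj₂ Fv₁)) (≡sym e))
      t'-out = TL-out t' (λ e → proj₂ s∉ (≡sym e)) (λ e → proj₂ s'∉ (≡sym e)) (λ e → proj₂ (proj₂ (proj₂ Fv₁)) (≡sym e))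
      N-out = TL-out vN (proj₁ FN) (proj₁ (proj₂ FN)) (λ e → v₁≢N (≡sym e))

      right = TR.addForm (linRel-⟿ {l = proj₁ lastRel} gr₁ TL-W t-out t'-out N-out r₂ linR)
        (⟿-¬dep r₁₂ gr₁ ndT)
        (λ D → ⟿-¬dep r₁₂ gr₁ (nd₁ vN t UN FN Ut (proj₁ (proj₂ (proj₂ FN)))) (dep-sym {a = a₂} {U} {t} {vN} D))
        (λ D → ⟿-¬dep r₁₂ gr₁ (nd₁ vN t' UN FN Ut' (proj₂ (proj₂ (proj₂ FN)))) (dep-sym {a = a₂} {U} {t'} {vN} D))

      a₃ = proj₁ (right P)
      a₃-≡ = proj₂ (proj₂ (right P))
      r₁₃ : U ⊢ a₁ ⟿ a₃
      r₁₃ = ⟿-trans r₁₂ (⟿-mono TR-W (proj₁ (proj₂ (right P))))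

      Tout : TL.Outside t × TL.Outside t'
      Tout = (Ut , (λ e → proj₁ s∉ (≡sym e)) , (λ e → proj₁ s'∉ (≡sym e)) , (λ e → proj₁ (proj₂ (proj₂ Fv₁)) (≡sym e))) ,
             (Ut' , (λ e → proj₂ s∉ (≡sym e)) , (λ e → proj₂ s'∉ (≡sym e)) , (λ e → proj₂ (proj₂ (proj₂ Fv₁)) (≡sym e)))

      B : F₂⁴ → F₂⁴ → Bool
      B = bilin' Q P (β a₁ t) (β a₁ t')

      Info : En.Entry → Set
      Info e@(u , l) = (U u ≡ true × Free u × v₁ ≢ u) × u ≢ vN × (a₁ u t ≡ dot l (β a₁ t) × a₁ u t' ≡ dot l (β a₁ t'))

      vecR : ∀ e → Info e → TR.vec (proj₁ e) ≡ (bilin Q (typ e) (β a₁ t) , bilin Q (typ e) (β a₁ t'))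
      vecR e@(u , l) (o , _ , h₁ , h₂) = cong₂ _,_
        (trans (symm gr₂ t u) (trans (a₂-≡ u t (inner-out e o) (proj₁ Tout) (proj₁ (proj₂ (proj₂ (proj₁ (proj₂ o)))))) (cong (_xor qf Q (β a₁ u) (β a₁ t)) h₁)))
        (trans (symm gr₂ t' u) (trans (a₂-≡ u t' (inner-out e o) (proj₂ Tout) (proj₂ (proj₂ (proj₂ (proj₁ (proj₂ o)))))) (cong (_xor qf Q (β a₁ u) (β a₁ t')) h₂)))

      relB : ∀ e e' → Info e → Info e' → Before e e' → proj₁ e ≢ proj₁ e' × a₃ (proj₁ e) (proj₁ e') ≡ B (typ e) (typ e')
      relB e@(u , l) e'@(w , k) i@(o , uN , _) i'@(o' , wN , _) (n , h) = n ,
        trans (a₃-≡ u w (proj₁ o , proj₁ (proj₂ (proj₂ (proj₁ (proj₂ o)))) , proj₂ (proj₂ (proj₂ (proj₁ (proj₂ o)))) , uN)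
                        (proj₁ o' , proj₁ (proj₂ (proj₂ (proj₁ (proj₂ o')))) , proj₂ (proj₂ (proj₂ (proj₁ (proj₂ o')))) , wN) n)
          (cong₂ _xor_ (trans (a₂-≡ u w (inner-out e o) (inner-out e' o') n) (cong (_xor qf Q (β a₁ u) (β a₁ w)) h))
            (cong₂ (qf P) (vecR e i) (vecR e' i')))

      zip-info : ∀ {es} → All Info es → AllPairs Before es → AllPairs (λ e e' → proj₁ e ≢ proj₁ e' × a₃ (proj₁ e) (proj₁ e') ≡ B (typ e) (typ e')) es
      zip-info {[]} [] [] = []
      zip-info {e ∷ _} (i ∷ is) (p ∷ ps) = All.zipWith (λ {e'} (j , q) → relB e e' i j q) (is , p) ∷ zip-info is ps

      midInfo : All Info mid
      midInfo = All.zipWith (λ (p , q , r) → p , q , r) (proj₁ (all-∷ʳ mid allOut) , All.zipWith (λ (p , q) → proj₁ p , q) (All.tail beforeN , proj₁ (all-∷ʳ mid (All.tail trows))))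

      LInfo : All Info L
      LInfo = proj₂ (proj₂ (proj₂ (proj₂ alt))) Info midInfo

      LPairs : AllPairs (λ e e' → proj₁ e ≢ proj₁ e' × a₃ (proj₁ e) (proj₁ e') ≡ B (typ e) (typ e')) L
      LPairs = zip-info LInfo (proj₁ (proj₂ (proj₂ (proj₂ alt))) (proj₁ (allPairs-∷ʳ mid (tailPairs pairs))))
        where
        tailPairs : ∀ {R : En.Entry → En.Entry → Set} {x xs} → AllPairs R (x ∷ xs) → AllPairs R xs
        tailPairs (_ ∷ ps) = ps

    result : HasC a₁ n
    result = ⟿-hasC r₁₃ (go (B X Y) (B Y X) refl refl (trans (bilin'-ω Q P _ _ X Y) ωXY) L (proj₁ (proj₂ alt)) L-long LPairs)
      where
      gr₃ = ⟿-graph r₁₃ gr₁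
      XX = proj₁ (proj₂ (proj₂ ell))
      YY = proj₂ (proj₂ (proj₂ ell))
      go : ∀ x y → B X Y ≡ x → B Y X ≡ y → x xor y ≡ true → ∀ L → Words.Alt typ X Y L → n < length L →
        AllPairs (λ e e' → proj₁ e ≢ proj₁ e' × a₃ (proj₁ e) (proj₁ e') ≡ B (typ e) (typ e')) L → HasC a₃ n
      go false true p q _ L A l AP = alternating⇒cycle typ proj₁ gr₃ (v₁ , l₁) n L 3≤n (≤-trans (n≤1+n n) l) A B AP XX YY p q
      -- In a zigzag the first letter must be nonadjacent to later copies of the second; here this
      -- holds for `Y` before `X`, so the word is made to start with `Y`.
      go true false p q _ (e ∷ L) (_ Words.∷ A) l (_ ∷ AP) = alternating⇒cycle typ proj₁ gr₃ (v₁ , l₁) n L 3≤n (s≤s⁻¹ l) A B AP YY XX q p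

  private
    T-rows : ∀ {C us} (k : KForm a₁ C us) → C t ≡ false → C t' ≡ false →
      All (λ (u , l) → a₁ u t ≡ dot l (β a₁ t) × a₁ u t' ≡ dot l (β a₁ t')) (entries k)
    T-rows nil _ _ = []
    T-rows (cons {C} v l Uv (_ , _ , f₃ , f₄) Cv R k) p q =
      let p' = add-out C v t p (λ e → f₃ (≡sym e)) ; q' = add-out C v t' q (λ e → f₄ (≡sym e)) in
      (R t (proj₁ (proj₂ (proj₂ E))) p' , R t' (proj₂ (proj₂ (proj₂ E))) q') ∷ T-rows k p' q'

    entries-length : ∀ {C us} (k : KForm a₁ C us) → length (entries k) ≡ length us
    entries-length nil = refl
    entries-length (cons v l _ _ _ _ k) = cong suc (entries-length k)

    entries-∈ : ∀ {C us} (k : KForm a₁ C us) {u} → u ∈ us → Any (λ e → proj₁ e ≡ u) (entries k)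
    entries-∈ (cons v l _ _ _ _ k) (here refl) = here refl
    entries-∈ (cons v l _ _ _ _ k) (there i) = there (entries-∈ k i)

    -- The constant 23 is 17 for the word in the middle, 4 for the ends and 2 for the vertices that
    -- complete the triples. The 5 on the right counts the ends and `v₁`; `suc` counts `vN`.
    size-split : 60 * n + 23 ≡ 5 + suc (60 * n + 17)
    size-split = trans (+-comm (60 * n) 23) (cong (6 +_) (+-comm 17 (60 * n)))

    length-∷ʳ : ∀ {A : Set} (xs : List A) x → length (xs ∷ʳ x) ≡ suc (length xs)
    length-∷ʳ xs x = trans (length-++ xs) (+-comm (length xs) 1)

    withLast : ∀ {v₁ l₁} → U v₁ ≡ true → Free v₁ → RowGood a₁ v₁ l₁ (add C₀ v₁) → ∀ es →
      All (λ e → U (proj₁ e) ≡ true × Free (proj₁ e) × v₁ ≢ proj₁ e) es → AllPairs Before ((v₁ , l₁) ∷ es) →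
      All (λ (u , l) → a₁ u t ≡ dot l (β a₁ t) × a₁ u t' ≡ dot l (β a₁ t')) ((v₁ , l₁) ∷ es) →
      (∀ u → U u ≡ true → Free u → Any (λ e → proj₁ e ≡ u) ((v₁ , l₁) ∷ es)) → Words.Separated typ es → suc (60 * n + 17) ≤ length es → HasC a₁ n
    withLast Uv Fv R es h₁ h₂ h₃ h₄ h₅ l with initLast es
    ... | mid ∷ʳ′ (vN , lN) = Final.result Uv Fv R mid vN lN h₁ h₂ h₃ h₄ h₅ (s≤s⁻¹ (≤-trans l (≤-reflexive (length-∷ʳ mid (vN , lN)))))

    split : ∀ us → KForm a₁ C₀ us → (∀ x → U x ≡ true → Free x → C₀ x ≡ true ⊎ x ∈ us) → 5 + suc (60 * n + 17) ≤ 4 + length us → HasC a₁ n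
    split [] nil _ (s≤s (s≤s (s≤s (s≤s ()))))
    split (v₁ ∷ us) k@(cons .v₁ l₁ Uv Fv Cv R k') mem l = withLast Uv Fv R (entries k')
      (All.map (λ { {w , _} (p , q , r) → p , q , λ e → proj₂ (add-false C₀ v₁ w r) (≡sym e) }) (En.entries-out k'))
      (En.entries-pairs k) (T-rows k (proj₁ (proj₂ (proj₂ C₀-sep))) (proj₂ (proj₂ (proj₂ C₀-sep))))
      (λ u p q → entries-∈ k (inUs u q (mem u p q)))
      (proj₂ (En.entries-separated nd₁ k (λ z p q → Λ₀ z , rows₀ a₁ z p q)))
      (≤-trans (s≤s⁻¹ (s≤s⁻¹ (s≤s⁻¹ (s≤s⁻¹ (s≤s⁻¹ l))))) (≤-reflexive (≡sym (entries-length k'))))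
      where
      inUs : ∀ u → Free u → C₀ u ≡ true ⊎ u ∈ v₁ ∷ us → u ∈ v₁ ∷ us
      inUs u _ (inj₂ i) = i
      inUs u F (inj₁ c) with C₀-true u c
      ... | inj₁ e = ⊥-elim (proj₁ F e)
      ... | inj₂ e = ⊥-elim (proj₁ (proj₂ F) e)

  kform⇒cycle : ∀ {us} → KForm a₁ C₀ us → (∀ x → U x ≡ true → Free x → C₀ x ≡ true ⊎ x ∈ us) → 60 * n + 23 ≤ 4 + length us → HasC a₁ n
  kform⇒cycle {us} k mem l = split us k mem (subst (_≤ 4 + length us) size-split l)

Big : ∀ {m} → Sub m → ℕ → Set
Big {m} U c = Σ (Fin c → Fin m) λ f → Injective _≡_ _≡_ f × (∀ i → U (f i) ≡ true)

-- There are 120 ordered pairs of non-commuting types, and one of them must have more than n / 2 turns.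
abstract
  size : ℕ → ℕ
  size n = 60 * n + 23

  size-≡ : ∀ n → size n ≡ 60 * n + 23
  size-≡ n = refl

module Core {m} (s s' t t' : Fin m) where
  open Ends s s' t t'

  module _ {a : Adj m} (gr : IsGraph a) (U : Sub m) (E : HasEnds U) (K : Kappa a U) (Mi : Minimal a U)
    (ss : a s s' ≡ true) (tt' : a t t' ≡ true) (s∉ : s ≢ t × s ≢ t') (s'∉ : s' ≢ t × s' ≢ t') where

    open Chains s s' t t' U
    open Rows s s' t t' U
    open Ground s s' t t' U s∉ s'∉
    private
      module ND = NonDegenerate gr E K Mi ss tt' s∉ s'∉

      chain-∈ : ∀ {b C vs} → Chain b C vs → ∀ x → U x ≡ true → Free x → C x ≡ true ⊎ x ∈ vs
      chain-∈ (done h) x p q = inj₁ (h x p q)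
      chain-∈ (step {C} v _ _ _ _ c) x p q with chain-∈ c x p q
      ... | inj₂ i = inj₂ (there i)
      ... | inj₁ r with add-true C v x r
      ... | inj₁ o = inj₁ o
      ... | inj₂ e = inj₂ (here e)

    module _ (n : ℕ) (3≤n : 3 ≤ n) (big : Big U (size n)) where

      private
        ch = chain gr E K Mi (length (allFin m)) (allFin m) ≤-refl C₀ C₀-sep
              (Λ₀ , (λ y → a s y , a s' y) , λ x y p q r o → rows₀ a x p q y r o) (λ x _ _ _ → ∈-allFin x)
        vs = proj₁ ch

        covered : ∀ x → U x ≡ true → x ∈ s ∷ s' ∷ t ∷ t' ∷ vs
        covered x p with x ≟ s | x ≟ s' | x ≟ t | x ≟ t'
        ... | yes e | _ | _ | _ = here e
        ... | no _ | yes e | _ | _ = there (here e)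
        ... | no _ | no _ | yes e | _ = there (there (here e))
        ... | no _ | no _ | no _ | yes e = there (there (there (here e)))
        ... | no q₁ | no q₂ | no q₃ | no q₄ with chain-∈ (proj₂ ch) x p (q₁ , q₂ , q₃ , q₄)
        ... | inj₂ i = there (there (there (there i)))
        ... | inj₁ c with C₀-true x c
        ... | inj₁ e = ⊥-elim (q₁ e)
        ... | inj₂ e = ⊥-elim (q₂ e)

        long : size n ≤ 4 + length vs
        long = injective⇒≤ {f = λ i → index (covered (proj₁ big i) (proj₂ (proj₂ big) i))}
          (λ {i} {j} e → proj₁ (proj₂ big) (trans (lookup-index (covered _ (proj₂ (proj₂ big) i))) (trans (cong (lookup (s ∷ s' ∷ t ∷ t' ∷ vs)) e) (≡sym (lookup-index (covered _ (proj₂ (proj₂ big) j)))))))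

        cv = convert gr (proj₂ ch) C₀-sep K E Λ₀ (rows₀ a)
        a₁ = proj₁ cv
        r₁ : U ⊢ a ⟿ a₁
        r₁ = proj₁ (proj₂ cv)
        gr₁ = ⟿-graph r₁ gr

        s≢s' : s ≢ s'
        s≢s' e = true≢false ss (subst (λ x → a s x ≡ false) e (irr gr s))

        t≢t' : t ≢ t'
        t≢t' e = true≢false tt' (subst (λ x → a t x ≡ false) e (irr gr t))

      abstract
        minimal⇒cycle : HasC a n
        minimal⇒cycle = ⟿-hasC r₁ (Finish.kform⇒cycle s s' t t' U a₁ gr₁ E s≢s' t≢t' s∉ s'∉
          (λ u w p q r o → ⟿-¬dep r₁ gr (ND.nonDep u w p q r o)) (⟿-¬dep r₁ gr ND.nonDep-s) (⟿-¬dep r₁ gr ND.nonDep-t) n 3≤n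
          (proj₂ (proj₂ (proj₂ cv))) (chain-∈ (proj₂ ch)) (subst (_≤ 4 + length vs) (size-≡ n) long))

  -- Minimizing may discard most of `U`, so largeness is demanded of every linked subset.
  linked⇒cycle : ∀ {a : Adj m} → IsGraph a → ∀ U → HasEnds U → Kappa a U → a s s' ≡ true → a t t' ≡ true → s ≢ t × s ≢ t' → s' ≢ t × s' ≢ t' →
    ∀ n → 3 ≤ n → (∀ U' → U' ⊑ U → HasEnds U' → Kappa a U' → Big U' (size n)) → HasC a n
  linked⇒cycle {a} gr U E K ss tt' s∉ s'∉ n 3≤n big =
    let (U' , sub , E' , K' , M) = minimize a U E K in
    minimal⇒cycle gr U' E' K' M ss tt' s∉ s'∉ n 3≤n (big U' sub E' K')

-- Connectivity along an induced path

does-true : ∀ {P : Set} (d : Dec P) → does d ≡ true → P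
does-true (yes p) _ = p

true-does : ∀ {P : Set} (d : Dec P) → P → does d ≡ true
true-does (yes _) _ = refl
true-does (no n) p = ⊥-elim (n p)

false-does : ∀ {P : Set} (d : Dec P) → ¬ P → does d ≡ false
false-does (yes p) n = ⊥-elim (n p)
false-does (no _) _ = refl

drop : ∀ (B : ℕ → Bool) lo k → B lo ≡ true → B (k + lo) ≡ false → Σ ℕ λ j → lo ≤ j × j < k + lo × B j ≡ true × B (suc j) ≡ false
drop B lo zero p q = ⊥-elim (true≢false p q)
drop B lo (suc k) p q with B (k + lo) in e
... | true = k + lo , m≤n+m lo k , ≤-refl , e , q
... | false = let (j , h₁ , h₂ , h) = drop B lo k p e in j , h₁ , <-trans h₂ (n<1+n _) , h

abstract
  drop-≤ : ∀ (B : ℕ → Bool) {lo hi} → lo ≤ hi → B lo ≡ true → B hi ≡ false → Σ ℕ λ j → lo ≤ j × j < hi × B j ≡ true × B (suc j) ≡ false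
  drop-≤ B {lo} {hi} l p q = let e = m∸n+n≡m l
                                 (j , h₁ , h₂ , h) = drop B lo (hi ∸ lo) p (trans (cong B e) q) in j , h₁ , subst (j <_) e h₂ , h

abstract
  rise-≤ : ∀ (B : ℕ → Bool) {lo hi} → lo ≤ hi → B lo ≡ false → B hi ≡ true → Σ ℕ λ j → lo ≤ j × j < hi × B j ≡ false × B (suc j) ≡ true
  rise-≤ B l p q = let (j , h₁ , h₂ , h₃ , h₄) = drop-≤ (λ i → not (B i)) l (cong not p) (cong not q) in j , h₁ , h₂ , not-true h₃ , not-false h₄

abstract
  4≤size : ∀ n → 4 ≤ size n
  4≤size n = subst (4 ≤_) (≡sym (size-≡ n)) (≤-trans (m≤n+m 4 19) (m≤n+m 23 (60 * n)))

module Paths {m} {a : Adj m} (gr : IsGraph a) (ℓ : ℕ) (p : ℕ → Fin m)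
  (p-adj : ∀ i j → i ≤ ℓ → j ≤ ℓ → a (p i) (p j) ≡ (suc i ≡ᵇ j) ∨ (suc j ≡ᵇ i))
  (p-inj : ∀ {i j} → i ≤ ℓ → j ≤ ℓ → p i ≡ p j → i ≡ j) (n : ℕ) (3≤n : 3 ≤ n) where

  sz : ℕ
  sz = size n

  p-step : ∀ i → i < ℓ → a (p i) (p (suc i)) ≡ true
  p-step i l = trans (p-adj i (suc i) (<⇒≤ l) l) (cong (_∨ (suc (suc i) ≡ᵇ i)) (≡ᵇ-refl (suc i)))

  p-step' : ∀ i → i < ℓ → a (p (suc i)) (p i) ≡ true
  p-step' i l = trans (symm gr _ _) (p-step i l)

  p-non : ∀ i j → i ≤ ℓ → j ≤ ℓ → suc i ≢ j → suc j ≢ i → a (p i) (p j) ≡ false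
  p-non i j l l' q r = trans (p-adj i j l l') (cong₂ _∨_ (≢⇒≡ᵇ-false q) (≢⇒≡ᵇ-false r))

  p-nbr : ∀ i j → i ≤ ℓ → j ≤ ℓ → a (p i) (p j) ≡ true → suc i ≡ j ⊎ suc j ≡ i
  p-nbr i j l l' e with suc i ≟ℕ j | suc j ≟ℕ i
  ... | yes q | _ = inj₁ q
  ... | no _ | yes r = inj₂ r
  ... | no q | no r = ⊥-elim (true≢false e (p-non i j l l' q r))

  far⇒≢ : ∀ {i j} → suc i < j → suc i ≢ j × suc j ≢ i
  far⇒≢ l = <⇒≢ l , λ { refl → <-asym l (<-trans (n<1+n _) (n<1+n _)) }

  abstract
    InSeg : ℕ → ℕ → Fin m → Set
    InSeg x y v = Σ ℕ λ j → j < suc y × x ≤ j × p j ≡ v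

    inSeg? : ∀ x y v → Dec (InSeg x y v)
    inSeg? x y v = anyUpTo? (λ j → (x ≤? j) ×-dec (p j ≟ v)) (suc y)

    seg : ℕ → ℕ → Sub m
    seg x y v = does (inSeg? x y v)

    seg-in : ∀ {x y} j → x ≤ j → j ≤ y → seg x y (p j) ≡ true
    seg-in {x} {y} j l l' = true-does (inSeg? x y (p j)) (j , s≤s l' , l , refl)

    seg-out : ∀ {x y} j → j ≤ ℓ → y ≤ ℓ → (j < x ⊎ y < j) → seg x y (p j) ≡ false
    seg-out {x} {y} j l l' o = false-does (inSeg? x y (p j)) (λ (i , h₁ , h₂ , e) → bad o (subst (x ≤_) (p-inj (≤-trans (s≤s⁻¹ h₁) l') l e) h₂) (subst (_≤ y) (p-inj (≤-trans (s≤s⁻¹ h₁) l') l e) (s≤s⁻¹ h₁)))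
      where
      bad : j < x ⊎ y < j → x ≤ j → j ≤ y → ⊥
      bad (inj₁ q) r _ = <-irrefl refl (<-≤-trans q r)
      bad (inj₂ q) _ r = <-irrefl refl (<-≤-trans q r)

    seg-elim : ∀ {x y v} → seg x y v ≡ true → Σ ℕ λ j → j < suc y × x ≤ j × p j ≡ v
    seg-elim {x} {y} {v} = does-true (inSeg? x y v)

  bigSeg : ∀ (U : Sub m) x y → y ≤ ℓ → x + sz ≤ y → (∀ j → x ≤ j → j ≤ y → U (p j) ≡ true) → Big U sz
  bigSeg U x y l l' h = (λ i → p (x + toℕ i)) ,
    (λ {i} {j} e → toℕ-injective (+-cancelˡ-≡ x _ _ (p-inj (bnd i) (bnd j) e))) ,
    λ i → h (x + toℕ i) (m≤m+n x (toℕ i)) (bnd' i)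
    where
    bnd' : ∀ (i : Fin sz) → x + toℕ i ≤ y
    bnd' i = ≤-trans (+-monoʳ-≤ x (<⇒≤ (toℕ<n i))) l'
    bnd : ∀ (i : Fin sz) → x + toℕ i ≤ ℓ
    bnd i = ≤-trans (bnd' i) l

  abstract
    size≥4 : ∀ {x y} → x + sz ≤ y → suc (suc (suc x)) < y
    size≥4 {x} {y} l = ≤-trans (≤-reflexive (+-comm 4 x)) (≤-trans (+-monoʳ-≤ x (4≤size n)) l)

  -- The linked set is `u` with the path from `p x` to `p y`. A separating cut splits an edge of
  -- this path before `p y'`, and rank 1 together with the edge from `u` to `p y` would join the
  -- first vertex of that edge to `p y`. If an inner vertex of the path is missing, the cut at the
  -- gap is crossed only by edges at `u`; so no linked subset misses one.
  hub⇒cycle : ∀ u x y' → suc y' ≤ ℓ → x + sz ≤ suc y' → (∀ j → j ≤ ℓ → u ≢ p j) → a u (p x) ≡ true → a u (p (suc y')) ≡ true → HasC a n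
  hub⇒cycle u x y' y≤ far u∉ ux uy = Core.linked⇒cycle u (p x) (p y) (p y') gr U
    (U-u , U-p x ≤-refl x≤y , U-p y x≤y ≤-refl , U-p y' x≤y' (n≤1+n y')) kappa ux (p-step' y' y≤) (u∉ y y≤ , u∉ y' y'≤)
    ((λ e → <⇒≢ x<y (p-inj x≤ y≤ e)) , (λ e → <⇒≢ x<y' (p-inj x≤ y'≤ e))) n 3≤n
    (λ U' sub E' K' → bigSeg U' x y y≤ far (essential U' sub E' K'))
    where
    y = suc y'
    y'≤ : y' ≤ ℓ
    y'≤ = <⇒≤ y≤
    x<y' : x < y'
    x<y' = s≤s⁻¹ (≤-trans (s≤s (s≤s (≤-trans (n≤1+n x) (n≤1+n _)))) (size≥4 far))
    x≤y' = <⇒≤ x<y'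
    x<y : x < y
    x<y = <-trans x<y' (n<1+n y')
    x≤y = <⇒≤ x<y
    x≤ : x ≤ ℓ
    x≤ = ≤-trans x≤y y≤
    U : Sub m
    U v = does (v ≟ u) ∨ seg x y v
    U-u : U u ≡ true
    U-u = cong (_∨ seg x y u) (true-does (u ≟ u) refl)
    ∨-r : ∀ b {c} → c ≡ true → b ∨ c ≡ true
    ∨-r true _ = refl
    ∨-r false e = e
    U-p : ∀ j → x ≤ j → j ≤ y → U (p j) ≡ true
    U-p j l l' = ∨-r (does (p j ≟ u)) (seg-in j l l')
    open Ends u (p x) (p y) (p y')
    kappa : Kappa a U
    kappa A (Au , Ax , Ay , Ay') (f , g , h) with drop-≤ (λ j → A (p j)) x≤y' Ax Ay'
    ... | (j , x≤j , j<y' , Aj , Aj') =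
      let fj = proj₁ (∧-true (trans (≡sym (h (p j) (p (suc j)) (U-p j x≤j (≤-trans (<⇒≤ j<y') (n≤1+n y'))) Aj (U-p (suc j) (≤-trans x≤j (n≤1+n j)) (≤-trans j<y' (n≤1+n y'))) Aj')) (p-step j (<-≤-trans j<y' y'≤))))
          gy = proj₂ (∧-true {f u} (trans (≡sym (h u (p y) U-u Au (U-p y x≤y ≤-refl) Ay)) uy)) in
      true≢false (trans (h (p j) (p y) (U-p j x≤j (≤-trans (<⇒≤ j<y') (n≤1+n y'))) Aj (U-p y x≤y ≤-refl) Ay) (cong₂ _∧_ fj gy))
        (p-non j y (≤-trans (<⇒≤ j<y') y'≤) y≤ (proj₁ (far⇒≢ (s≤s j<y'))) (proj₂ (far⇒≢ (s≤s j<y'))))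
    essential : ∀ U' → U' ⊑ U → HasEnds U' → Kappa a U' → ∀ j → x ≤ j → j ≤ y → U' (p j) ≡ true
    essential U' sub (_ , e₂ , e₃ , e₄) K' j x≤j j≤y with U' (p j) in Uj
    ... | true = refl
    ... | false with m≤n⇒m<n∨m≡n x≤j
    ... | inj₂ refl = ⊥-elim (true≢false e₂ Uj)
    essential U' sub (_ , e₂ , e₃ , e₄) K' zero _ _ | false | inj₁ ()
    essential U' sub (_ , e₂ , e₃ , e₄) K' (suc j) x≤j j≤y | false | inj₁ x<j with m≤n⇒m<n∨m≡n j≤y
    ... | inj₂ refl = ⊥-elim (true≢false e₃ Uj)
    ... | inj₁ j<y with m≤n⇒m<n∨m≡n (s≤s⁻¹ j<y)
    ... | inj₂ refl = ⊥-elim (true≢false e₄ Uj)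
    ... | inj₁ j<y' = ⊥-elim (K' A (cong (_∨ seg x j u) (true-does (u ≟ u) refl) , ∨-r (does (p x ≟ u)) (seg-in x ≤-refl (s≤s⁻¹ x<j)) ,
             cong₂ _∨_ (false-does (p y ≟ u) (λ e → u∉ y y≤ (≡sym e))) (seg-out y y≤ j≤ (inj₂ (<-trans (n<1+n j) j<y))) ,
             cong₂ _∨_ (false-does (p y' ≟ u) (λ e → u∉ y' y'≤ (≡sym e))) (seg-out y' y'≤ j≤ (inj₂ (<-trans (n<1+n j) j<y')))) ((λ v → does (v ≟ u)) , (λ w → a u w) , fac))
      where
      j≤ : j ≤ ℓ
      j≤ = ≤-trans (n≤1+n j) (≤-trans j≤y y≤)
      A : Sub m
      A v = does (v ≟ u) ∨ seg x j v
      fac : ∀ v w → U' v ≡ true → A v ≡ true → U' w ≡ true → A w ≡ false → a v w ≡ does (v ≟ u) ∧ a u w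
      fac v w Uv Av Uw Aw with v ≟ u
      ... | yes refl = refl
      ... | no v≢u with seg-elim Av
      ... | (i , i≤j , x≤i , refl) with ∨-false {does (w ≟ u)} Aw
      ... | (w≢u , w∉) = lemma (subst (λ b → b ∨ seg x y w ≡ true) w≢u (sub w Uw))
        where
        lemma : seg x y w ≡ true → a (p i) w ≡ false
        lemma Sw with seg-elim Sw
        ... | (k , k≤y , x≤k , refl) with <-cmp k (suc j)
        ... | tri< l _ _ = ⊥-elim (true≢false (seg-in k x≤k (s≤s⁻¹ l)) w∉)
        ... | tri≈ _ refl _ = ⊥-elim (true≢false Uw Uj)
        ... | tri> _ _ l = let o = far⇒≢ (≤-<-trans i≤j l) in p-non i k (≤-trans (s≤s⁻¹ i≤j) j≤) (≤-trans (s≤s⁻¹ k≤y) y≤) (proj₁ o) (proj₂ o)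

  module Gap (ℓ' : ℕ) (ℓ≡ : ℓ ≡ suc ℓ') (U : Sub m)
    (E : Ends.HasEnds (p 0) (p 1) (p ℓ) (p ℓ') U) (K : Ends.Kappa (p 0) (p 1) (p ℓ) (p ℓ') a U) where

    -- A separating cut splits an edge from `p j` to `p (suc j)` inside the block, and rank 1 then
    -- forces each crossing edge to leave `A` at a neighbour of `p (suc j)`. Some crossing edge does
    -- not: one of the path outside the block if `A` fails to separate the original end edges, and
    -- otherwise one inside `U`, which has no neighbours in the block.
    gap⇒cycle : ∀ i k' → i + sz ≤ suc k' → suc (suc k') < ℓ → (∀ u j → U u ≡ true → i ≤ j → j ≤ suc k' → a u (p j) ≡ false) → HasC a n
    gap⇒cycle i k' far k<ℓ free = Core.linked⇒cycle (p i) (p (suc i)) (p k) (p k') gr W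
      (W-p i i≤ , W-p (suc i) i₁≤ , W-p k k≤ , W-p k' k'≤) kappa (p-step i i₁≤) (p-step' k' k≤)
      ((λ e → <⇒≢ i<k (p-inj i≤ k≤ e)) , (λ e → <⇒≢ i<k' (p-inj i≤ k'≤ e))) ((λ e → <⇒≢ i₁<k (p-inj i₁≤ k≤ e)) , (λ e → <⇒≢ i₁<k' (p-inj i₁≤ k'≤ e))) n 3≤n
      (λ U' sub E' K' → bigSeg U' i k k≤ far (essential U' sub E' K'))
      where
      k = suc k'
      k≤ : k ≤ ℓ
      k≤ = ≤-trans (n≤1+n _) (<⇒≤ k<ℓ)
      k'≤ : k' ≤ ℓ
      k'≤ = <⇒≤ k≤
      i₁<k' : suc i < k'
      i₁<k' = s≤s⁻¹ (≤-trans (s≤s (s≤s (s≤s (n≤1+n i)))) (size≥4 far))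
      i<k' : i < k'
      i<k' = <-trans (n<1+n i) i₁<k'
      i<k : i < k
      i<k = <-trans i<k' (n<1+n k')
      i₁<k : suc i < k
      i₁<k = <-trans i₁<k' (n<1+n k')
      i≤ : i ≤ ℓ
      i≤ = ≤-trans (<⇒≤ i<k) k≤
      i₁≤ : suc i ≤ ℓ
      i₁≤ = ≤-trans (<⇒≤ i₁<k) k≤
      ∨-r : ∀ b {c} → c ≡ true → b ∨ c ≡ true
      ∨-r true _ = refl
      ∨-r false e = e
      W : Sub m
      W v = U v ∨ seg 0 ℓ v
      W-p : ∀ j → j ≤ ℓ → W (p j) ≡ true
      W-p j l = ∨-r (U (p j)) (seg-in j z≤n l)
      open Ends (p i) (p (suc i)) (p k) (p k')
      kappa : Kappa a W
      kappa A (A₁ , A₂ , A₃ , A₄) (f , g , h) with drop-≤ (λ j → A (p j)) (<⇒≤ i₁<k') A₂ A₄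
      ... | (j , i₁≤j , j<k' , Aj , Aj') = impossible
        where
        j'≤k' : suc j ≤ k'
        j'≤k' = j<k'
        j'≤ : suc j ≤ ℓ
        j'≤ = ≤-trans j<k' k'≤
        gj : g (p (suc j)) ≡ true
        gj = proj₂ (∧-true {f (p j)} (trans (≡sym (h (p j) (p (suc j)) (W-p j (≤-trans (n≤1+n j) j'≤)) Aj (W-p (suc j) j'≤) Aj')) (p-step j j'≤)))
        edge : ∀ v w → W v ≡ true → A v ≡ true → W w ≡ true → A w ≡ false → a v w ≡ true → a v (p (suc j)) ≡ false → ⊥
        edge v w Wv Av Ww Aw e e' = true≢false (trans (h v (p (suc j)) Wv Av (W-p (suc j) j'≤) Aj') (cong₂ _∧_ (proj₁ (∧-true (trans (≡sym (h v w Wv Av Ww Aw)) e))) gj)) e'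
        ℓ'<ℓ : ℓ' < ℓ
        ℓ'<ℓ = ≤-reflexive (≡sym ℓ≡)
        k<ℓ' : k < ℓ'
        k<ℓ' = s≤s⁻¹ (subst (suc k <_) ℓ≡ k<ℓ)
        impossible : ⊥
        impossible with A (p 0) in B₀
        ... | false = let (q , _ , q<i , Bq , Bq') = rise-≤ (λ j → A (p j)) z≤n B₀ A₁
                          q'≤ = ≤-trans q<i i≤ in
          edge (p (suc q)) (p q) (W-p (suc q) q'≤) Bq' (W-p q (<⇒≤ q'≤)) Bq (p-step' q q'≤)
            (let o = far⇒≢ (s≤s (≤-trans (s≤s q<i) i₁≤j)) in p-non (suc q) (suc j) q'≤ j'≤ (proj₁ o) (proj₂ o))
        ... | true with A (p ℓ) in Bℓ
        ... | true = let (q , k≤q , q<ℓ , Bq , Bq') = rise-≤ (λ j → A (p j)) k≤ A₃ Bℓ in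
          edge (p (suc q)) (p q) (W-p (suc q) q<ℓ) Bq' (W-p q (<⇒≤ q<ℓ)) Bq (p-step' q q<ℓ)
            (let o = far⇒≢ (s≤s (≤-trans (s≤s j'≤k') k≤q)) in p-non (suc q) (suc j) q<ℓ j'≤ (proj₂ o) (proj₁ o))
        ... | false with A (p 1) in B₁
        ... | false = edge (p 0) (p 1) (W-p 0 z≤n) B₀ (W-p 1 (≤-trans (s≤s z≤n) i₁≤)) B₁ (p-step 0 (≤-trans (s≤s z≤n) i₁≤))
            (let o = far⇒≢ {0} {suc j} (s≤s (≤-trans (s≤s z≤n) i₁≤j)) in p-non 0 (suc j) z≤n j'≤ (proj₁ o) (proj₂ o))
        ... | true with A (p ℓ') in Bℓ'
        ... | true = edge (p ℓ') (p ℓ) (W-p ℓ' (<⇒≤ ℓ'<ℓ)) Bℓ' (W-p ℓ ≤-refl) Bℓ (subst (λ x → a (p ℓ') (p x) ≡ true) (≡sym ℓ≡) (p-step ℓ' ℓ'<ℓ))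
            (let o = far⇒≢ {suc j} {ℓ'} (≤-<-trans (s≤s j'≤k') k<ℓ') in p-non ℓ' (suc j) (<⇒≤ ℓ'<ℓ) j'≤ (proj₂ o) (proj₁ o))
        -- Here `A` separates the two end edges of the whole path, so by `K` it cannot be free of
        -- crossing edges inside `U`.
        ... | false with any? (λ v → any? (λ w → ((U v ≟ᵇ true) ×-dec (A v ≟ᵇ true)) ×-dec (((U w ≟ᵇ true) ×-dec (A w ≟ᵇ false)) ×-dec (a v w ≟ᵇ true))))
        ... | yes (v , w , (Uv , Av) , (Uw , Aw) , e) = edge v w (cong (_∨ seg 0 ℓ v) Uv) Av (cong (_∨ seg 0 ℓ w) Uw) Aw e (free v (suc j) Uv (≤-trans (n≤1+n i) (≤-trans i₁≤j (n≤1+n j))) (≤-trans j'≤k' (n≤1+n k')))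
        ... | no none = K A (B₀ , B₁ , Bℓ , Bℓ') ((λ _ → false) , (λ _ → false) , noEdge)
          where
          noEdge : ∀ v w → U v ≡ true → A v ≡ true → U w ≡ true → A w ≡ false → a v w ≡ false
          noEdge v w q r q' r' with a v w in e
          ... | false = refl
          ... | true = ⊥-elim (none (v , w , (q , r) , (q' , r') , e))
      -- With `p j` missing, the part of the block before it has no neighbours in `U` and is joined
      -- to the rest only through `p i`, so it is a cut of rank at most 1.
      essential : ∀ U' → U' ⊑ W → HasEnds U' → Kappa a U' → ∀ j → i ≤ j → j ≤ k → U' (p j) ≡ true
      essential U' sub (e₁ , e₂ , e₃ , e₄) K' j i≤j j≤k with U' (p j) in Uj
      ... | true = refl
      ... | false with m≤n⇒m<n∨m≡n i≤j
      ... | inj₂ refl = ⊥-elim (true≢false e₁ Uj)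
      essential U' sub (e₁ , e₂ , e₃ , e₄) K' zero _ _ | false | inj₁ ()
      essential U' sub (e₁ , e₂ , e₃ , e₄) K' (suc j) i≤j j≤k | false | inj₁ i<j with m≤n⇒m<n∨m≡n i<j
      ... | inj₂ refl = ⊥-elim (true≢false e₂ Uj)
      ... | inj₁ i₁<j with m≤n⇒m<n∨m≡n j≤k
      ... | inj₂ refl = ⊥-elim (true≢false e₃ Uj)
      ... | inj₁ j<k with m≤n⇒m<n∨m≡n (s≤s⁻¹ j<k)
      ... | inj₂ refl = ⊥-elim (true≢false e₄ Uj)
      ... | inj₁ j<k' = ⊥-elim (K' A (seg-in i ≤-refl (s≤s⁻¹ i<j) , seg-in (suc i) (n≤1+n i) (s≤s⁻¹ i₁<j) ,
               seg-out k k≤ j≤ (inj₂ (<-trans (n<1+n j) j<k)) , seg-out k' k'≤ j≤ (inj₂ (<-trans (n<1+n j) j<k'))) ((λ v → does (v ≟ p i)) , (λ w → a (p i) w) , fac))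
        where
        j≤ : j ≤ ℓ
        j≤ = ≤-trans (n≤1+n j) (≤-trans j≤k k≤)
        A : Sub m
        A = seg i j
        fac : ∀ v w → U' v ≡ true → A v ≡ true → U' w ≡ true → A w ≡ false → a v w ≡ does (v ≟ p i) ∧ a (p i) w
        fac v w Uv Av Uw Aw with v ≟ p i
        ... | yes refl = refl
        ... | no v≢ with seg-elim Av
        ... | (q , q≤j , i≤q , refl) with U w in Uw'
        ... | true = trans (symm gr (p q) w) (free w q Uw' i≤q (≤-trans (s≤s⁻¹ q≤j) (≤-trans (n≤1+n j) j≤k)))
        ... | false with seg-elim (trans (≡sym (cong (_∨ seg 0 ℓ w) Uw')) (sub w Uw))
        ... | (r , r≤ , _ , refl) with a (p q) (p r) in e
        ... | false = refl
        ... | true with p-nbr q r (≤-trans (s≤s⁻¹ q≤j) j≤) (s≤s⁻¹ r≤) e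
        ... | inj₂ refl = ⊥-elim (true≢false (seg-in r i≤r (≤-trans (n≤1+n r) (s≤s⁻¹ q≤j))) Aw)
          where
          i≤r : i ≤ r
          i≤r with m≤n⇒m<n∨m≡n i≤q
          ... | inj₁ l = s≤s⁻¹ l
          ... | inj₂ refl = ⊥-elim (v≢ refl)
        ... | inj₁ refl with m≤n⇒m<n∨m≡n (s≤s⁻¹ q≤j)
        ... | inj₁ q<j = ⊥-elim (true≢false (seg-in (suc q) (≤-trans i≤q (n≤1+n q)) q<j) Aw)
        ... | inj₂ refl = ⊥-elim (true≢false Uw Uj)

-- Small minimal sets leave a free block of the path

lookup-unique : ∀ {A : Set} {xs : List A} → Unique xs → ∀ {i j} → lookup xs i ≡ lookup xs j → i ≡ j
lookup-unique (_ ∷ _) {zero} {zero} _ = refl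
lookup-unique (h ∷ _) {zero} {suc j} e = ⊥-elim (All.lookup h (∈-lookup j) e)
lookup-unique (h ∷ _) {suc i} {zero} e = ⊥-elim (All.lookup h (∈-lookup i) (≡sym e))
lookup-unique (_ ∷ u) {suc i} {suc j} e = cong suc (lookup-unique u e)

big-or-list : ∀ {m} (U : Sub m) c → Big U c ⊎ Σ (List (Fin m)) λ us → length us < c × (∀ x → U x ≡ true → x ∈ us)
big-or-list {m} U c with c ≤? length (filter (λ x → U x ≟ᵇ true) (allFin m))
... | yes l = inj₁ ((λ i → lookup us (inject≤ i l)) ,
    (λ e → inject≤-injective l l _ _ (lookup-unique (unique-filter (λ x → U x ≟ᵇ true) (allFin⁺ m)) e)) ,
    λ i → proj₂ (∈-filter⁻ (λ x → U x ≟ᵇ true) {xs = allFin m} (∈-lookup (inject≤ i l))))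
  where us = filter (λ x → U x ≟ᵇ true) (allFin m)
... | no l = inj₂ (_ , ≰⇒> l , λ x p → ∈-filter⁺ (λ x → U x ≟ᵇ true) (∈-allFin x) p)

abstract
  fresh : ∀ (F : List ℕ) → Σ ℕ λ q → q ≤ length F × q ∉ F
  fresh F with anyUpTo? (λ q → ¬? (q ∈? F)) (suc (length F))
  ... | yes (q , l , n) = q , s≤s⁻¹ l , n
  ... | no none = ⊥-elim (<-irrefl refl (injective⇒≤ {f = λ i → index (mem i)} (λ {i} {j} e → toℕ-injective
          (trans (lookup-index (mem i)) (trans (cong (lookup F) e) (≡sym (lookup-index (mem j))))))))
    where
    mem : (i : Fin (suc (length F))) → toℕ i ∈ F
    mem i = decidable-stable (toℕ i ∈? F) (λ n → none (toℕ i , toℕ<n i , n))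

  least : ∀ {P : ℕ → Set} → (∀ j → Dec (P j)) → ∀ N → (Σ ℕ λ x → x < N × P x × (∀ j → j < N → P j → x ≤ j)) ⊎ (∀ j → j < N → ¬ P j)
  least P? zero = inj₂ λ _ ()
  least P? (suc N) with P? 0 | least (λ j → P? (suc j)) N
  ... | yes p | _ = inj₁ (0 , s≤s z≤n , p , λ _ _ _ → z≤n)
  ... | no n | inj₁ (x , l , p , h) = inj₁ (suc x , s≤s l , p , λ { zero _ q → ⊥-elim (n q) ; (suc j) l' q → s≤s (h j (s≤s⁻¹ l') q) })
  ... | no n | inj₂ h = inj₂ λ { zero _ → n ; (suc j) l → h j (s≤s⁻¹ l) }

two-elements : ∀ {m} {A : Subset m} {x y} → x ∈ₛ A → y ∈ₛ A → y ≢ x → 2 ≤ ∣ A ∣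
two-elements p q r = ≤-<-trans (≤-<-trans z≤n (x∈p⇒∣p-x∣<∣p∣ (x∈p∧x≢y⇒x∈p-y q r))) (x∈p⇒∣p-x∣<∣p∣ p)

-- A separating cut has two vertices on each side, so at rank at most 1 it is a split; the two
-- factors, restricted to their sides, are the witnesses.
prime⇒kappa : ∀ G → Prime G → ∀ {s s' t t'} → s' ≢ s → t' ≢ t → Ends.Kappa s s' t t' (adj G) (λ _ → true)
prime⇒kappa G pr {s} {s'} {t} {t'} s'≢s t'≢t A (As , As' , At , At') (f , g , h) = pr (tabulate A)
  (two-elements (in⁺ A As) (in⁺ A As') s'≢s , two-elements (x∉p⇒x∈∁p (out⁺ A At)) (x∉p⇒x∈∁p (out⁺ A At')) t'≢t ,
   tabulate (λ x → A x ∧ f x) , tabulate (λ y → not (A y) ∧ g y) ,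
   (λ x p → in⁺ A (proj₁ (∧-true (in⁻ (λ x → A x ∧ f x) p)))) ,
   (λ y p q → true≢false (in⁻ A q) (not-true (proj₁ (∧-true (in⁻ (λ y → not (A y) ∧ g y) p))))) ,
   λ x y p q → let Ax = in⁻ A p ; Ay = out⁻ A q in
     (λ e → let (fx , gy) = ∧-true (trans (≡sym (h x y refl Ax refl Ay)) e) in
       in⁺ (λ x → A x ∧ f x) (cong₂ _∧_ Ax fx) , in⁺ (λ y → not (A y) ∧ g y) (cong₂ _∧_ (cong not Ay) gy)) ,
     λ p' q' → trans (h x y refl Ax refl Ay) (cong₂ _∧_ (proj₂ (∧-true {A x} (in⁻ (λ x → A x ∧ f x) p'))) (proj₂ (∧-true {not (A y)} (in⁻ (λ y → not (A y) ∧ g y) q')))))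
  where
  in⁺ : ∀ (B : Sub (m G)) {x} → B x ≡ true → x ∈ₛ tabulate B
  in⁺ B {x} e = lookup⇒[]= x (tabulate B) (trans (lookup∘tabulate B x) e)
  in⁻ : ∀ (B : Sub (m G)) {x} → x ∈ₛ tabulate B → B x ≡ true
  in⁻ B {x} e = trans (≡sym (lookup∘tabulate B x)) ([]=⇒lookup e)
  out⁺ : ∀ (B : Sub (m G)) {x} → B x ≡ false → x ∉ₛ tabulate B
  out⁺ B e q = true≢false (in⁻ B q) e
  out⁻ : ∀ (B : Sub (m G)) {x} → x ∉ₛ tabulate B → B x ≡ false
  out⁻ B {x} q with B x in e
  ... | false = refl
  ... | true = ⊥-elim (q (in⁺ B e))

module LongPath {m} {a : Adj m} (gr : IsGraph a) (ℓ : ℕ) (p : ℕ → Fin m)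
  (p-adj : ∀ i j → i ≤ ℓ → j ≤ ℓ → a (p i) (p j) ≡ (suc i ≡ᵇ j) ∨ (suc j ≡ᵇ i))
  (p-inj : ∀ {i j} → i ≤ ℓ → j ≤ ℓ → p i ≡ p j → i ≡ j) (n : ℕ) (3≤n : 3 ≤ n) where

  open Paths gr ℓ p p-adj p-inj n 3≤n

  -- A block of `b` consecutive path vertices spans `sz` edges, the length that `gap⇒cycle` asks
  -- for.
  b : ℕ
  b = suc sz

  -- Contacts that span less than one block length lie in two consecutive blocks, those numbered `q`
  -- and `suc q`.
  Local : Fin m → ℕ → Set
  Local u q = ∀ j → j ≤ ℓ → a u (p j) ≡ true → q * b ≤ j × j < suc (suc q) * b

  far-contacts⇒cycle : ∀ u x y → y ≤ ℓ → x + b ≤ y → a u (p x) ≡ true → a u (p y) ≡ true → HasC a n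
  far-contacts⇒cycle u x zero _ l with subst (_≤ 0) (+-suc x sz) l
  ... | ()
  far-contacts⇒cycle u x (suc y') y≤ l ux uy = hub⇒cycle u x y' y≤ (≤-trans (+-monoʳ-≤ x (n≤1+n sz)) l) off ux uy
    where
    far : suc (suc (suc x)) < suc y'
    far = size≥4 (≤-trans (+-monoʳ-≤ x (n≤1+n sz)) l)
    x≤ : x ≤ ℓ
    x≤ = ≤-trans (≤-trans (m≤m+n x b) l) y≤
    -- A vertex of the path has its neighbours on the path at most two apart.
    off : ∀ j → j ≤ ℓ → u ≢ p j
    off j j≤ refl with p-nbr j x j≤ x≤ ux | p-nbr j (suc y') j≤ y≤ uy
    ... | inj₁ refl | inj₁ refl = <-irrefl refl (<-trans (<-trans (n<1+n _) (n<1+n _)) (<-trans (n<1+n _) far))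
    ... | inj₁ refl | inj₂ refl = <-irrefl refl (<-trans (<-trans (n<1+n _) (n<1+n _)) (<-trans (<-trans (n<1+n _) (n<1+n _)) (<-trans (n<1+n _) far)))
    ... | inj₂ refl | inj₁ refl = <-irrefl refl (<-trans (n<1+n _) far)
    ... | inj₂ refl | inj₂ refl = <-irrefl refl (<-trans (<-trans (n<1+n _) (n<1+n _)) (<-trans (n<1+n _) far))

  abstract
    local-or-cycle : ∀ u → HasC a n ⊎ Σ ℕ (Local u)
    local-or-cycle u with least (λ j → a u (p j) ≟ᵇ true) (suc ℓ)
    ... | inj₂ none = inj₂ (0 , λ j l e → ⊥-elim (none j (s≤s l) e))
    ... | inj₁ (x , x≤ , ux , low) with anyUpTo? (λ y → (x + b ≤? y) ×-dec (a u (p y) ≟ᵇ true)) (suc ℓ)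
    ... | yes (y , y≤ , l , uy) = inj₁ (far-contacts⇒cycle u x y (s≤s⁻¹ y≤) l ux uy)
    ... | no none = inj₂ (x / b , λ j l e → ≤-trans (m/n*n≤m x b) (low j (s≤s l) e) , <-≤-trans (≰⇒> (λ f → none (j , s≤s l , f , e))) end)
      where
      end : x + b ≤ suc (suc (x / b)) * b
      end = ≤-trans (≤-reflexive (+-comm x b)) (+-monoʳ-≤ b (≤-trans (≤-reflexive (m≡m%n+[m/n]*n x b)) (+-monoˡ-≤ (x / b * b) (<⇒≤ (m%n<n x b)))))

    locals-or-cycle : ∀ us → HasC a n ⊎ Σ (List ℕ) λ qs → length qs ≡ length us × (∀ u → u ∈ us → Σ ℕ λ q → q ∈ qs × Local u q)
    locals-or-cycle [] = inj₂ ([] , refl , λ _ ())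
    locals-or-cycle (u ∷ us) with local-or-cycle u | locals-or-cycle us
    ... | inj₁ c | _ = inj₁ c
    ... | inj₂ _ | inj₁ c = inj₁ c
    ... | inj₂ (q , h) | inj₂ (qs , e , k) = inj₂ (q ∷ qs , cong suc e ,
      λ { _ (here refl) → q , here refl , h ; v (there i) → let (r , j , g) = k v i in r , there j , g })

  module _ (K : Ends.Kappa (p 0) (p 1) (p ℓ) (p (pred ℓ)) a (λ _ → true)) (long : suc (suc (2 * sz * b + sz)) ≤ ℓ) where

    private
      ℓ' : ℕ
      ℓ' = pred ℓ

      ℓ≡ : ℓ ≡ suc ℓ'
      ℓ≡ = go long
        where
        go : ∀ {x y} → suc x ≤ y → y ≡ suc (pred y)
        go (s≤s _) = refl

      4≤sz : 4 ≤ sz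
      4≤sz = 4≤size n

      4<ℓ : 4 < ℓ
      4<ℓ = ≤-trans (s≤s (≤-trans 4≤sz (≤-trans (m≤n+m sz (2 * sz * b)) (n≤1+n _)))) long

      ℓ'≤ : ℓ' ≤ ℓ
      ℓ'≤ = ≤-trans (n≤1+n ℓ') (≤-reflexive (≡sym ℓ≡))

      3<ℓ' : 3 < ℓ'
      3<ℓ' = s≤s⁻¹ (≤-trans 4<ℓ (≤-reflexive ℓ≡))

      apart : ∀ {i j} → i < j → j ≤ ℓ → p i ≢ p j
      apart l l' e = <⇒≢ l (p-inj (≤-trans (<⇒≤ l) l') l' e)

    clear⇒cycle : ∀ U → Ends.HasEnds (p 0) (p 1) (p ℓ) (p ℓ') U → Ends.Kappa (p 0) (p 1) (p ℓ) (p ℓ') a U → ∀ i k → i + sz ≤ k → suc k < ℓ →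
      (∀ u j → U u ≡ true → i ≤ j → j ≤ k → a u (p j) ≡ false) → HasC a n
    clear⇒cycle U E K' i zero l = ⊥-elim (contra (≤-trans (≤-trans 4≤sz (m≤n+m sz i)) l))
      where
      contra : ¬ (4 ≤ 0)
      contra ()
    clear⇒cycle U E K' i (suc k') l = Gap.gap⇒cycle ℓ' ℓ≡ U E K' i k' l

    -- A set of fewer than `sz` vertices touches at most two blocks per vertex, so one of the blocks
    -- `0` to `2 * sz` is free. The assumed length is what keeps the last of these blocks clear of
    -- the end of the path.
    longPath⇒cycle : HasC a n
    longPath⇒cycle with Ends.minimize (p 0) (p 1) (p ℓ) (p ℓ') a (λ _ → true) (refl , refl , refl , refl) K
    ... | (U , _ , E , K' , M) with big-or-list U sz
    ... | inj₁ big = Core.minimal⇒cycle (p 0) (p 1) (p ℓ) (p ℓ') gr U E K' M (p-step 0 (<-trans (s≤s z≤n) 4<ℓ))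
            (trans (symm gr _ _) (trans (cong (λ x → a (p ℓ') (p x)) ℓ≡) (p-step ℓ' (≤-reflexive (≡sym ℓ≡)))))
            (apart (<-trans (s≤s z≤n) 4<ℓ) ≤-refl , apart (<-trans (s≤s z≤n) 3<ℓ') ℓ'≤)
            (apart (<-trans (s≤s (s≤s z≤n)) 4<ℓ) ≤-refl , apart (<-trans (s≤s (s≤s z≤n)) 3<ℓ') ℓ'≤) n 3≤n big
    ... | inj₂ (us , few , cov) with locals-or-cycle us
    ... | inj₁ c = c
    ... | inj₂ (qs , len , loc) with fresh (qs ++ map suc qs)
    ... | (q , q≤ , q∉) = clear⇒cycle U E K' (q * b) (q * b + sz) ≤-refl fits clear
      where
      q≤' : q ≤ 2 * sz
      q≤' = ≤-trans q≤ (≤-trans (≤-reflexive (trans (length-++ qs) (cong₂ _+_ len (trans (length-map suc qs) len))))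
              (+-mono-≤ (<⇒≤ few) (≤-trans (<⇒≤ few) (m≤m+n sz 0))))
      fits : suc (q * b + sz) < ℓ
      fits = ≤-trans (s≤s (s≤s (+-monoˡ-≤ sz (*-monoˡ-≤ b q≤')))) long
      clear : ∀ u j → U u ≡ true → q * b ≤ j → j ≤ q * b + sz → a u (p j) ≡ false
      clear u j Uu l l' with a u (p j) in e
      ... | false = refl
      ... | true with loc u (cov u Uu)
      ... | (r , r∈ , h) with h j (<⇒≤ (≤-<-trans l' (<-trans (n<1+n _) fits))) e
      ... | (h₁ , h₂) with m≤n⇒m<n∨m≡n (s≤s⁻¹ (*-cancelʳ-< b r (suc q) (≤-<-trans h₁ (≤-<-trans l' (≤-reflexive (cong suc (+-comm (q * b) sz)))))))
      ... | inj₂ refl = ⊥-elim (q∉ (∈-++⁺ˡ r∈))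
      ... | inj₁ r<q with ≤-antisym (s≤s⁻¹ (*-cancelʳ-< b q (suc (suc r)) (≤-<-trans l h₂))) r<q
      ... | refl = ⊥-elim (q∉ (∈-++⁺ʳ qs (∈-map⁺ suc r∈)))

-- Short cycles and the bound

lc-induced : ∀ {m k} {a : Adj m} {e : Adj k} (h : Fin k → Fin m) → Injective _≡_ _≡_ h →
  (∀ i j → a (h i) (h j) ≡ e i j) → ∀ v i j → lcAdj a (h v) (h i) (h j) ≡ lcAdj e v i j
lc-induced h h-inj h-adj v i j with h i ≟ h j | i ≟ j
... | yes _ | yes _ = h-adj i j
... | no _ | no _ = cong₂ _xor_ (h-adj i j) (cong₂ _∧_ (h-adj v i) (h-adj v j))
... | yes q | no r = ⊥-elim (r (h-inj q))
... | no q | yes r = ⊥-elim (q (cong h r))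

lcSeq-induced : ∀ {m k} {a : Adj m} {e : Adj k} (h : Fin k → Fin m) → Injective _≡_ _≡_ h →
  (∀ i j → a (h i) (h j) ≡ e i j) → ∀ vs i j → lcSeq a (map h vs) (h i) (h j) ≡ lcSeq e vs i j
lcSeq-induced h h-inj h-adj [] = h-adj
lcSeq-induced h h-inj h-adj (v ∷ vs) = lcSeq-induced h h-inj (lc-induced h h-inj h-adj v) vs

hasC-induced : ∀ {m k} {a : Adj m} {e : Adj k} (h : Fin k → Fin m) → Injective _≡_ _≡_ h →
  (∀ i j → a (h i) (h j) ≡ e i j) → ∀ {n} → HasC e n → HasC a n
hasC-induced h h-inj h-adj (vs , f , f-inj , c) = map h vs , (λ i → h (f i)) , (λ q → f-inj (h-inj q)) ,
  λ i j → trans (lcSeq-induced h h-inj h-adj vs (f i) (f j)) (c i j)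

path⇒C₃ : HasC (pathAdj 3) 3
path⇒C₃ = suc zero ∷ [] , first₃ , (λ {i} {j} → inj i j) , from-yes (all? λ i → all? λ j → lcSeq (pathAdj 3) (suc zero ∷ []) (first₃ i) (first₃ j) ≟ᵇ cycleAdj 3 i j)
  where
  first₃ : Fin 3 → Fin 4
  first₃ i = inject≤ i (n≤1+n 3)
  inj : ∀ i j → first₃ i ≡ first₃ j → i ≡ j
  inj = from-yes (all? λ i → all? λ j → (first₃ i ≟ first₃ j) →-dec (i ≟ j))

-- The three complementations form the pivot on the middle edge: the ends become adjacent and the
-- middle vertices exchange their outer neighbours, which leaves the cycle 0, 2, 1, 3.
path⇒C₄ : HasC (pathAdj 3) 4
path⇒C₄ = vs , order , (λ {i} {j} → inj i j) , from-yes (all? λ i → all? λ j → lcSeq (pathAdj 3) vs (order i) (order j) ≟ᵇ cycleAdj 4 i j)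
  where
  vs : List (Fin 4)
  vs = suc zero ∷ suc (suc zero) ∷ suc zero ∷ []
  order : Fin 4 → Fin 4
  order zero = zero
  order (suc zero) = suc (suc zero)
  order (suc (suc zero)) = suc zero
  order (suc (suc (suc zero))) = suc (suc (suc zero))
  inj : ∀ i j → order i ≡ order j → i ≡ j
  inj = from-yes (all? λ i → all? λ j → (order i ≟ order j) →-dec (i ≟ j))

module PathVertices {m} (a : Adj m) (ℓ : ℕ) (copy : InducedCopy (suc ℓ) (pathAdj ℓ) a) where

  -- Indices beyond ℓ are sent to the last vertex of the path.
  index⊓ : ℕ → Fin (suc ℓ)
  index⊓ i = fromℕ< (s≤s (m⊓n≤n i ℓ))

  toℕ-index⊓ : ∀ {i} → i ≤ ℓ → toℕ (index⊓ i) ≡ i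
  toℕ-index⊓ {i} l = trans (toℕ-fromℕ< (s≤s (m⊓n≤n i ℓ))) (m≤n⇒m⊓n≡m l)

  vertex : ℕ → Fin m
  vertex i = proj₁ copy (index⊓ i)

  vertex-adj : ∀ i j → i ≤ ℓ → j ≤ ℓ → a (vertex i) (vertex j) ≡ (suc i ≡ᵇ j) ∨ (suc j ≡ᵇ i)
  vertex-adj i j l l' = trans (proj₂ (proj₂ copy) (index⊓ i) (index⊓ j)) (trans (pathAdj-≡ ℓ (index⊓ i) (index⊓ j))
    (cong₂ (λ x y → (suc x ≡ᵇ y) ∨ (suc y ≡ᵇ x)) (toℕ-index⊓ l) (toℕ-index⊓ l')))

  vertex-inj : ∀ {i j} → i ≤ ℓ → j ≤ ℓ → vertex i ≡ vertex j → i ≡ j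
  vertex-inj l l' e = trans (≡sym (toℕ-index⊓ l)) (trans (cong toℕ (proj₁ (proj₂ copy) e)) (toℕ-index⊓ l'))

  path₃ : 3 ≤ ℓ → ∀ {n} → HasC (pathAdj 3) n → HasC a n
  path₃ l = hasC-induced (λ i → vertex (toℕ i)) (λ {i} {j} e → toℕ-injective (vertex-inj (le i) (le j) e))
    (λ i j → trans (vertex-adj (toℕ i) (toℕ j) (le i) (le j)) (≡sym (pathAdj-≡ 3 i j)))
    where
    le : ∀ (i : Fin 4) → toℕ i ≤ ℓ
    le i = ≤-trans (s≤s⁻¹ (toℕ<n i)) l

abstract
  ≤-bound : ∀ {x n} → x * 4 ≤ 27 * n ^ 7 + 3 → x ≤ bound n
  ≤-bound {x} l = ≤-trans (≤-reflexive (≡sym (m*n/n≡m x 4))) (/-monoˡ-≤ 4 l)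

  -- Four times the left side is at most `34584 * (n * n)`, and 27 · 5⁵ = 84375 = 34584 + 49791. For
  -- `n` equal to 3 or 4 the left side exceeds `bound n`, so these cases are treated apart.
  size-small : ∀ n → 5 ≤ n → suc (suc (2 * size n * suc (size n) + size n)) ≤ bound n
  size-small n 5≤n = ≤-bound {n = n} (begin
    suc (suc (2 * size n * suc (size n) + size n)) * 4 ≡⟨ expand (size n) ⟩
    8 * (size n * suc (size n)) + 4 * suc (suc (size n)) ≤⟨ +-mono-≤ (*-monoʳ-≤ 8 (*-mono-≤ S≤ S₁≤)) (*-monoʳ-≤ 4 S₂≤) ⟩
    8 * ((65 * n) * (66 * n)) + 4 * (66 * n * n) ≡⟨ collect n ⟩
    34584 * (n * n) ≤⟨ *-monoˡ-≤ (n * n) (≤-trans (m≤m+n 34584 49791) (*-monoʳ-≤ 27 (^-monoˡ-≤ 5 5≤n))) ⟩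
    27 * n ^ 5 * (n * n) ≡⟨ power n (n ^ 5) ⟩
    27 * n ^ 7 ≤⟨ m≤m+n (27 * n ^ 7) 3 ⟩
    27 * n ^ 7 + 3 ∎)
    where
    open ≤-Reasoning
    expand : ∀ S → suc (suc (2 * S * suc S + S)) * 4 ≡ 8 * (S * suc S) + 4 * suc (suc S)
    expand = solve-∀
    collect : ∀ n → 8 * ((65 * n) * (66 * n)) + 4 * (66 * n * n) ≡ 34584 * (n * n)
    collect = solve-∀
    power : ∀ n y → 27 * y * (n * n) ≡ 27 * (n * (n * y))
    power = solve-∀
    split65 : ∀ n → 60 * n + 5 * n ≡ 65 * n
    split65 = solve-∀
    split66 : ∀ n → 65 * n + n ≡ 66 * n
    split66 = solve-∀
    S+2≤ : suc (suc (size n)) ≤ 65 * n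
    S+2≤ = begin
      suc (suc (size n)) ≡⟨ cong (λ x → suc (suc x)) (size-≡ n) ⟩
      2 + (60 * n + 23) ≡⟨ +-comm 2 (60 * n + 23) ⟩
      60 * n + 23 + 2 ≡⟨ +-assoc (60 * n) 23 2 ⟩
      60 * n + 25 ≤⟨ +-monoʳ-≤ (60 * n) (*-monoʳ-≤ 5 5≤n) ⟩
      60 * n + 5 * n ≡⟨ split65 n ⟩
      65 * n ∎
    65≤66 : 65 * n ≤ 66 * n
    65≤66 = ≤-trans (m≤m+n (65 * n) n) (≤-reflexive (split66 n))
    S₁≤ : suc (size n) ≤ 66 * n
    S₁≤ = ≤-trans (n≤1+n _) (≤-trans S+2≤ 65≤66)
    S≤ : size n ≤ 65 * n
    S≤ = ≤-trans (n≤1+n _) (≤-trans (n≤1+n _) S+2≤)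
    S₂≤ : suc (suc (size n)) ≤ 66 * n * n
    S₂≤ = ≤-trans S+2≤ (≤-trans 65≤66 (≤-trans (≤-reflexive (≡sym (*-identityʳ (66 * n)))) (*-monoʳ-≤ (66 * n) (≤-trans (s≤s z≤n) 5≤n))))

  3≤bound₃ : 3 ≤ bound 3
  3≤bound₃ = ≤-bound {n = 3} (from-yes (12 ≤? 27 * 3 ^ 7 + 3))

  3≤bound₄ : 3 ≤ bound 4
  3≤bound₄ = ≤-bound {n = 4} (from-yes (12 ≤? 27 * 4 ^ 7 + 3))

prime∧longPath⇒cycle : ∀ ℓ (n : ℕ) → 3 ≤ n → suc (suc (2 * size n * suc (size n) + size n)) ≤ ℓ → (G : Graph) → Prime G →
    HasInducedPath G ℓ → HasC (adj G) n
prime∧longPath⇒cycle ℓ n 3≤n long G pr copy = LongPath.longPath⇒cycle (isGraph (Defs.sym G) (irref G)) ℓ vertex vertex-adj vertex-inj n 3≤n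
  (prime⇒kappa G pr (λ e → 1≢0 (vertex-inj 1≤ z≤n e)) (λ e → <⇒≢ (go long) (vertex-inj (pred[n]≤n {ℓ}) ≤-refl e))) long
  where
  open PathVertices (adj G) ℓ copy
  1≢0 : 1 ≢ 0
  1≢0 ()
  1≤ : 1 ≤ ℓ
  1≤ = ≤-trans (s≤s z≤n) long
  go : ∀ {x y} → suc x ≤ y → pred y < y
  go (s≤s _) = ≤-refl

theorem6p1 : (n : ℕ) → 3 ≤ n → (G : Graph) → Prime G →
    HasInducedPath G (bound n) → HasCycleVertexMinor G n
theorem6p1 0 ()
theorem6p1 1 (s≤s ())
theorem6p1 2 (s≤s (s≤s ()))
theorem6p1 3 _ G pr copy = PathVertices.path₃ (adj G) (bound 3) copy 3≤bound₃ path⇒C₃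
theorem6p1 4 _ G pr copy = PathVertices.path₃ (adj G) (bound 4) copy 3≤bound₄ path⇒C₄
theorem6p1 n@(suc (suc (suc (suc (suc _))))) 3≤n G pr copy = prime∧longPath⇒cycle (bound n) n 3≤n (size-small n (s≤s (s≤s (s≤s (s≤s (s≤s z≤n)))))) G pr copy
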